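{- Let $n \ge 3$, let $G$ be a dihedral group of order $2n$, and let $S$ be a sequence over $G$. (1) Suppose $n \ge 4$ is even. Then the following are equivalent: (a) $|S| = \mathsf s(G) - 1$ and $S$ has no product-one subsequence of length $\exp(G) = n$; (b) there exist $\alpha, \tau \in G$ with $G = \langle \alpha,\tau \mid \alpha^n=\tau^2=1_G,\ \tau\alpha=\alpha^{ -1}\tau\rangle$ and $S = (\alpha^{r_1})^{[n-1]} \boldsymbol{\cdot} (\alpha^{r_2})^{[n-1]} \boldsymbol{\cdot} \alpha^{r_3}\tau$ for some $r_1,r_2,r_3 \in [0,n-1]$ with $\gcd(r_1-r_2,n)=1$. (2) The following are equivalent: (a) $|S| = \mathsf E(G) - 1$ and $S$ has no product-one subsequence of length $|G|$; (b) there exist $\alpha,\tau \in G$ with $G = \langle \alpha,\tau \mid \alpha^n=\tau^2=1_G,\ \tau\alpha=\alpha^{ -1}\tau\rangle$ such that either (i) $n \ge 4$ and $S = (\alpha^{r_1})^{[2n-1]} \boldsymbol{\cdot} (\alpha^{r_2})^{[n-1]} \boldsymbol{\cdot} \alpha^{r_3}\tau$ with $r_1,r_2,r_3 \in [0,n-1]$ and $\gcd(r_1-r_2,n)=1$; or (ii) $n=3$ and either $S = 1_G^{[5]} \boldsymbol{\cdot} \tau \boldsymbol{\cdot} \alpha\tau \boldsymbol{\cdot} \alpha^2\tau$, or $S = (\alpha^{t_1})^{[5]} \boldsymbol{\cdot} (\alpha^{t_2})^{[2]} \boldsymbol{\cdot} \alpha^{t_3}\tau$ with $t_1,t_2,t_3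 \in [0,2]$ and $\gcd(t_1-t_2,3)=1$.
   Context: A sequence over a finite group $G$ is a finite unordered list of elements of $G$ with repetitions allowed; $|S|$ is its length, a subsequence is a sub-multiset, $S_1 \boldsymbol{\cdot} S_2$ denotes concatenation and $g^{[k]}$ denotes the sequence consisting of $g$ repeated $k$ times. A sequence is product-one if its terms can be ordered so that their product equals $1_G$. $\exp(G) = \operatorname{lcm}\{\operatorname{ord}(g) \mid g\in G\}$. $\mathsf s(G)$ (resp. $\mathsf E(G)$) is the smallest integer $\ell$ such that every sequence over $G$ of length at least $\ell$ has a product-one subsequence of length $\exp(G)$ (resp. $|G|$). For integers $a\le b$, $[a,b]=\{x\in\mathbb Z \mid a\le x\le b\}$. A dihedral group of order $2n$ is a group with presentation $\langle \alpha,\tau \mid \alpha^n=\tau^2=1,\ \tau\alpha=\alpha^{ -1}\tau\rangle$. -}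

module Defs where

open import Data.Nat using (ℕ; zero; suc; _+_; _∸_; _≤_; NonZero)
open import Data.Nat.DivMod using (_mod_)
open import Data.Nat.LCM using (lcm)
open import Data.Fin using (Fin; toℕ)
open import Data.Fin.Properties using () renaming (_≟_ to _≟ᶠ_)
open import Data.Bool using (Bool; true; false; if_then_else_; _xor_)
open import Data.Bool.Properties using () renaming (_≟_ to _≟ᵇ_)
open import Data.Product using (_×_; _,_; Σ; ∃; ∃-syntax; Σ-syntax)
open import Data.Product.Properties using (≡-dec)
open import Data.List using (List; []; _∷_; _++_; length; foldr; map; allFin; cartesianProduct)
open import Data.List.Relation.Binary.Permutation.Propositional using (_↭_)
open import Relation.Binary.PropositionalEquality using (_≡_)
open import Relation.Nullary using (¬_; yes; no; Dec)

-- Concrete model of the dihedral group of order 2n.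
-- (i , false) stands for ρ^i, (i , true) stands for ρ^i σ, where ρ, σ are
-- the standard generators (ρ^n = σ^2 = 1, σρ = ρ^{-1}σ).

D : (n : ℕ) → Set
D n = Fin n × Bool

module _ (n : ℕ) .{{_ : NonZero n}} where

  addF : Fin n → Fin n → Fin n
  addF i j = (toℕ i + toℕ j) mod n

  negF : Fin n → Fin n
  negF i = (n ∸ toℕ i) mod n

  one : D n
  one = (0 mod n , false)

  mul : D n → D n → D n
  mul (i , a) (j , b) = ((if a then addF i (negF j) else addF i j) , a xor b)

  inv : D n → D n
  inv (i , false) = (negF i , false)
  inv (i , true)  = (i , true)

  pow : D n → ℕ → D n
  pow g zero    = one
  pow g (suc k) = mul g (pow g k)

  prod : List (D n) → D n
  prod = foldr mul one

  elements : List (D n)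
  elements = cartesianProduct (allFin n) (true ∷ false ∷ [])

  -- order of an element: least k ≥ 1 with g^k = 1 (searched in [1, 2n],
  -- the order of any element divides |G| = 2n)
  ordSearch : D n → ℕ → ℕ → ℕ
  ordSearch g k zero = 0
  ordSearch g k (suc fuel) with ≡-dec _≟ᶠ_ _≟ᵇ_ (pow g k) one
  ... | yes _ = k
  ... | no  _ = ordSearch g (suc k) fuel

  ord : D n → ℕ
  ord g = ordSearch g 1 (n + n)

  expD : ℕ
  expD = foldr lcm 1 (map ord elements)

  ProductOne : List (D n) → Set
  ProductOne S = ∃[ T ] (S ↭ T × prod T ≡ one)

  HasP1Sub : ℕ → List (D n) → Set
  HasP1Sub k S = ∃[ T ] ∃[ U ] (S ↭ T ++ U × length T ≡ k × ProductOne T)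

  -- ℓ has the defining property of s(G) (resp. E(G) with k = |G|):
  -- every sequence of length ≥ ℓ has a product-one subsequence of length k
  Forces : ℕ → ℕ → Set
  Forces k ℓ = ∀ (S : List (D n)) → ℓ ≤ length S → HasP1Sub k S

  -- α, τ give a dihedral presentation of G:
  -- α^n = τ^2 = 1, τα = α^{-1}τ, and the canonical map from the group
  -- ⟨α,τ | …⟩ (normal forms α^i τ^b, 0 ≤ i < n) to G is bijective.
  normalForm : D n → D n → Fin n × Bool → D n
  normalForm α τ (i , false) = pow α (toℕ i)
  normalForm α τ (i , true)  = mul (pow α (toℕ i)) τ

  Presentation : D n → D n → Set
  Presentation α τ =
      pow α n ≡ one
    × mul τ τ ≡ one
    × mul τ α ≡ mul (inv α) τ
    × (∀ (x y : Fin n × Bool) → normalForm α τ x ≡ normalForm α τ y → x ≡ y)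
    × (∀ (g : D n) → ∃[ x ] (normalForm α τ x ≡ g))

IsLeast : (ℕ → Set) → ℕ → Set
IsLeast P ℓ = P ℓ × (∀ m → P m → ℓ ≤ m)

module _ (n : ℕ) .{{_ : NonZero n}} where
  open import Data.Nat using (_∸_; ∣_-_∣)
  open import Data.Nat.GCD using (gcd)
  open import Data.Sum using (_⊎_)
  open import Data.List using (replicate)

  CaseE : D n → D n → List (D n) → Set
  CaseE α τ S =
      (4 ≤ n × ∃[ r₁ ] ∃[ r₂ ] Σ[ r₃ ∈ Fin n ]
         (gcd ∣ toℕ {n} r₁ - toℕ {n} r₂ ∣ n ≡ 1
          × S ↭ replicate (n + n ∸ 1) (pow n α (toℕ r₁)) ++ replicate (n ∸ 1) (pow n α (toℕ r₂))
                  ++ (mul n (pow n α (toℕ r₃)) τ ∷ [])))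
    ⊎ (n ≡ 3 ×
         ((S ↭ replicate 5 (one n) ++ (τ ∷ mul n α τ ∷ mul n (pow n α 2) τ ∷ []))
          ⊎ ∃[ t₁ ] ∃[ t₂ ] Σ[ t₃ ∈ Fin n ]
              (gcd ∣ toℕ {n} t₁ - toℕ {n} t₂ ∣ 3 ≡ 1
               × S ↭ replicate 5 (pow n α (toℕ t₁)) ++ replicate 2 (pow n α (toℕ t₂))
                       ++ (mul n (pow n α (toℕ t₃)) τ ∷ []))))

-- Split S into rotations ρ^a and reflections ρ^b σ, and let L be n or 2n, so that
-- |S| = L + n − 1 in both parts. A sequence containing reflections has product one, for a
-- suitable order, as soon as some signed sum of its exponents vanishes, with equally many plus
-- and minus signs among the reflections.
--
-- If a reflection occurs twice, it makes all signs of rotations available. The remaining terms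
-- are then used up in pairs of equal terms and in quadruples with x − x′ + y − y′ = 0, which
-- for n ≥ 4 exist among any n + 1 distinct terms by the pigeonhole principle.
--
-- If the reflections are distinct, translate the rotations so that a value of maximal
-- multiplicity h becomes 0, and split off zero-sum blocks of length at most h + 1 as long as
-- possible (Gao). The rest R has no short zero-sum subsequence, so by Scherk's theorem the sums
-- of at most h terms of R take |R| + 1 values. For two or more reflections these values meet the
-- differences that the reflections provide, up to one exception for n = 3. For one reflection R
-- has n − 1 terms, and is constant because the bound of Scherk's theorem is not attained by a
-- nonconstant R.
{-# OPTIONS --safe #-}
module Submission where

open import Defs
open import Algebra.Bundles using (AbelianGroup)
open import Algebra.Structures using (IsAbelianGroup)
import Algebra.Properties.CommutativeMonoid.Mult as Mult
import Algebra.Properties.Group as GroupProperties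
open import Data.Bool using (Bool; true; false; not)
open import Data.Bool.Properties using (not-involutive; not-injective) renaming (_≟_ to _≟ᵇ_)
open import Data.Empty using (⊥; ⊥-elim)
open import Data.Fin using (Fin; toℕ)
open import Data.Fin.Patterns
open import Data.Fin.Properties using (toℕ-injective; fromℕ<-cong; toℕ-fromℕ<; toℕ<n; injective⇒≤) renaming (_≟_ to _≟ᶠ_)
open import Data.List using (List; _∷_; []; [_]; _++_; length; map; foldr; filter; replicate; lookup; cartesianProduct)
open import Data.List.Properties using (length-++; filter-++; length-map; map-++; map-id; map-cong; map-∘; length-replicate; map-replicate; ++-identityʳ; filter-notAll)
open import Data.List.Membership.Propositional using (_∈_; _∉_; find; lose)
open import Data.List.Membership.Propositional.Properties using (∈-++⁺ˡ; ∈-++⁺ʳ; ∈-++⁻; ∈-∃++; ∈-map⁺; ∈-map⁻; ∈-filter⁻; ∈-lookup; ∈-allFin; ∈-cartesianProduct⁺; ∈-cartesianProduct⁻)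
import Data.List.Membership.DecPropositional as DecMembership
open import Data.List.Relation.Binary.Permutation.Propositional renaming (trans to step)
open import Data.List.Relation.Binary.Permutation.Propositional.Properties hiding (++-identityʳ)
open import Data.List.Relation.Unary.All as All using ([]; _∷_; all?)
open import Data.List.Relation.Unary.All.Properties using (¬All⇒Any¬; ¬Any⇒All¬; All¬⇒¬Any)
open import Data.List.Relation.Unary.AllPairs using ([]; _∷_)
open import Data.List.Relation.Unary.Any using (here; there; any?)
open import Data.List.Relation.Unary.Unique.Propositional using (Unique)
import Data.List.Relation.Unary.Unique.Propositional.Properties as Uniqueₚ
open import Data.Nat using (ℕ; zero; suc; pred; _+_; _*_; _≤_; _<_; NonZero; >-nonZero; ∣_-_∣; _∸_; z≤n; s≤s)
open import Data.Nat.Coprimality using (coprime-divisor; gcd≡1⇒coprime) renaming (sym to coprime-sym)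
open import Data.Nat.Divisibility
open import Data.Nat.DivMod using (_/_; _%_; _mod_; m%n<n; m<n⇒m%n≡m; n%n≡0; m*n%n≡0; %-distribˡ-+; m≡m%n+[m/n]*n; [m+kn]%n≡m%n)
open import Data.Nat.GCD using (gcd; gcd[m,n]∣m; gcd[m,n]∣n)
open import Data.Nat.LCM using (lcm; m∣lcm[m,n]; n∣lcm[m,n]; lcm-least)
open import Data.Nat.Properties
open import Data.Nat.Tactic.RingSolver using () renaming (solve-∀ to ringℕ-∀)
open import Data.Product using (_×_; _,_; ∃; ∃₂; ∃-syntax; Σ-syntax; proj₁; proj₂)
open import Data.Product.Properties using (≡-dec)
open import Data.Sum using (_⊎_; inj₁; inj₂; [_,_]′)
open import Data.Vec using (Vec; []; _∷_; zipWith; _[_]≔_) renaming (lookup to lookupᵛ; replicate to replicateᵛ)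
open import Function using (_∘_)
open import Relation.Binary.Definitions using (DecidableEquality)
open import Relation.Binary.PropositionalEquality hiding ([_])
open import Relation.Nullary using (¬_; Dec; yes; no; ¬?; contradiction)
open import Relation.Nullary.Decidable using (_×-dec_)
open import Relation.Unary using (Decidable)

-- Why blocks of at most `h + 1` terms: they are split off while `length U + h < L`, so one more
-- cannot carry the removed part `U` beyond `L`; and once `length U + h ≥ L`, copies of the most
-- frequent rotation, zero after translation, fill `U` up to length `L`. If no block is left before
-- that, the missing length `s = L - length U - h` must come from reflections. Scherk's bound gives
-- `|R| < n`, hence `s ≤ |B|`, and for `s ≥ 2` the pigeonhole principle succeeds. For `s = 1` this
-- count is short by one; with two reflections a rotation then has to be moved between them, which
-- changes its sign. Of the integers modulo `n` the additive part uses that `n · x = 0`, that at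
-- most `n` elements are distinct and that at most one has order two. The last fact decides the
-- equality case: the three nonzero elements of the Klein four-group attain Scherk's bound without
-- being equal. The values of `s(G)`, for even `n`, and of `E(G)` are consequences of the inverse
-- theorem, not ingredients of it.

-- Linear arithmetic: a goal L ≤ R follows from a hypothesis l ≤ r as soon as
-- L + r plus a slack equals R + l.
≤-from : ∀ {l r} L R k → l ≤ r → L + r + k ≡ R + l → L ≤ R
≤-from {l} {r} L R k l≤r eq = +-cancelʳ-≤ l L R (begin
  L + l      ≤⟨ +-monoʳ-≤ L l≤r ⟩
  L + r      ≤⟨ m≤m+n (L + r) k ⟩
  L + r + k  ≡⟨ eq ⟩
  R + l      ∎)
  where open ≤-Reasoning

≡-from : ∀ {l r} L R → l ≡ r → L + r ≡ R + l → L ≡ R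
≡-from {l} L R refl eq = +-cancelʳ-≡ l L R eq

-- Lists up to permutation, multiplicities and distinctness.

module _ {A : Set} where

  ∈⇒↭ : ∀ {x : A} {xs} → x ∈ xs → ∃ λ xs′ → xs ↭ x ∷ xs′
  ∈⇒↭ {x} x∈xs with ∈-∃++ x∈xs
  ... | as , bs , refl = as ++ bs , shift x as bs

  ∷↭++ : ∀ {x : A} {xs ys zs} → x ∷ xs ↭ ys ++ zs →
         (∃ λ ys′ → ys ↭ x ∷ ys′ × xs ↭ ys′ ++ zs) ⊎
         (∃ λ zs′ → zs ↭ x ∷ zs′ × xs ↭ ys ++ zs′)
  ∷↭++ {x} {xs} {ys} {zs} p with ∈-++⁻ ys (∈-resp-↭ p (here refl))
  ... | inj₁ x∈ys with ys′ , q ← ∈⇒↭ x∈ys =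
    inj₁ (ys′ , q , drop-∷ (↭-trans p (++⁺ʳ zs q)))
  ... | inj₂ x∈zs with zs′ , q ← ∈⇒↭ x∈zs =
    inj₂ (zs′ , q , drop-∷ (↭-trans p (↭-trans (++⁺ˡ ys q) (shift x ys zs′))))

  ∈∈⇒↭ : ∀ {x y : A} {xs} → x ∈ xs → y ∈ xs → x ≢ y → ∃ λ xs′ → xs ↭ x ∷ y ∷ xs′
  ∈∈⇒↭ x∈ y∈ x≢y with xs′ , p ← ∈⇒↭ x∈ with ∈-resp-↭ p y∈
  ... | here y≡x = contradiction (sym y≡x) x≢y
  ... | there y∈′ = let xs″ , q = ∈⇒↭ y∈′ in xs″ , ↭-trans p (prep _ q)

  length-filter-¬ : ∀ {P : A → Set} (P? : Decidable P) xs →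
    length (filter P? xs) + length (filter (¬? ∘ P?) xs) ≡ length xs
  length-filter-¬ P? [] = refl
  length-filter-¬ P? (x ∷ xs) with P? x
  ... | yes _ = cong suc (length-filter-¬ P? xs)
  ... | no  _ = trans (+-suc _ _) (cong suc (length-filter-¬ P? xs))

  Unique-∷ : ∀ {x : A} {xs} → x ∉ xs → Unique xs → Unique (x ∷ xs)
  Unique-∷ x∉ u = ¬Any⇒All¬ _ x∉ ∷ u

  Unique-↭ : ∀ {xs ys : List A} → xs ↭ ys → Unique xs → Unique ys
  Unique-↭ refl u = u
  Unique-↭ (prep x p) (x∉ ∷ u) = All-resp-↭ p x∉ ∷ Unique-↭ p u
  Unique-↭ (swap x y p) ((x≢y ∷ x∉) ∷ y∉ ∷ u) =
    ((λ y≡x → x≢y (sym y≡x)) ∷ All-resp-↭ p y∉) ∷ All-resp-↭ p x∉ ∷ Unique-↭ p u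
  Unique-↭ (step p q) u = Unique-↭ q (Unique-↭ p u)

  Unique-++ˡ : ∀ xs {ys : List A} → Unique (xs ++ ys) → Unique xs
  Unique-++ˡ [] u = []
  Unique-++ˡ (x ∷ xs) (x∉ ∷ u) =
    Unique-∷ (λ x∈ → All¬⇒¬Any x∉ (∈-++⁺ˡ x∈)) (Unique-++ˡ xs u)

  Unique-++ʳ : ∀ xs {ys : List A} → Unique (xs ++ ys) → Unique ys
  Unique-++ʳ [] u = u
  Unique-++ʳ (x ∷ xs) (x∉ ∷ u) = Unique-++ʳ xs u

module Counting {A : Set} (_≟_ : DecidableEquality A) where

  open DecMembership _≟_ public using (_∈?_)

  count : A → List A → ℕ
  count x xs = length (filter (x ≟_) xs)

  count-++ : ∀ x xs ys → count x (xs ++ ys) ≡ count x xs + count x ys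
  count-++ x xs ys = trans (cong length (filter-++ (x ≟_) xs ys)) (length-++ (filter (x ≟_) xs))

  count-↭ : ∀ x {xs ys} → xs ↭ ys → count x xs ≡ count x ys
  count-↭ x p = ↭-length (filter-↭ (x ≟_) p)

  count-∉ : ∀ {x xs} → x ∉ xs → count x xs ≡ 0
  count-∉ {x} {[]} x∉ = refl
  count-∉ {x} {y ∷ xs} x∉ with x ≟ y
  ... | yes x≡y = contradiction (here x≡y) x∉
  ... | no  _   = count-∉ (x∉ ∘ there)

  count-∈ : ∀ {x xs} → x ∈ xs → 1 ≤ count x xs
  count-∈ {x} {y ∷ xs} x∈ with x ≟ y
  ... | yes _ = s≤s z≤n
  count-∈ (here x≡y) | no x≢y = contradiction x≡y x≢y
  count-∈ (there x∈) | no x≢y = count-∈ x∈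

  count-replicate : ∀ x k → count x (replicate k x) ≡ k
  count-replicate x zero = refl
  count-replicate x (suc k) with x ≟ x
  ... | yes _  = cong suc (count-replicate x k)
  ... | no x≢x = contradiction refl x≢x

  count≤-++ʳ : ∀ {h R} Q {V} → R ↭ Q ++ V → (∀ x → count x R ≤ h) → ∀ x → count x V ≤ h
  count≤-++ʳ {h} {R} Q {V} p c≤ x = ≤-trans
    (≤-trans (m≤n+m (count x V) (count x Q))
             (≤-reflexive (sym (trans (count-↭ x p) (count-++ x Q V))))) (c≤ x)

  extract : ∀ x xs → ∃ λ ys → xs ↭ replicate (count x xs) x ++ ys × x ∉ ys
  extract x [] = [] , ↭-refl , λ ()
  extract x (y ∷ xs) with extract x xs
  ... | ys , p , x∉ with x ≟ y
  ... | yes refl = ys , prep x p , x∉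
  ... | no  x≢y  = y ∷ ys
    , ↭-trans (prep y p) (↭-sym (shift y (replicate (count x xs) x) ys))
    , λ { (here x≡y) → x≢y x≡y ; (there x∈) → x∉ x∈ }

  -- The superlevel set {x : count x R ≥ 1} split off from R.
  support : ∀ R → ∃₂ λ B R′ → R ↭ B ++ R′ × Unique B × (∀ {x} → x ∈ R → x ∈ B)
  support [] = [] , [] , ↭-refl , [] , λ ()
  support (x ∷ R) with support R
  ... | B , R′ , p , u , sup with x ∈? B
  ... | yes x∈B = B , x ∷ R′ , ↭-trans (prep x p) (↭-sym (shift x B R′)) , u ,
                  λ { (here refl) → x∈B ; (there y∈) → sup y∈ }
  ... | no  x∉B = x ∷ B , R′ , prep x p , Unique-∷ x∉B u ,
                  λ { (here refl) → here refl ; (there y∈) → there (sup y∈) }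

  -- `B` takes at least one copy of every element of `R`. The bound on multiplicities therefore
  -- drops by one, which drives the induction in `growthFrom`.
  count-residual : ∀ {R B R′ h} → R ↭ B ++ R′ → (∀ {x} → x ∈ R → x ∈ B) →
                   (∀ x → count x R ≤ suc h) → ∀ x → count x R′ ≤ h
  count-residual {R} {B} {R′} {h} p sup c≤ x with x ∈? R
  ... | yes x∈ = ≤-pred (≤-trans (≤-trans (+-monoˡ-≤ (count x R′) (count-∈ (sup x∈)))
        (≤-reflexive (sym (trans (count-↭ x p) (count-++ x B R′))))) (c≤ x))
  ... | no x∉ = ≤-trans (≤-reflexive
        (count-∉ (λ x∈ → x∉ (∈-resp-↭ (↭-sym p) (∈-++⁺ʳ B x∈))))) z≤n

  maxCount : ∀ a xs → ∃ λ c → c ∈ a ∷ xs × (∀ x → count x (a ∷ xs) ≤ count c (a ∷ xs))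
  maxCount a xs = let c , c∈ , c≥ = go a xs in c , c∈ , λ x → below c≥ x
    where
    S = a ∷ xs
    go : ∀ b ys → ∃ λ c → c ∈ b ∷ ys × (∀ {x} → x ∈ b ∷ ys → count x S ≤ count c S)
    go b [] = b , here refl , λ { (here refl) → ≤-refl }
    go b (y ∷ ys) with go y ys
    ... | c , c∈ , c≥ with ≤-total (count b S) (count c S)
    ... | inj₁ b≤c = c , there c∈ , λ { (here refl) → b≤c ; (there x∈) → c≥ x∈ }
    ... | inj₂ c≤b = b , here refl , λ { (here refl) → ≤-refl ; (there x∈) → ≤-trans (c≥ x∈) c≤b }
    below : ∀ {c} → (∀ {x} → x ∈ S → count x S ≤ count c S) → ∀ x → count x S ≤ count c S
    below c≥ x with x ∈? S
    ... | yes x∈ = c≥ x∈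
    ... | no  x∉ = ≤-trans (≤-reflexive (count-∉ x∉)) z≤n

  ¬Unique⇒repeat : ∀ xs → ¬ Unique xs → ∃₂ λ x ys → xs ↭ x ∷ x ∷ ys
  ¬Unique⇒repeat [] ¬u = contradiction [] ¬u
  ¬Unique⇒repeat (x ∷ xs) ¬u with x ∈? xs
  ... | yes x∈ = let ys , p = ∈⇒↭ x∈ in x , ys , prep x p
  ... | no  x∉ =
    let y , ys , p = ¬Unique⇒repeat xs (¬u ∘ Unique-∷ x∉)
    in y , x ∷ ys , ↭-trans (prep x p) (↭-trans (swap x y ↭-refl) (prep y (swap x y ↭-refl)))

  unique? : ∀ xs → Dec (Unique xs)
  unique? [] = yes []
  unique? (x ∷ xs) with x ∈? xs | unique? xs
  ... | yes x∈ | _ = no λ { (x∉ ∷ _) → All¬⇒¬Any x∉ x∈ }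
  ... | no x∉ | yes u = yes (Unique-∷ x∉ u)
  ... | no x∉ | no ¬u = no λ { (_ ∷ u) → ¬u u }

odd? : ℕ → Bool
odd? zero = false
odd? (suc k) = not (odd? k)

odd?-double : ∀ k → odd? (k + k) ≡ false
odd?-double zero = refl
odd?-double (suc k) = cong not (trans (cong odd? (+-suc k k)) (cong not (odd?-double k)))

-- Abelian groups: a linear solver, sums and alternating sums.

module AbelianSums {G : Set} (_∙_ : G → G → G) (𝟘 : G) (_⁻¹ : G → G)
  (isAbelianGroup : IsAbelianGroup _≡_ _∙_ 𝟘 _⁻¹) where

  infixl 6 _⊕_ _⊟_
  infix 8 ⊖_

  _⊕_ : G → G → G
  x ⊕ y = x ∙ y

  ⊖_ : G → G
  ⊖ x = x ⁻¹

  abelianGroup : AbelianGroup _ _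
  abelianGroup = record { isAbelianGroup = isAbelianGroup }

  private module AG = AbelianGroup abelianGroup
  open Mult AG.commutativeMonoid public
    using (×-homo-+; ×-assocˡ; ×-distrib-+) renaming (_×_ to _·_)
  private module GP = GroupProperties AG.group

  _⊟_ : G → G → G
  x ⊟ y = x ⊕ ⊖ y

  data Expr (k : ℕ) : Set where
    var  : Fin k → Expr k
    _:+_ : Expr k → Expr k → Expr k
    _:-_ : Expr k → Expr k → Expr k
    :-_  : Expr k → Expr k
    :0   : Expr k

  infixl 6 _:+_ _:-_
  infix 8 :-_

  ⟦_⟧ : ∀ {k} → Expr k → Vec G k → G
  ⟦ var i ⟧ ρ = lookupᵛ ρ i
  ⟦ e :+ f ⟧ ρ = ⟦ e ⟧ ρ ⊕ ⟦ f ⟧ ρ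
  ⟦ e :- f ⟧ ρ = ⟦ e ⟧ ρ ⊟ ⟦ f ⟧ ρ
  ⟦ :- e ⟧ ρ = ⊖ ⟦ e ⟧ ρ
  ⟦ :0 ⟧ ρ = 𝟘

  private
    _⊞_ : ∀ {k} → Vec ℕ k → Vec ℕ k → Vec ℕ k
    _⊞_ = zipWith _+_

    -- Coefficients are natural numbers, with the negative ones kept apart, so that the comparison
    -- of two normal forms computes and is closed by `refl`.
    pos neg : ∀ {k} → Expr k → Vec ℕ k
    pos (var i)  = replicateᵛ _ 0 [ i ]≔ 1
    pos (e :+ f) = pos e ⊞ pos f
    pos (e :- f) = pos e ⊞ neg f
    pos (:- e)   = neg e
    pos :0       = replicateᵛ _ 0
    neg (var i)  = replicateᵛ _ 0
    neg (e :+ f) = neg e ⊞ neg f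
    neg (e :- f) = neg e ⊞ pos f
    neg (:- e)   = pos e
    neg :0       = replicateᵛ _ 0

    lin : ∀ {k} → Vec ℕ k → Vec G k → G
    lin [] [] = 𝟘
    lin (c ∷ cs) (x ∷ ρ) = c · x ⊕ lin cs ρ

    interchange : ∀ a b c d → (a ⊕ b) ⊕ (c ⊕ d) ≡ (a ⊕ c) ⊕ (b ⊕ d)
    interchange a b c d = begin
      (a ⊕ b) ⊕ (c ⊕ d)  ≡⟨ AG.assoc a b (c ⊕ d) ⟩
      a ⊕ (b ⊕ (c ⊕ d))  ≡⟨ cong (a ⊕_) (sym (AG.assoc b c d)) ⟩
      a ⊕ ((b ⊕ c) ⊕ d)  ≡⟨ cong (λ z → a ⊕ (z ⊕ d)) (AG.comm b c) ⟩
      a ⊕ ((c ⊕ b) ⊕ d)  ≡⟨ cong (a ⊕_) (AG.assoc c b d) ⟩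
      a ⊕ (c ⊕ (b ⊕ d))  ≡⟨ sym (AG.assoc a c (b ⊕ d)) ⟩
      (a ⊕ c) ⊕ (b ⊕ d)  ∎
      where open ≡-Reasoning

    lin-0 : ∀ {k} (ρ : Vec G k) → lin (replicateᵛ k 0) ρ ≡ 𝟘
    lin-0 [] = refl
    lin-0 (x ∷ ρ) = trans (AG.identityˡ _) (lin-0 ρ)

    lin-var : ∀ {k} (i : Fin k) ρ → lin (replicateᵛ k 0 [ i ]≔ 1) ρ ≡ lookupᵛ ρ i
    lin-var Fin.zero (x ∷ ρ) = trans (cong₂ _⊕_ (AG.identityʳ x) (lin-0 ρ)) (AG.identityʳ x)
    lin-var (Fin.suc i) (x ∷ ρ) = trans (AG.identityˡ _) (lin-var i ρ)

    lin-⊞ : ∀ {k} (v w : Vec ℕ k) ρ → lin (v ⊞ w) ρ ≡ lin v ρ ⊕ lin w ρ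
    lin-⊞ [] [] [] = sym (AG.identityˡ 𝟘)
    lin-⊞ (c ∷ v) (d ∷ w) (x ∷ ρ) =
      trans (cong₂ _⊕_ (×-homo-+ x c d) (lin-⊞ v w ρ)) (interchange _ _ _ _)

    minus : ∀ a b c → a ⊕ b ≡ c → ⊖ a ⊕ c ≡ b
    minus a b c refl = GP.\\-leftDividesʳ a b

    sound : ∀ {k} (e : Expr k) ρ → ⟦ e ⟧ ρ ⊕ lin (neg e) ρ ≡ lin (pos e) ρ
    sound (var i) ρ = trans (cong (lookupᵛ ρ i ⊕_) (lin-0 ρ))
                            (trans (AG.identityʳ _) (sym (lin-var i ρ)))
    sound (e :+ f) ρ = begin
      (⟦ e ⟧ ρ ⊕ ⟦ f ⟧ ρ) ⊕ lin (neg e ⊞ neg f) ρ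
        ≡⟨ cong ((⟦ e ⟧ ρ ⊕ ⟦ f ⟧ ρ) ⊕_) (lin-⊞ (neg e) (neg f) ρ) ⟩
      (⟦ e ⟧ ρ ⊕ ⟦ f ⟧ ρ) ⊕ (lin (neg e) ρ ⊕ lin (neg f) ρ) ≡⟨ interchange _ _ _ _ ⟩
      (⟦ e ⟧ ρ ⊕ lin (neg e) ρ) ⊕ (⟦ f ⟧ ρ ⊕ lin (neg f) ρ)
        ≡⟨ cong₂ _⊕_ (sound e ρ) (sound f ρ) ⟩
      lin (pos e) ρ ⊕ lin (pos f) ρ ≡⟨ sym (lin-⊞ (pos e) (pos f) ρ) ⟩
      lin (pos e ⊞ pos f) ρ ∎
      where open ≡-Reasoning
    sound (e :- f) ρ = begin
      (⟦ e ⟧ ρ ⊕ ⊖ ⟦ f ⟧ ρ) ⊕ lin (neg e ⊞ pos f) ρ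
        ≡⟨ cong ((⟦ e ⟧ ρ ⊟ ⟦ f ⟧ ρ) ⊕_) (lin-⊞ (neg e) (pos f) ρ) ⟩
      (⟦ e ⟧ ρ ⊕ ⊖ ⟦ f ⟧ ρ) ⊕ (lin (neg e) ρ ⊕ lin (pos f) ρ) ≡⟨ interchange _ _ _ _ ⟩
      (⟦ e ⟧ ρ ⊕ lin (neg e) ρ) ⊕ (⊖ ⟦ f ⟧ ρ ⊕ lin (pos f) ρ)
        ≡⟨ cong₂ _⊕_ (sound e ρ) (minus _ _ _ (sound f ρ)) ⟩
      lin (pos e) ρ ⊕ lin (neg f) ρ ≡⟨ sym (lin-⊞ (pos e) (neg f) ρ) ⟩
      lin (pos e ⊞ neg f) ρ ∎
      where open ≡-Reasoning
    sound (:- e) ρ = minus _ _ _ (sound e ρ)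
    sound :0 ρ = AG.identityˡ _

  -- Two expressions agree once their positive and negative parts balance,
  -- which is decided by evaluation of coefficient vectors.
  solve : ∀ {k} (ρ : Vec G k) (e f : Expr k) → pos e ⊞ neg f ≡ pos f ⊞ neg e →
          ⟦ e ⟧ ρ ≡ ⟦ f ⟧ ρ
  solve ρ e f eq = GP.∙-cancelʳ (lin (neg e) ρ ⊕ lin (neg f) ρ) _ _ (begin
    ⟦ e ⟧ ρ ⊕ (lin (neg e) ρ ⊕ lin (neg f) ρ)  ≡⟨ sym (AG.assoc _ _ _) ⟩
    (⟦ e ⟧ ρ ⊕ lin (neg e) ρ) ⊕ lin (neg f) ρ  ≡⟨ cong (_⊕ _) (sound e ρ) ⟩
    lin (pos e) ρ ⊕ lin (neg f) ρ              ≡⟨ sym (lin-⊞ (pos e) (neg f) ρ) ⟩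
    lin (pos e ⊞ neg f) ρ                      ≡⟨ cong (λ v → lin v ρ) eq ⟩
    lin (pos f ⊞ neg e) ρ                      ≡⟨ lin-⊞ (pos f) (neg e) ρ ⟩
    lin (pos f) ρ ⊕ lin (neg e) ρ              ≡⟨ cong (_⊕ _) (sym (sound f ρ)) ⟩
    (⟦ f ⟧ ρ ⊕ lin (neg f) ρ) ⊕ lin (neg e) ρ  ≡⟨ AG.assoc _ _ _ ⟩
    ⟦ f ⟧ ρ ⊕ (lin (neg f) ρ ⊕ lin (neg e) ρ)  ≡⟨ cong (⟦ f ⟧ ρ ⊕_) (AG.comm _ _) ⟩
    ⟦ f ⟧ ρ ⊕ (lin (neg e) ρ ⊕ lin (neg f) ρ)  ∎)
    where open ≡-Reasoning

  -- The group counterpart of `≡-from`: a linear consequence of an equation becomes an identity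
  -- without hypotheses, which `solve` settles.
  ≡-diff : ∀ {l r L R} → l ≡ r → L ⊟ R ≡ l ⊟ r → L ≡ R
  ≡-diff {l} {_} {L} {R} refl eq = GP.x∙y⁻¹≈ε⇒x≈y L R (trans eq (AG.inverseʳ l))

  ⊕-cancelˡ : ∀ a {b c} → a ⊕ b ≡ a ⊕ c → b ≡ c
  ⊕-cancelˡ a {b} {c} = GP.∙-cancelˡ a b c

  ⊕-identityˡ : ∀ a → 𝟘 ⊕ a ≡ a
  ⊕-identityˡ = AG.identityˡ

  ⊕-identityʳ : ∀ a → a ⊕ 𝟘 ≡ a
  ⊕-identityʳ = AG.identityʳ

  ·-𝟘 : ∀ k → k · 𝟘 ≡ 𝟘
  ·-𝟘 zero = refl
  ·-𝟘 (suc k) = trans (⊕-identityˡ _) (·-𝟘 k)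

  Σ : List G → G
  Σ = foldr _⊕_ 𝟘

  Σ-++ : ∀ xs ys → Σ (xs ++ ys) ≡ Σ xs ⊕ Σ ys
  Σ-++ [] ys = sym (⊕-identityˡ _)
  Σ-++ (x ∷ xs) ys = trans (cong (x ⊕_) (Σ-++ xs ys)) (sym (AG.assoc x (Σ xs) (Σ ys)))

  Σ-↭ : ∀ {xs ys} → xs ↭ ys → Σ xs ≡ Σ ys
  Σ-↭ refl = refl
  Σ-↭ (prep x p) = cong (x ⊕_) (Σ-↭ p)
  Σ-↭ (swap x y p) = trans (cong (λ s → x ⊕ (y ⊕ s)) (Σ-↭ p))
    (solve (x ∷ y ∷ _ ∷ []) (var 0F :+ (var 1F :+ var 2F)) (var 1F :+ (var 0F :+ var 2F)) refl)
  Σ-↭ (step p q) = trans (Σ-↭ p) (Σ-↭ q)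

  Σ-replicate : ∀ k x → Σ (replicate k x) ≡ k · x
  Σ-replicate zero x = refl
  Σ-replicate (suc k) x = cong (x ⊕_) (Σ-replicate k x)

  Σ-map-⊕ : ∀ c xs → Σ (map (c ⊕_) xs) ≡ length xs · c ⊕ Σ xs
  Σ-map-⊕ c [] = sym (⊕-identityˡ 𝟘)
  Σ-map-⊕ c (x ∷ xs) = trans (cong ((c ⊕ x) ⊕_) (Σ-map-⊕ c xs)) (interchange c x _ _)

  -- The exponent of a product of reflections: each reflection negates all exponents to its right.
  alternate : List G → G
  alternate [] = 𝟘
  alternate (b ∷ F) = b ⊟ alternate F

  regroup-sum : ∀ a b d {ab} → ab ≡ a ⊕ b → a ⊕ (b ⊕ d) ≡ ab ⊕ d
  regroup-sum a b d refl = sym (AG.assoc a b d)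

  -- Origin of `4c`: two reflections and the rotation `c + w` are missing from the positive copies
  -- of `c`, which leaves `m = -3c`, and `c + w` itself counts negatively.
  flip-identity : ∀ {m s w β β′ c} → c ⊕ (c ⊕ (c ⊕ m)) ≡ 𝟘 → (s ⊟ w) ⊕ (β ⊟ β′) ≡ (c ⊕ c) ⊕ (c ⊕ c) →
    (m ⊕ s) ⊕ (β ⊟ ((c ⊕ w ⊕ 𝟘) ⊕ (β′ ⊟ 𝟘))) ≡ 𝟘
  flip-identity {m} {s} {w} {β} {β′} {c} e₁ e₂ = ≡-diff (cong₂ _⊕_ e₁ e₂)
    (solve (m ∷ s ∷ w ∷ β ∷ β′ ∷ c ∷ [])
      (((var 0F :+ var 1F) :+ (var 3F :- ((var 5F :+ var 2F :+ :0) :+ (var 4F :- :0)))) :- :0)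
      (((var 5F :+ (var 5F :+ (var 5F :+ var 0F))) :+ ((var 1F :- var 2F) :+ (var 3F :- var 4F)))
        :- (:0 :+ ((var 5F :+ var 5F) :+ (var 5F :+ var 5F)))) refl)

  signed-identity : ∀ {p q b b′ f g} → p ⊕ (b ⊕ f) ≡ q ⊕ (b′ ⊕ g) → p ⊕ (b ⊟ (q ⊕ (b′ ⊟ (f ⊟ g)))) ≡ 𝟘
  signed-identity {p} {q} {b} {b′} {f} {g} e = ≡-diff e (solve (p ∷ q ∷ b ∷ b′ ∷ f ∷ g ∷ [])
    ((var 0F :+ (var 2F :- (var 1F :+ (var 3F :- (var 4F :- var 5F))))) :- :0)
    ((var 0F :+ (var 2F :+ var 4F)) :- (var 1F :+ (var 3F :+ var 5F))) refl)

  interleave : List G → List G → List G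
  interleave [] _ = []
  interleave (_ ∷ _) [] = []
  interleave (x ∷ xs) (y ∷ ys) = x ∷ y ∷ interleave xs ys

  interleave-↭ : ∀ xs ys → length xs ≡ length ys → interleave xs ys ↭ xs ++ ys
  interleave-↭ [] [] _ = ↭-refl
  interleave-↭ (x ∷ xs) (y ∷ ys) eq = prep x (↭-trans (prep y (interleave-↭ xs ys (suc-injective eq))) (↭-sym (shift y xs ys)))

  alternate-interleave : ∀ xs ys → length xs ≡ length ys → alternate (interleave xs ys) ≡ Σ xs ⊟ Σ ys
  alternate-interleave [] [] _ = solve [] :0 (:0 :- :0) refl
  alternate-interleave (x ∷ xs) (y ∷ ys) eq = ≡-diff (alternate-interleave xs ys (suc-injective eq))
    (solve (x ∷ y ∷ Σ xs ∷ Σ ys ∷ alternate (interleave xs ys) ∷ [])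
      ((var 0F :- (var 1F :- var 4F)) :- ((var 0F :+ var 2F) :- (var 1F :+ var 3F))) (var 4F :- (var 2F :- var 3F)) refl)

  degenerate-identity : ∀ {l c f₀ f₁ f₂ f₃} → c ⊕ c ≡ 𝟘 → c ⊕ (c ⊕ (c ⊕ (c ⊕ l))) ≡ 𝟘 → f₀ ⊕ f₃ ≡ f₁ ⊕ f₂ →
    l ⊕ (f₀ ⊟ (f₁ ⊟ (f₃ ⊟ (f₂ ⊟ 𝟘)))) ≡ 𝟘
  degenerate-identity {l} {c} {f₀} {f₁} {f₂} {f₃} e₁ e₂ e₃ =
    ≡-diff (cong₂ _⊕_ (cong₂ _⊟_ e₂ (cong₂ _⊕_ e₁ e₁)) e₃) (solve (l ∷ c ∷ f₀ ∷ f₁ ∷ f₂ ∷ f₃ ∷ [])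
      ((var 0F :+ (var 2F :- (var 3F :- (var 5F :- (var 4F :- :0))))) :- :0)
      ((((var 1F :+ (var 1F :+ (var 1F :+ (var 1F :+ var 0F)))) :- ((var 1F :+ var 1F) :+ (var 1F :+ var 1F))) :+ (var 2F :+ var 5F))
        :- ((:0 :- (:0 :+ :0)) :+ (var 3F :+ var 4F))) refl)

-- Scherk's theorem and sequences without short zero-sum subsequences.

module ZeroSums {G : Set} (_≟_ : DecidableEquality G)
  (_∙_ : G → G → G) (𝟘 : G) (_⁻¹ : G → G) (isAbelianGroup : IsAbelianGroup _≡_ _∙_ 𝟘 _⁻¹)
  (n : ℕ) .{{_ : NonZero n}} (n·≡𝟘 : ∀ x → AbelianSums._·_ _∙_ 𝟘 _⁻¹ isAbelianGroup n x ≡ 𝟘)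
  (Unique-bound : ∀ {xs : List G} → Unique xs → length xs ≤ n)
  (involution-unique : ∀ {x y} → x ∙ x ≡ 𝟘 → y ∙ y ≡ 𝟘 → x ≢ 𝟘 → y ≢ 𝟘 → x ≡ y) where

  open AbelianSums _∙_ 𝟘 _⁻¹ isAbelianGroup
  open Counting _≟_ public

  ∣⇒·≡𝟘 : ∀ {L} → n ∣ L → ∀ x → L · x ≡ 𝟘
  ∣⇒·≡𝟘 n∣L x = trans (cong (_· x) (_∣_.equality n∣L))
    (trans (sym (×-assocˡ x q n)) (trans (cong (q ·_) (n·≡𝟘 x)) (·-𝟘 q)))
    where q = quotient n∣L

  -- Closure under adding b reaches (n − 1)b = −b.
  orbit : ∀ (P : G → Set) b → (∀ {v} → P v → P (v ⊕ b)) → ∀ {a} → P a → P (a ⊟ b)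
  orbit P b closed {a} Pa = subst P eq (go (pred n))
    where
    go : ∀ j → P (a ⊕ j · b)
    go zero = subst P (sym (⊕-identityʳ a)) Pa
    go (suc j) = subst P
      (solve (a ∷ j · b ∷ b ∷ []) ((var 0F :+ var 1F) :+ var 2F) (var 0F :+ (var 2F :+ var 1F)) refl)
      (closed (go j))
    eq : a ⊕ pred n · b ≡ a ⊟ b
    eq = ≡-diff (trans (cong (_· b) (suc-pred n)) (n·≡𝟘 b))
      (solve (a ∷ b ∷ pred n · b ∷ [])
        ((var 0F :+ var 2F) :- (var 0F :- var 1F)) ((var 1F :+ var 2F) :- :0) refl)

  meet : ∀ {C K : List G} → Unique C → Unique K → n < length C + length K → ∃ λ v → v ∈ C × v ∈ K
  meet {C} {K} uC uK n< with any? (_∈? K) C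
  ... | yes any = let v , v∈C , v∈K = find any in v , v∈C , v∈K
  ... | no ¬any = contradiction
    (≤-trans (≤-trans n< (≤-reflexive (sym (length-++ C))))
      (Unique-bound (Uniqueₚ.++⁺ uC uK λ (v∈C , v∈K) →
        ¬any (lose v∈C v∈K))))
    (<-irrefl refl)

  full : ∀ {C : List G} → Unique C → n ≤ length C → ∀ v → v ∈ C
  full {C} u n≤ v with v ∈? C
  ... | yes v∈ = v∈
  ... | no v∉  = contradiction (Unique-bound (Unique-∷ v∉ u)) (<⇒≱ (s≤s n≤))

  -- Membership in `X + (A ∪ {𝟘})`, the sumset of Scherk's theorem. In `scherk` the list `A` omits
  -- `𝟘` by the hypotheses, since `𝟘 ∈ X` and no sum `a ⊕ b` vanishes.
  SumBelow : List G → List G → G → Set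
  SumBelow X A c = c ∈ X ⊎ ∃₂ λ a b → a ∈ X × b ∈ A × c ≡ a ⊕ b

  -- Scherk's theorem, by the e-transform X ↦ X ∪ (a + A), A ↦ A ∩ (X − a).
  scherk : ∀ k X A → length A ≤ k → Unique X → Unique A → 𝟘 ∈ X →
    (∀ {a b} → a ∈ X → b ∈ A → a ⊕ b ≢ 𝟘) →
    ∃ λ C → Unique C × 𝟘 ∈ C × length C ≡ length X + length A × (∀ {c} → c ∈ C → SumBelow X A c)
  scherk k X [] _ uX uA 0∈X _ = X , uX , 0∈X , sym (+-identityʳ _) , inj₁
  scherk (suc k) X A@(b ∷ _) |A|≤ uX uA 0∈X ≢0 with all? (λ a → (a ⊕ b) ∈? X) X
  -- If `X + b ⊆ X`, then `orbit` puts `-b` into `X`, and `-b + b` is a forbidden zero sum.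
  ... | yes all = contradiction
          (solve (b ∷ []) ((:0 :- var 0F) :+ var 0F) :0 refl)
          (≢0 (orbit (_∈ X) b (All.lookup all) 0∈X) (here refl))
  ... | no ¬all with a , a∈X , a⊕b∉X ← find
                       (¬All⇒Any¬ (λ a → (a ⊕ b) ∈? X) X ¬all) =
    let C , uC , 0∈C , |C| , reach = scherk k X′ A₁ |A₁|≤k uX′ (Uniqueₚ.filter⁺ P? uA) (∈-++⁺ˡ 0∈X) ≢0′
    in C , uC , 0∈C , trans |C| lengths , λ c∈ → pull (reach c∈)
    where
    P? : Decidable (λ y → (a ⊕ y) ∈ X)
    P? y = (a ⊕ y) ∈? X
    A₁ = filter P? A
    A₂ = filter (¬? ∘ P?) A
    X′ = X ++ map (a ⊕_) A₂
    |A₁|≤k : length A₁ ≤ k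
    |A₁|≤k = ≤-pred (≤-trans (filter-notAll P? A (here a⊕b∉X)) |A|≤)
    uX′ : Unique X′
    uX′ = Uniqueₚ.++⁺ uX (Uniqueₚ.map⁺ (⊕-cancelˡ a) (Uniqueₚ.filter⁺ (¬? ∘ P?) uA))
      λ (v∈X , v∈map) → let y , y∈ , v≡ = ∈-map⁻ (a ⊕_) v∈map
                        in proj₂ (∈-filter⁻ (¬? ∘ P?) {xs = A} y∈) (subst (_∈ X) v≡ v∈X)
    X′-elim : ∀ {c} → c ∈ X′ → c ∈ X ⊎ ∃ λ y → y ∈ A × c ≡ a ⊕ y
    X′-elim c∈ with ∈-++⁻ X c∈
    ... | inj₁ c∈X = inj₁ c∈X
    ... | inj₂ c∈map = let y , y∈ , c≡ = ∈-map⁻ (a ⊕_) c∈map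
                       in inj₂ (y , proj₁ (∈-filter⁻ (¬? ∘ P?) {xs = A} y∈) , c≡)
    exchange : ∀ y z → (a ⊕ y) ⊕ z ≡ (a ⊕ z) ⊕ y
    exchange y z = solve (a ∷ y ∷ z ∷ []) ((var 0F :+ var 1F) :+ var 2F)
                                          ((var 0F :+ var 2F) :+ var 1F) refl
    -- The hypothesis survives because `(a + y) + z = (a + z) + y`, where `a + z ∈ X` for every
    -- `z ∈ A₁`. The same exchange keeps the new sums inside the old sumset.
    ≢0′ : ∀ {c z} → c ∈ X′ → z ∈ A₁ → c ⊕ z ≢ 𝟘
    ≢0′ {z = z} c∈ z∈ c⊕z≡0 with ∈-filter⁻ P? {xs = A} z∈ | X′-elim c∈
    ... | z∈A , _ | inj₁ c∈X = ≢0 c∈X z∈A c⊕z≡0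
    ... | z∈A , a⊕z∈X | inj₂ (y , y∈A , refl) = ≢0 a⊕z∈X y∈A (trans (sym (exchange y z)) c⊕z≡0)
    pull : ∀ {c} → SumBelow X′ A₁ c → SumBelow X A c
    pull (inj₁ c∈X′) with X′-elim c∈X′
    ... | inj₁ c∈X = inj₁ c∈X
    ... | inj₂ (y , y∈A , c≡) = inj₂ (a , y , a∈X , y∈A , c≡)
    pull (inj₂ (c , z , c∈X′ , z∈A₁ , e≡)) with ∈-filter⁻ P? {xs = A} z∈A₁ | X′-elim c∈X′
    ... | z∈A , _ | inj₁ c∈X = inj₂ (c , z , c∈X , z∈A , e≡)
    ... | z∈A , a⊕z∈X | inj₂ (y , y∈A , refl) =
      inj₂ (a ⊕ z , y , a⊕z∈X , y∈A , trans e≡ (exchange y z))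
    lengths : length X′ + length A₁ ≡ length X + length A
    lengths = begin
      length X′ + length A₁
        ≡⟨ cong (_+ length A₁) (length-++ X) ⟩
      length X + length (map (a ⊕_) A₂) + length A₁
        ≡⟨ cong (λ m → length X + m + length A₁) (length-map (a ⊕_) A₂) ⟩
      length X + length A₂ + length A₁
        ≡⟨ +-assoc (length X) _ _ ⟩
      length X + (length A₂ + length A₁)
        ≡⟨ cong (length X +_) (trans (+-comm (length A₂) _) (length-filter-¬ P? A)) ⟩
      length X + length A ∎
      where open ≡-Reasoning

  Reach : ℕ → List G → G → Set
  Reach k R v = ∃₂ λ W V → R ↭ W ++ V × length W ≤ k × Σ W ≡ v

  NoZero : ℕ → List G → Set
  NoZero k R = ∀ w W V → R ↭ (w ∷ W) ++ V → length (w ∷ W) ≤ k → Σ (w ∷ W) ≢ 𝟘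

  NoZero-↭ : ∀ {k R R′} → R ↭ R′ → NoZero k R → NoZero k R′
  NoZero-↭ p nz w W V q = nz w W V (↭-trans p q)

  NoZero-≤ : ∀ {k k′ R} → k′ ≤ k → NoZero k R → NoZero k′ R
  NoZero-≤ k′≤k nz w W V q l = nz w W V q (≤-trans l k′≤k)

  NoZero-++ʳ : ∀ {k} Q {R} → NoZero k (Q ++ R) → NoZero k R
  NoZero-++ʳ Q nz w W V q = nz w W (Q ++ V) (↭-trans (++⁺ˡ Q q) (shifts Q (w ∷ W)))

  Reach-++ : ∀ {k k′ R R′ a b} → Reach k R a → Reach k′ R′ b → Reach (k + k′) (R ++ R′) (a ⊕ b)
  Reach-++ {R = R} {R′} (W , V , p , l , refl) (W′ , V′ , p′ , l′ , refl) =
    W ++ W′ , V ++ V′ ,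
    ↭-trans (++⁺ p p′) (↭-trans (++-assoc W V (W′ ++ V′))
      (↭-trans (++⁺ˡ W (shifts V W′)) (↭-sym (++-assoc W W′ (V ++ V′))))) ,
    ≤-trans (≤-reflexive (length-++ W)) (+-mono-≤ l l′) ,
    Σ-++ W W′

  Reach-↭ : ∀ {k R R′ a} → R ↭ R′ → Reach k R a → Reach k R′ a
  Reach-↭ p (W , V , q , r) = W , V , ↭-trans (↭-sym p) q , r

  Reach-≤ : ∀ {k k′ R a} → k ≤ k′ → Reach k R a → Reach k′ R a
  Reach-≤ k≤ (W , V , q , l , e) = W , V , q , ≤-trans l k≤ , e

  Reach-[] : ∀ {k R} → Reach k R 𝟘
  Reach-[] {R = R} = [] , R , ↭-refl , z≤n , refl

  Reach-∈ : ∀ {k R a} → a ∈ R → Reach (suc k) R a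
  Reach-∈ {a = a} a∈ = let V , p = ∈⇒↭ a∈ in [ a ] , V , p , s≤s z≤n , ⊕-identityʳ a

  Reach-++ˡ : ∀ {k R R′ a} → Reach k R a → Reach k (R ++ R′) a
  Reach-++ˡ {k} {R} {R′} {a} r = subst₂ (λ k a → Reach k (R ++ R′) a) (+-identityʳ k) (⊕-identityʳ a)
    (Reach-++ {k′ = 0} r (Reach-[] {0} {R′}))

  Sumset : ℕ → List G → ℕ → Set
  Sumset k R m = ∃ λ C → Unique C × 𝟘 ∈ C × length C ≡ m × (∀ {c} → c ∈ C → Reach k R c)

  -- Scherk's theorem applied to the superlevel sets {x : count x R ≥ j}.
  growthFrom : ∀ h j Q R X → (∀ x → count x R ≤ h) → NoZero (j + h) (Q ++ R) →
    Unique X → 𝟘 ∈ X → (∀ {x} → x ∈ X → Reach j Q x) →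
    Sumset (j + h) (Q ++ R) (length X + length R)
  growthFrom zero j Q [] X c≤ nz uX 0∈X reach =
    X , uX , 0∈X , sym (+-identityʳ _) ,
    λ x∈ → Reach-≤ (m≤m+n j 0) (Reach-++ˡ (reach x∈))
  growthFrom zero j Q (x ∷ R) X c≤ = contradiction (≤-trans (count-∈ (here refl)) (c≤ x)) λ ()
  -- One term is spent per level: `X` is reached with at most `j` terms of the levels collected in
  -- `Q`, and the next level `B` adds at most one term to each sum.
  growthFrom (suc h) j Q R X c≤ nz uX 0∈X reach with support R
  ... | B , R′ , p , uB , sup =
    let C , uC , 0∈C , |C| , reachC = scherk (length B) X B ≤-refl uX uB 0∈X ≢0
        D , uD , 0∈D , |D| , reachD = growthFrom h (suc j) (Q ++ B) R′ C
          (count-residual p sup c≤) nz′ uC 0∈C (λ c∈ → up (reachC c∈))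
    in D , uD , 0∈D ,
       trans |D| (trans (cong (_+ length R′) |C|) (trans (+-assoc (length X) _ _)
         (cong (length X +_) (trans (sym (length-++ B)) (sym (↭-length p)))))) ,
       λ d∈ → Reach-≤ (≤-reflexive (sym (+-suc j h))) (Reach-↭ perm (reachD d∈))
    where
    perm : (Q ++ B) ++ R′ ↭ Q ++ R
    perm = ↭-trans (++-assoc Q B R′) (++⁺ˡ Q (↭-sym p))
    nz′ : NoZero (suc j + h) ((Q ++ B) ++ R′)
    nz′ = NoZero-≤ (≤-reflexive (sym (+-suc j h))) (NoZero-↭ (↭-sym perm) nz)
    ≢0 : ∀ {a b} → a ∈ X → b ∈ B → a ⊕ b ≢ 𝟘
    ≢0 a∈ b∈ a⊕b≡0 with reach a∈ | ∈⇒↭ b∈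
    ... | W , V , q , l , refl | B′ , r = nz _ W (V ++ (B′ ++ R′))
      (↭-trans (↭-sym perm)
        (↭-trans (++⁺ʳ R′ (++⁺ q r)) (↭-trans (++⁺ʳ R′ (shift _ (W ++ V) B′))
          (prep _ (↭-trans (++-assoc (W ++ V) B′ R′) (++-assoc W V (B′ ++ R′)))))))
      (≤-trans (s≤s l) (≤-trans (s≤s (m≤m+n j h)) (≤-reflexive (sym (+-suc j h)))))
      (trans (solve (_ ∷ Σ W ∷ []) (var 0F :+ var 1F) (var 1F :+ var 0F) refl) a⊕b≡0)
    up : ∀ {c} → SumBelow X B c → Reach (suc j) (Q ++ B) c
    up (inj₁ c∈) = Reach-≤ (n≤1+n j) (Reach-++ˡ (reach c∈))
    up (inj₂ (a , b , a∈ , b∈ , refl)) =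
      Reach-≤ (≤-reflexive (+-comm j 1)) (Reach-++ (reach a∈) (Reach-∈ {0} b∈))

  growth : ∀ h R → (∀ x → count x R ≤ h) → NoZero h R → Sumset h R (suc (length R))
  growth h R c≤ nz = growthFrom h 0 [] R [ 𝟘 ] c≤ nz ([] ∷ []) (here refl)
    λ { (here refl) → Reach-[] }

  NoZero⇒≢𝟘 : ∀ {k R} → NoZero (suc k) R → ∀ {x} → x ∈ R → x ≢ 𝟘
  NoZero⇒≢𝟘 nz {x} x∈ x≡0 = let V , p = ∈⇒↭ x∈ in
    nz x [] V p (s≤s z≤n) (trans (⊕-identityʳ x) x≡0)

  NoZero⇒pair≢𝟘 : ∀ {k R} → NoZero (suc (suc k)) R → ∀ {x y} → x ∈ R → y ∈ R → x ≢ y → x ⊕ y ≢ 𝟘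
  NoZero⇒pair≢𝟘 nz {x} {y} x∈ y∈ x≢y e = let V , p = ∈∈⇒↭ x∈ y∈ x≢y in
    nz x [ y ] V p (s≤s (s≤s z≤n)) (trans (cong (x ⊕_) (⊕-identityʳ y)) e)

  -- The set {𝟘} ∪ B ∪ {y + w}, for y ≠ w in the support B of R and y + w ∉ B, consists of
  -- sums of at most two elements of B and is one element larger than Scherk's bound. If
  -- no such y, w exist, then B contains −u for all u ∈ B.
  growth-nonconstant : ∀ h R {a b} → (∀ x → count x R ≤ suc h) → NoZero (suc (suc h)) R →
    a ∈ R → b ∈ R → a ≢ b → Sumset (suc (suc h)) R (suc (suc (length R)))
  growth-nonconstant h R {a} {b} c≤ nz a∈R b∈R a≢b with support R
  ... | B , R′ , p , uB , sup with any? (λ y → any? (λ w → ¬? (y ≟ w) ×-dec ¬? ((y ⊕ w) ∈? B)) B) B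
  ... | yes found =
    let y , y∈ , foundʸ = find found
        w , w∈ , y≢w , y⊕w∉ = find foundʸ
        𝟘∉B = λ 𝟘∈ → NoZero⇒≢𝟘 nz (∈-resp-↭ (↭-sym p) (∈-++⁺ˡ 𝟘∈)) refl
        sum≢𝟘 = NoZero⇒pair≢𝟘 nz (∈-resp-↭ (↭-sym p) (∈-++⁺ˡ y∈)) (∈-resp-↭ (↭-sym p) (∈-++⁺ˡ w∈)) y≢w
        C , uC , 0∈C , |C| , reach = growthFrom h 2 B R′ ((y ⊕ w) ∷ 𝟘 ∷ B)
          (count-residual p sup c≤) (NoZero-↭ p nz)
          (Unique-∷ (λ { (here e) → sum≢𝟘 e ; (there y⊕w∈) → y⊕w∉ y⊕w∈ }) (Unique-∷ 𝟘∉B uB))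
          (there (here refl))
          λ { (here refl) → let V , q = ∈∈⇒↭ y∈ w∈ y≢w in
                y ∷ w ∷ [] , V , q , ≤-refl , cong (y ⊕_) (⊕-identityʳ w)
            ; (there (here refl)) → Reach-[]
            ; (there (there c∈)) → Reach-∈ c∈ }
    in C , uC , 0∈C ,
       trans |C| (cong (suc ∘ suc) (trans (sym (length-++ B)) (sym (↭-length p)))) ,
       λ c∈ → Reach-↭ (↭-sym p) (reach c∈)
  -- An element `u ≠ -u` would give the zero sum `u + (-u)` of two terms of `R`. So `a` and `b` both
  -- have order two, and only one such element exists.
  ... | no none = contradiction
    (involution-unique (doubles a∈R b∈R a≢b) (doubles b∈R a∈R (a≢b ∘ sym))
      (NoZero⇒≢𝟘 nz a∈R) (NoZero⇒≢𝟘 nz b∈R))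
    a≢b
    where
    B⊆R : ∀ {c} → c ∈ B → c ∈ R
    B⊆R c∈ = ∈-resp-↭ (↭-sym p) (∈-++⁺ˡ c∈)
    closed : ∀ {u v} → u ∈ B → v ∈ B → u ≢ v → u ⊕ v ∈ B
    closed {u} {v} u∈ v∈ u≢v with (u ⊕ v) ∈? B
    ... | yes u⊕v∈ = u⊕v∈
    ... | no u⊕v∉ = contradiction
      (lose u∈
        (lose v∈ (u≢v , u⊕v∉))) none
    difference : ∀ {u v} → u ∈ B → v ∈ B → u ≢ v → v ⊟ u ∈ B
    difference {u} {v} u∈ v∈ u≢v = proj₁ (orbit (λ z → z ∈ B × z ≢ u) u
      (λ {z} (z∈ , z≢u) → closed z∈ u∈ z≢u , λ e → NoZero⇒≢𝟘 nz (B⊆R z∈)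
        (≡-diff e (solve (z ∷ u ∷ []) (var 0F :- :0) ((var 0F :+ var 1F) :- var 1F) refl)))
      (v∈ , u≢v ∘ sym))
    negative : ∀ {u v} → u ∈ B → v ∈ B → u ≢ v → ⊖ u ∈ B
    negative {u} {v} u∈ v∈ u≢v = subst (_∈ B)
      (solve (u ∷ v ∷ []) ((var 1F :- var 0F) :- var 1F) (:- var 0F) refl)
      (difference v∈ (difference u∈ v∈ u≢v) λ e → NoZero⇒≢𝟘 nz (B⊆R u∈)
        (≡-diff e (solve (u ∷ v ∷ []) (var 0F :- :0) (var 1F :- (var 1F :- var 0F)) refl)))
    doubles : ∀ {u v} → u ∈ R → v ∈ R → u ≢ v → u ⊕ u ≡ 𝟘
    doubles {u} u∈ v∈ u≢v with u ≟ (⊖ u)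
    ... | yes e = ≡-diff e (solve (u ∷ []) ((var 0F :+ var 0F) :- :0) (var 0F :- (:- var 0F)) refl)
    ... | no u≢-u = contradiction (solve (u ∷ []) (var 0F :+ (:- var 0F)) :0 refl)
      (NoZero⇒pair≢𝟘 nz u∈ (B⊆R (negative (sup u∈) (sup v∈) u≢v)) u≢-u)

  sub? : ∀ k R v → Dec (∃₂ λ W V → R ↭ W ++ V × length W ≡ k × Σ W ≡ v)
  sub? zero R v with 𝟘 ≟ v
  ... | yes refl = yes ([] , R , ↭-refl , refl , refl)
  ... | no  0≢v  = no λ { ([] , V , p , l , e) → 0≢v e }
  sub? (suc k) [] v = no λ { (w ∷ W , V , p , l , e) → contradiction (↭-length p) λ () }
  sub? (suc k) (x ∷ R) v with sub? k R (v ⊟ x) | sub? (suc k) R v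
  ... | yes (W , V , p , refl , e) | _ = yes (x ∷ W , V , prep x p , refl ,
        trans (cong (x ⊕_) e) (solve (x ∷ v ∷ []) (var 0F :+ (var 1F :- var 0F)) (var 1F) refl))
  ... | no _ | yes (W , V , p , l , e) = yes (W , x ∷ V , ↭-trans (prep x p) (↭-sym (shift x W V)) , l , e)
  ... | no ¬with | no ¬without = no λ (W , V , p , l , e) → case-of {W} {V} (∷↭++ p) l e
    where
    case-of : ∀ {W V} → (∃ λ W′ → W ↭ x ∷ W′ × R ↭ W′ ++ V) ⊎ (∃ λ V′ → V ↭ x ∷ V′ × R ↭ W ++ V′) →
              length W ≡ suc k → Σ W ≡ v → ⊥
    case-of (inj₁ (W′ , q , r)) l e = ¬with (W′ , _ , r , suc-injective (trans (sym (↭-length q)) l) ,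
      ≡-diff (trans (sym (Σ-↭ q)) e)
        (solve (Σ W′ ∷ v ∷ x ∷ []) (var 0F :- (var 1F :- var 2F)) ((var 2F :+ var 0F) :- var 1F) refl))
    case-of (inj₂ (V′ , q , r)) l e = ¬without (_ , V′ , r , l , e)

  noZero? : ∀ k R → NoZero k R ⊎
    ∃₂ λ w W → ∃ λ V → R ↭ (w ∷ W) ++ V × length (w ∷ W) ≤ k × Σ (w ∷ W) ≡ 𝟘
  noZero? k R with anyUpTo? (λ j → sub? (suc j) R 𝟘) k
  ... | yes (j , j<k , w ∷ W , V , p , l , e) = inj₂ (w , W , V , p , ≤-trans (≤-reflexive l) j<k , e)
  ... | no ¬any = inj₁ λ w W V p l e → ¬any (length W , l , w ∷ W , V , p , refl , e)

  -- The two bounds place `L - length U` between `0` and `h`: that many copies of the value of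
  -- multiplicity `h`, translated to zero, complete `U` to length `L`.
  ZeroSub : ℕ → ℕ → List G → Set
  ZeroSub L h T = ∃₂ λ U V → T ↭ U ++ V × Σ U ≡ 𝟘 × length U ≤ L × L ≤ length U + h

  record Stuck (L h : ℕ) (T : List G) : Set where
    field
      U R    : List G
      splits : T ↭ U ++ R
      ΣU     : Σ U ≡ 𝟘
      short  : length U + h < L
      noZero : NoZero (suc h) R
      -- One removed block is remembered, so that `room` can give up its length for a longer sum of
      -- terms of `R`.
      block  : U ≡ [] ⊎ ∃₂ λ V U′ → U ↭ V ++ U′ × Σ V ≡ 𝟘 × 2 ≤ length V × length V ≤ suc h

  -- Gao's argument: split off zero-sum blocks of length at most h + 1 for as long as possible.
  exhaust : ∀ L h T → h < L → (∀ {t} → t ∈ T → t ≢ 𝟘) → ZeroSub L h T ⊎ Stuck L h T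
  exhaust L h T h<L ≢0 = go (length T) [] T ≤-refl ↭-refl refl h<L (inj₁ refl)
    where
    go : ∀ fuel U R → length R ≤ fuel → T ↭ U ++ R → Σ U ≡ 𝟘 → length U + h < L →
      (U ≡ [] ⊎ ∃₂ λ V U′ → U ↭ V ++ U′ × Σ V ≡ 𝟘 × 2 ≤ length V × length V ≤ suc h) →
      ZeroSub L h T ⊎ Stuck L h T
    go fuel U R |R|≤ splits ΣU short block with noZero? (suc h) R
    ... | inj₁ noZero = inj₂ record
          { U = U ; R = R ; splits = splits ; ΣU = ΣU ; short = short ; noZero = noZero ; block = block }
    ... | inj₂ (w , [] , V , p , l , e) = contradiction
          (trans (sym (⊕-identityʳ w)) e)
          (≢0 (∈-resp-↭ (↭-sym splits) (∈-++⁺ʳ U (∈-resp-↭ (↭-sym p) (here refl)))))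
    go zero U R |R|≤ splits ΣU short block | inj₂ (w , w′ ∷ W , V , p , l , e) =
      contradiction (≤-trans (≤-reflexive (sym (↭-length p))) |R|≤) λ ()
    go (suc fuel) U R |R|≤ splits ΣU short block | inj₂ (w , w′ ∷ W , V , p , l , e) =
      result (length U₁ + h <? L)
      where
      Z = w ∷ w′ ∷ W
      U₁ = Z ++ U
      splits₁ : T ↭ U₁ ++ V
      splits₁ = ↭-trans splits (↭-trans (++⁺ˡ U p) (↭-trans (shifts U Z) (↭-sym (++-assoc Z U V))))
      ΣU₁ : Σ U₁ ≡ 𝟘
      ΣU₁ = trans (Σ-++ Z U) (trans (cong₂ _⊕_ e ΣU) (⊕-identityˡ 𝟘))
      result : Dec (length U₁ + h < L) → ZeroSub L h T ⊎ Stuck L h T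
      result (yes short₁) = go fuel U₁ V
        (≤-pred (≤-trans (≤-trans (s≤s (m≤n+m (length V) (suc (length W))))
          (≤-reflexive (sym (trans (↭-length p) (length-++ Z))))) |R|≤))
        splits₁ ΣU₁ short₁ (inj₂ (Z , U , ↭-refl , e , s≤s (s≤s z≤n) , l))
      result (no ¬short) = inj₁ (U₁ , V , splits₁ , ΣU₁ ,
        ≤-trans (≤-reflexive (length-++ Z)) (≤-trans (+-monoˡ-≤ (length U) l)
          (≤-trans (≤-reflexive (cong suc (+-comm h (length U)))) short)) ,
        ≮⇒≥ ¬short)

-- The integers modulo `n`.

module Cyclic (n : ℕ) .{{_ : NonZero n}} where

  mod-cong : ∀ {a b} → a % n ≡ b % n → a mod n ≡ b mod n
  mod-cong {a} {b} eq = fromℕ<-cong _ _ eq (m%n<n a n) (m%n<n b n)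

  toℕ-mod : ∀ k → toℕ (k mod n) ≡ k % n
  toℕ-mod k = toℕ-fromℕ< (m%n<n k n)

  mod-toℕ : ∀ (i : Fin n) → toℕ i mod n ≡ i
  mod-toℕ i = toℕ-injective (trans (toℕ-mod (toℕ i)) (m<n⇒m%n≡m (toℕ<n i)))

  addF-mod : ∀ a b → addF n (a mod n) (b mod n) ≡ (a + b) mod n
  addF-mod a b = mod-cong (trans (cong₂ (λ x y → (x + y) % n) (toℕ-mod a) (toℕ-mod b))
                                 (sym (%-distribˡ-+ a b n)))

  𝟘 : Fin n
  𝟘 = 0 mod n

  addF-assoc : ∀ i j k → addF n (addF n i j) k ≡ addF n i (addF n j k)
  addF-assoc i j k = begin
    addF n (addF n i j) k                  ≡⟨ cong (addF n (addF n i j)) (sym (mod-toℕ k)) ⟩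
    addF n (addF n i j) (toℕ k mod n)      ≡⟨ addF-mod (toℕ i + toℕ j) (toℕ k) ⟩
    (toℕ i + toℕ j + toℕ k) mod n          ≡⟨ cong (_mod n) (+-assoc (toℕ i) (toℕ j) (toℕ k)) ⟩
    (toℕ i + (toℕ j + toℕ k)) mod n        ≡⟨ sym (addF-mod (toℕ i) (toℕ j + toℕ k)) ⟩
    addF n (toℕ i mod n) (addF n j k)      ≡⟨ cong (λ x → addF n x (addF n j k)) (mod-toℕ i) ⟩
    addF n i (addF n j k)                  ∎
    where open ≡-Reasoning

  addF-comm : ∀ i j → addF n i j ≡ addF n j i
  addF-comm i j = cong (_mod n) (+-comm (toℕ i) (toℕ j))

  addF-identityˡ : ∀ i → addF n 𝟘 i ≡ i
  addF-identityˡ i = trans (cong (addF n 𝟘) (sym (mod-toℕ i)))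
    (trans (addF-mod 0 (toℕ i)) (mod-toℕ i))

  addF-inverseʳ : ∀ i → addF n i (negF n i) ≡ 𝟘
  addF-inverseʳ i = begin
    addF n i (negF n i)                        ≡⟨ cong (λ x → addF n x (negF n i)) (sym (mod-toℕ i)) ⟩
    addF n (toℕ i mod n) ((n ∸ toℕ i) mod n)   ≡⟨ addF-mod (toℕ i) (n ∸ toℕ i) ⟩
    (toℕ i + (n ∸ toℕ i)) mod n                ≡⟨ cong (_mod n) (m+[n∸m]≡n (<⇒≤ (toℕ<n i))) ⟩
    n mod n                                    ≡⟨ mod-cong (trans (n%n≡0 n) (sym (m*n%n≡0 0 n))) ⟩
    𝟘                                        ∎
    where open ≡-Reasoning

  isAbelianGroup : IsAbelianGroup _≡_ (addF n) 𝟘 (negF n)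
  isAbelianGroup = record
    { isGroup = record
      { isMonoid = record
        { isSemigroup = record
          { isMagma = record { isEquivalence = isEquivalence ; ∙-cong = cong₂ (addF n) }
          ; assoc = addF-assoc }
        ; identity = addF-identityˡ , λ i → trans (addF-comm i 𝟘) (addF-identityˡ i) }
      ; inverse = (λ i → trans (addF-comm (negF n i) i) (addF-inverseʳ i)) , addF-inverseʳ
      ; ⁻¹-cong = cong (negF n) }
    ; comm = addF-comm }

  open AbelianSums (addF n) 𝟘 (negF n) isAbelianGroup public

  mod≡𝟘⇒∣ : ∀ {k} → k mod n ≡ 𝟘 → n ∣ k
  mod≡𝟘⇒∣ {k} eq = m%n≡0⇒n∣m k n
    (trans (sym (toℕ-mod k)) (trans (cong toℕ eq) (trans (toℕ-mod 0) (m*n%n≡0 0 n))))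

  ∣⇒mod≡𝟘 : ∀ {k} → n ∣ k → k mod n ≡ 𝟘
  ∣⇒mod≡𝟘 {k} n∣k = mod-cong (trans (n∣m⇒m%n≡0 k n n∣k) (sym (m*n%n≡0 0 n)))

  ·-mod : ∀ k x → k · x ≡ (k * toℕ x) mod n
  ·-mod zero x = refl
  ·-mod (suc k) x = trans (cong₂ _⊕_ (sym (mod-toℕ x)) (·-mod k x)) (addF-mod (toℕ x) (k * toℕ x))

  n·≡𝟘 : ∀ x → n · x ≡ 𝟘
  n·≡𝟘 x = trans (·-mod n x) (∣⇒mod≡𝟘 (m∣m*n (toℕ x)))

  toℕ≢0 : ∀ {x} → x ≢ 𝟘 → 0 < toℕ x
  toℕ≢0 {x} x≢0 = n≢0⇒n>0 λ e → x≢0 (trans (sym (mod-toℕ x)) (cong (_mod n) e))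

  -- The left-hand side is a positive multiple of `n` that is smaller than `2n`.
  double≡n : ∀ {x} → x ⊕ x ≡ 𝟘 → x ≢ 𝟘 → toℕ x + toℕ x ≡ n
  double≡n {x} 2x≡0 x≢0 with mod≡𝟘⇒∣ {toℕ x + toℕ x} 2x≡0
  ... | divides zero eq = contradiction (m+n≡0⇒m≡0 (toℕ x) eq) (>⇒≢ (toℕ≢0 x≢0))
  ... | divides 1 eq = trans eq (+-identityʳ n)
  ... | divides (suc (suc q)) eq = contradiction
    (≤-trans (+-monoʳ-≤ n (m≤m+n n (q * n))) (≤-reflexive (sym eq)))
    (<⇒≱ (+-mono-< (toℕ<n x) (toℕ<n x)))

  involution-unique : ∀ {x y} → x ⊕ x ≡ 𝟘 → y ⊕ y ≡ 𝟘 → x ≢ 𝟘 → y ≢ 𝟘 → x ≡ y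
  involution-unique {x} {y} 2x 2y x≢0 y≢0 = toℕ-injective (*-cancelˡ-≡ (toℕ x) (toℕ y) 2
    (trans (double x) (trans (trans (double≡n 2x x≢0) (sym (double≡n 2y y≢0))) (sym (double y)))))
    where
    double : ∀ (z : Fin n) → 2 * toℕ z ≡ toℕ z + toℕ z
    double z = cong (toℕ z +_) (+-identityʳ (toℕ z))

  Unique-bound : ∀ {xs : List (Fin n)} → Unique xs → length xs ≤ n
  Unique-bound {xs} u = injective⇒≤ {f = lookup xs} (λ {i} {j} → lookup-injective u i j)
    where
    lookup-injective : ∀ {ys : List (Fin n)} → Unique ys → ∀ i j →
      lookup ys i ≡ lookup ys j → i ≡ j
    lookup-injective (_ ∷ _) Fin.zero Fin.zero _ = refl
    lookup-injective (y∉ ∷ _) Fin.zero (Fin.suc j) eq = contradiction eq (All.lookup y∉ (∈-lookup j))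
    lookup-injective (y∉ ∷ _) (Fin.suc i) Fin.zero eq = contradiction (sym eq) (All.lookup y∉ (∈-lookup i))
    lookup-injective (_ ∷ u) (Fin.suc i) (Fin.suc j) eq = cong Fin.suc (lookup-injective u i j eq)

  open ZeroSums _≟ᶠ_ (addF n) 𝟘 (negF n) isAbelianGroup n n·≡𝟘 Unique-bound involution-unique public

-- Products in the dihedral group and the search for product-one subsequences.

module _ {A : Set} where

  picks : List A → List (A × List A)
  picks [] = []
  picks (x ∷ xs) = (x , xs) ∷ map (λ (y , ys) → y , x ∷ ys) (picks xs)

  picks-sound : ∀ {xs : List A} {y ys} → (y , ys) ∈ picks xs → xs ↭ y ∷ ys
  picks-sound {x ∷ xs} (here refl) = ↭-refl
  picks-sound {x ∷ xs} (there p) with _ , q , refl ← ∈-map⁻ (λ (y , ys) → y , x ∷ ys) p =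
    ↭-trans (prep x (picks-sound q)) (swap x _ ↭-refl)

  picks-complete : ∀ {xs : List A} {y} → y ∈ xs → ∃ λ ys → (y , ys) ∈ picks xs
  picks-complete {x ∷ xs} (here refl) = xs , here refl
  picks-complete {x ∷ xs} (there y∈) = let ys , q = picks-complete y∈ in
    x ∷ ys , there (∈-map⁺ (λ (y , ys) → y , x ∷ ys) q)

module Dihedral (n : ℕ) .{{_ : NonZero n}} where

  open Cyclic n public

  G : Set
  G = Fin n

  rot ref : G → D n
  rot a = a , false
  ref b = b , true

  rots refs : List (D n) → List G
  rots [] = []
  rots ((i , false) ∷ S) = i ∷ rots S
  rots ((i , true) ∷ S) = rots S
  refs [] = []
  refs ((i , false) ∷ S) = refs S
  refs ((i , true) ∷ S) = i ∷ refs S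

  split-↭ : ∀ S → S ↭ map rot (rots S) ++ map ref (refs S)
  split-↭ [] = ↭-refl
  split-↭ ((i , false) ∷ S) = prep _ (split-↭ S)
  split-↭ ((i , true) ∷ S) = ↭-trans (prep _ (split-↭ S)) (↭-sym (shift _ (map rot (rots S)) _))

  rots-↭ : ∀ {S T} → S ↭ T → rots S ↭ rots T
  rots-↭ refl = ↭-refl
  rots-↭ (prep (i , false) p) = prep i (rots-↭ p)
  rots-↭ (prep (i , true) p) = rots-↭ p
  rots-↭ (swap (i , false) (j , false) p) = swap i j (rots-↭ p)
  rots-↭ (swap (i , false) (j , true) p) = prep i (rots-↭ p)
  rots-↭ (swap (i , true) (j , false) p) = prep j (rots-↭ p)
  rots-↭ (swap (i , true) (j , true) p) = rots-↭ p
  rots-↭ (step p q) = ↭-trans (rots-↭ p) (rots-↭ q)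

  refs-↭ : ∀ {S T} → S ↭ T → refs S ↭ refs T
  refs-↭ refl = ↭-refl
  refs-↭ (prep (i , false) p) = refs-↭ p
  refs-↭ (prep (i , true) p) = prep i (refs-↭ p)
  refs-↭ (swap (i , false) (j , false) p) = refs-↭ p
  refs-↭ (swap (i , false) (j , true) p) = prep j (refs-↭ p)
  refs-↭ (swap (i , true) (j , false) p) = prep i (refs-↭ p)
  refs-↭ (swap (i , true) (j , true) p) = swap i j (refs-↭ p)
  refs-↭ (step p q) = ↭-trans (refs-↭ p) (refs-↭ q)

  rots-++ : ∀ S T → rots (S ++ T) ≡ rots S ++ rots T
  rots-++ [] T = refl
  rots-++ ((i , false) ∷ S) T = cong (i ∷_) (rots-++ S T)
  rots-++ ((i , true) ∷ S) T = rots-++ S T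

  refs-++ : ∀ S T → refs (S ++ T) ≡ refs S ++ refs T
  refs-++ [] T = refl
  refs-++ ((i , false) ∷ S) T = refs-++ S T
  refs-++ ((i , true) ∷ S) T = cong (i ∷_) (refs-++ S T)

  length-split : ∀ S → length S ≡ length (rots S) + length (refs S)
  length-split [] = refl
  length-split ((i , false) ∷ S) = cong suc (length-split S)
  length-split ((i , true) ∷ S) = trans (cong suc (length-split S)) (sym (+-suc _ _))

  prod-rots : ∀ A g b T → prod n T ≡ (g , b) → prod n (map rot A ++ T) ≡ (Σ A ⊕ g , b)
  prod-rots [] g b T eq = trans eq (cong (_, b) (sym (⊕-identityˡ g)))
  prod-rots (a ∷ A) g b T eq = trans (cong (mul n (rot a)) (prod-rots A g b T eq))
    (cong (_, b) (solve (a ∷ Σ A ∷ g ∷ []) (var 0F :+ (var 1F :+ var 2F)) ((var 0F :+ var 1F) :+ var 2F) refl))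

  prod-refs : ∀ F → prod n (map ref F) ≡ (alternate F , odd? (length F))
  prod-refs [] = refl
  prod-refs (b ∷ F) = cong (mul n (ref b)) (prod-refs F)

  prod-parity : ∀ T → proj₂ (prod n T) ≡ odd? (length (refs T))
  prod-parity [] = refl
  prod-parity ((i , false) ∷ T) = prod-parity T
  prod-parity ((i , true) ∷ T) = cong not (prod-parity T)

  prod-no-refs : ∀ T → refs T ≡ [] → prod n T ≡ rot (Σ (rots T))
  prod-no-refs [] _ = refl
  prod-no-refs ((i , false) ∷ T) eq = cong (mul n (rot i)) (prod-no-refs T eq)

  _≟ᴰ_ : DecidableEquality (D n)
  _≟ᴰ_ = ≡-dec _≟ᶠ_ _≟ᵇ_

  leftDivide : D n → D n → D n
  leftDivide (i , false) (j , b) = j ⊟ i , b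
  leftDivide (i , true) (j , b) = i ⊟ j , not b

  mul-leftDivide : ∀ x g → mul n x (leftDivide x g) ≡ g
  mul-leftDivide (i , false) (j , b) = cong (_, b)
    (solve (i ∷ j ∷ []) (var 0F :+ (var 1F :- var 0F)) (var 1F) refl)
  mul-leftDivide (i , true) (j , b) = cong₂ _,_
    (solve (i ∷ j ∷ []) (var 0F :- (var 0F :- var 1F)) (var 1F) refl) (not-involutive b)

  leftDivide-mul : ∀ x y → leftDivide x (mul n x y) ≡ y
  leftDivide-mul (i , false) (j , b) = cong (_, b)
    (solve (i ∷ j ∷ []) ((var 0F :+ var 1F) :- var 0F) (var 1F) refl)
  leftDivide-mul (i , true) (j , b) = cong₂ _,_
    (solve (i ∷ j ∷ []) (var 0F :- (var 0F :- var 1F)) (var 1F) refl) (not-involutive b)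

  OrderedSub : ℕ → List (D n) → D n → Set
  OrderedSub k S g = ∃₂ λ T U → S ↭ T ++ U × length T ≡ k × prod n T ≡ g

  -- Exhaustive search over the first factor `x`, after which the remaining factors have to multiply
  -- to `x⁻¹ g`.
  orderedSub? : ∀ k S g → Dec (OrderedSub k S g)
  orderedSub? zero S g with one n ≟ᴰ g
  ... | yes eq = yes ([] , S , ↭-refl , refl , eq)
  ... | no ¬eq = no λ { ([] , U , p , l , eq) → ¬eq eq }
  orderedSub? (suc k) S g with any? (λ (x , S′) → orderedSub? k S′ (leftDivide x g)) (picks S)
  ... | yes found = let (x , S′) , x∈ , T , U , p , l , eq = find found in
    yes (x ∷ T , U , ↭-trans (picks-sound x∈) (prep x p) , cong suc l ,
         trans (cong (mul n x) eq) (mul-leftDivide x g))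
  ... | no none = no λ
    { (x ∷ T , U , p , l , eq) →
      let S′ , x∈ = picks-complete (∈-resp-↭ (↭-sym p) (here refl))
      in none (lose x∈ (T , U , drop-∷ (↭-trans (↭-sym (picks-sound x∈)) p) , suc-injective l ,
           trans (sym (leftDivide-mul x (prod n T))) (cong (leftDivide x) eq))) }

  -- The inverse theorem only refutes the absence of a product-one subsequence; decidability turns
  -- this into existence in `forces`.
  hasP1Sub? : ∀ k S → Dec (HasP1Sub n k S)
  hasP1Sub? k S with orderedSub? k S (one n)
  ... | yes (T , U , p , l , eq) = yes (T , U , p , l , T , ↭-refl , eq)
  ... | no ¬sub = no λ (T , U , p , l , T′ , q , eq) →
    ¬sub (T′ , U , ↭-trans p (++⁺ʳ U q) , trans (sym (↭-length q)) l , eq)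

  -- A product-one sequence may be arranged as P · b · N · b′ · F: between the first two
  -- reflections b and b′ the rotations count negatively.
  signedP1 : ∀ {L S A₁ A₂ B₁} b b′ P N F →
    S ↭ map rot A₁ ++ map ref B₁ → A₁ ↭ (P ++ N) ++ A₂ → ∀ {B₂} → B₁ ↭ (b ∷ b′ ∷ F) ++ B₂ →
    odd? (length F) ≡ false → length (P ++ N) + suc (suc (length F)) ≡ L →
    Σ P ⊕ (b ⊟ (Σ N ⊕ (b′ ⊟ alternate F))) ≡ 𝟘 → HasP1Sub n L S
  signedP1 {L} {S} {A₁} {A₂} {B₁} b b′ P N F S↭ A↭ {B₂} B↭ even |T| sum =
    map rot (P ++ N) ++ map ref (b ∷ b′ ∷ F) , map rot A₂ ++ map ref B₂ ,
    ↭-trans S↭ (↭-trans (++⁺ (map⁺ rot A↭) (map⁺ ref B↭)) rearrange) ,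
    trans (length-++ (map rot (P ++ N))) (trans (cong₂ _+_ (length-map rot (P ++ N)) (cong (suc ∘ suc) (length-map ref F))) |T|) ,
    map rot P ++ (ref b ∷ map rot N ++ (ref b′ ∷ map ref F)) ,
    order ,
    trans (prod-rots P _ _ _ (cong (mul n (ref b)) (prod-rots N _ _ _ (cong (mul n (ref b′)) (prod-refs F)))))
      (cong₂ _,_ sum (cong (not ∘ not) even))
    where
    rearrange : map rot ((P ++ N) ++ A₂) ++ map ref ((b ∷ b′ ∷ F) ++ B₂) ↭
      (map rot (P ++ N) ++ map ref (b ∷ b′ ∷ F)) ++ (map rot A₂ ++ map ref B₂)
    rearrange = ↭-trans (↭-reflexive (cong₂ _++_ (map-++ rot (P ++ N) A₂) (map-++ ref (b ∷ b′ ∷ F) B₂)))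
      (↭-trans (++-assoc (map rot (P ++ N)) _ _)
      (↭-trans (++⁺ˡ (map rot (P ++ N)) (shifts (map rot A₂) (map ref (b ∷ b′ ∷ F))))
               (↭-sym (++-assoc (map rot (P ++ N)) _ _))))
    order : map rot (P ++ N) ++ map ref (b ∷ b′ ∷ F) ↭ map rot P ++ (ref b ∷ map rot N ++ (ref b′ ∷ map ref F))
    order = ↭-trans (↭-reflexive (cong (_++ map ref (b ∷ b′ ∷ F)) (map-++ rot P N)))
      (↭-trans (++-assoc (map rot P) _ _) (++⁺ˡ (map rot P) (shift (ref b) (map rot N) _)))

  -- With all rotations in front every rotation counts positively, and only the reflections
  -- alternate in sign.
  plainP1 : ∀ {L S A₁ A₂ B₁ B₂} A F →
    S ↭ map rot A₁ ++ map ref B₁ → A₁ ↭ A ++ A₂ → B₁ ↭ F ++ B₂ →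
    odd? (length F) ≡ false → length A + length F ≡ L →
    Σ A ⊕ alternate F ≡ 𝟘 → HasP1Sub n L S
  plainP1 {L} {S} {A₁} {A₂} {B₁} {B₂} A F S↭ A↭ B↭ even |T| sum =
    map rot A ++ map ref F , map rot A₂ ++ map ref B₂ ,
    ↭-trans S↭ (↭-trans (++⁺ (map⁺ rot A↭) (map⁺ ref B↭)) rearrange) ,
    trans (length-++ (map rot A)) (trans (cong₂ _+_ (length-map rot A) (length-map ref F)) |T|) ,
    _ , ↭-refl ,
    trans (prod-rots A _ _ _ (prod-refs F)) (cong₂ _,_ sum even)
    where
    rearrange : map rot (A ++ A₂) ++ map ref (F ++ B₂) ↭ (map rot A ++ map ref F) ++ (map rot A₂ ++ map ref B₂)
    rearrange = ↭-trans (↭-reflexive (cong₂ _++_ (map-++ rot A A₂) (map-++ ref F B₂)))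
      (↭-trans (++-assoc (map rot A) _ _)
      (↭-trans (++⁺ˡ (map rot A) (shifts (map rot A₂) (map ref F))) (↭-sym (++-assoc (map rot A) _ _))))

-- Distinct reflections: translation, exhaustion and the extremal shape.

module _ {A : Set} where

  splitAt-length : ∀ k (xs : List A) → k ≤ length xs → ∃₂ λ ys zs → xs ≡ ys ++ zs × length ys ≡ k
  splitAt-length zero xs _ = [] , xs , refl , refl
  splitAt-length (suc k) (x ∷ xs) (s≤s k≤) =
    let ys , zs , eq , l = splitAt-length k xs k≤ in x ∷ ys , zs , cong (x ∷_) eq , cong suc l

  replicate-+ : ∀ k l (x : A) → replicate (k + l) x ≡ replicate k x ++ replicate l x
  replicate-+ zero l x = refl
  replicate-+ (suc k) l x = cong (x ∷_) (replicate-+ k l x)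

  constant⇒replicate : ∀ (xs : List A) {x} → (∀ {y} → y ∈ xs → y ≡ x) → xs ≡ replicate (length xs) x
  constant⇒replicate [] _ = refl
  constant⇒replicate (y ∷ xs) ≡x = cong₂ _∷_ (≡x (here refl)) (constant⇒replicate xs (≡x ∘ there))

module _ {A B : Set} (_≟_ : DecidableEquality A) (_≟′_ : DecidableEquality B) where

  private
    module CA = Counting _≟_
    module CB = Counting _≟′_

  count-map : ∀ (f : A → B) → (∀ {x y} → f x ≡ f y → x ≡ y) → ∀ x xs →
              CB.count (f x) (map f xs) ≡ CA.count x xs
  count-map f inj x [] = refl
  count-map f inj x (y ∷ xs) with x ≟ y | f x ≟′ f y
  ... | yes refl | yes _ = cong suc (count-map f inj x xs)
  ... | yes refl | no ¬e = contradiction refl ¬e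
  ... | no x≢y | yes e = contradiction (inj e) x≢y
  ... | no _ | no _ = count-map f inj x xs

module Extremal {G : Set} (_≟_ : DecidableEquality G)
  (_∙_ : G → G → G) (𝟘 : G) (_⁻¹ : G → G) (isAbelianGroup : IsAbelianGroup _≡_ _∙_ 𝟘 _⁻¹)
  (n : ℕ) .{{_ : NonZero n}} (n·≡𝟘 : ∀ x → AbelianSums._·_ _∙_ 𝟘 _⁻¹ isAbelianGroup n x ≡ 𝟘)
  (Unique-bound : ∀ {xs : List G} → Unique xs → length xs ≤ n)
  (involution-unique : ∀ {x y} → x ∙ x ≡ 𝟘 → y ∙ y ≡ 𝟘 → x ≢ 𝟘 → y ≢ 𝟘 → x ≡ y) where

  open AbelianSums _∙_ 𝟘 _⁻¹ isAbelianGroup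
  open ZeroSums _≟_ _∙_ 𝟘 _⁻¹ isAbelianGroup n n·≡𝟘 Unique-bound involution-unique

  record Frame (A : List G) : Set where
    field
      c      : G
      h      : ℕ
      T      : List G
      shape  : A ↭ replicate h c ++ map (c ⊕_) T
      1≤h    : 1 ≤ h
      T≢𝟘    : ∀ {t} → t ∈ T → t ≢ 𝟘
      count≤ : ∀ x → count x T ≤ h

  -- Translation by the value of maximal multiplicity.
  frame : ∀ a A → Frame (a ∷ A)
  frame a A′ with maxCount a A′
  ... | c , c∈ , c≥ with extract c (a ∷ A′)
  ... | A″ , p , c∉ = record
    { c = c ; h = count c A ; T = T ; shape = ↭-trans p (↭-reflexive (cong (replicate (count c A) c ++_) back))
    ; 1≤h = count-∈ c∈ ; T≢𝟘 = T≢𝟘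
    ; count≤ = λ x → ≤-trans (≤-reflexive (trans
        (cong (λ y → count y T) (solve (c ∷ x ∷ []) (var 1F) ((var 0F :+ var 1F) :- var 0F) refl))
        (count-map _≟_ _≟_ (_⊟ c) inj (c ⊕ x) A″)))
        (count≤-++ʳ (replicate (count c A) c) p c≥ (c ⊕ x)) }
    where
    A = a ∷ A′
    T = map (_⊟ c) A″
    inj : ∀ {x y} → x ⊟ c ≡ y ⊟ c → x ≡ y
    inj {x} {y} e = ≡-diff e (solve (x ∷ y ∷ c ∷ []) (var 0F :- var 1F)
                                    ((var 0F :- var 2F) :- (var 1F :- var 2F)) refl)
    back : A″ ≡ map (c ⊕_) T
    back = trans (sym (map-id A″)) (trans (map-cong (λ x → solve (x ∷ c ∷ []) (var 0F)
      (var 1F :+ (var 0F :- var 1F)) refl) A″) (map-∘ A″))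
    T≢𝟘 : ∀ {t} → t ∈ T → t ≢ 𝟘
    T≢𝟘 t∈ t≡0 with x , x∈ , refl ← ∈-map⁻ (_⊟ c) t∈ =
      c∉ (subst (_∈ A″) (≡-diff t≡0 (solve (x ∷ c ∷ []) (var 0F :- var 1F) ((var 0F :- var 1F) :- :0) refl)) x∈)

  -- The dihedral group enters only through two families of forbidden equations: all rotations in
  -- front, or some rotations between exactly two reflections.
  module _ (A B : List G) (L : ℕ) (n≤L : n ≤ L) (n∣L : n ∣ L) (|A|+r : suc (length A + length B) ≡ L + n)
    (no-plain : ∀ A₁ A₂ F B₂ → A ↭ A₁ ++ A₂ → B ↭ F ++ B₂ → odd? (length F) ≡ false →
       length A₁ + length F ≡ L → Σ A₁ ⊕ alternate F ≢ 𝟘)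
    (no-signed : ∀ b b′ P N A₂ B₂ → A ↭ (P ++ N) ++ A₂ → B ↭ b ∷ b′ ∷ B₂ →
       length (P ++ N) + 2 ≡ L → Σ P ⊕ (b ⊟ (Σ N ⊕ (b′ ⊟ 𝟘))) ≢ 𝟘) where

    r : ℕ
    r = length B

    module WithFrame (fr : Frame A) where
      open Frame fr

      |A| : length A ≡ h + length T
      |A| = trans (↭-length shape) (trans (length-++ (replicate h c))
        (cong₂ _+_ (length-replicate h) (length-map (c ⊕_) T)))

      -- Of the `L` terms the `length F` reflections carry no `c`. Since `L · c = 0`, undoing the
      -- translation contributes `-(length F · c)`, and the right-hand side of the equation cancels
      -- this.
      impossible : ∀ X Y z F B₂ → T ↭ X ++ Y → z ≤ h → B ↭ F ++ B₂ → odd? (length F) ≡ false →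
        z + length X + length F ≡ L → Σ X ⊕ alternate F ≡ length F · c → ⊥
      impossible X Y z F B₂ T↭ z≤h B↭ even total sum with m≤n⇒∃[o]m+o≡n z≤h
      ... | o , z+o = no-plain (replicate z c ++ map (c ⊕_) X) (replicate o c ++ map (c ⊕_) Y) F B₂
        A↭ B↭ even
        (trans (cong (_+ length F) (trans (length-++ (replicate z c))
          (cong₂ _+_ (length-replicate z) (length-map (c ⊕_) X)))) total)
        zero-sum
        where
        A↭ : A ↭ (replicate z c ++ map (c ⊕_) X) ++ (replicate o c ++ map (c ⊕_) Y)
        A↭ = ↭-trans shape (↭-trans (++⁺ (↭-reflexive (trans (cong (λ k → replicate k c) (sym z+o)) (replicate-+ z o c)))
                 (↭-trans (map⁺ (c ⊕_) T↭) (↭-reflexive (map-++ (c ⊕_) X Y))))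
          (↭-trans (++-assoc (replicate z c) _ _)
            (↭-trans (++⁺ˡ (replicate z c) (shifts (replicate o c) (map (c ⊕_) X)))
              (↭-sym (++-assoc (replicate z c) _ _)))))
        zero-sum : Σ (replicate z c ++ map (c ⊕_) X) ⊕ alternate F ≡ 𝟘
        zero-sum = begin
          Σ (replicate z c ++ map (c ⊕_) X) ⊕ alternate F
            ≡⟨ cong (_⊕ alternate F) (trans (Σ-++ (replicate z c) _) (cong₂ _⊕_ (Σ-replicate z c) (Σ-map-⊕ c X))) ⟩
          (z · c ⊕ (length X · c ⊕ Σ X)) ⊕ alternate F
            ≡⟨ solve (z · c ∷ length X · c ∷ Σ X ∷ alternate F ∷ [])
                 ((var 0F :+ (var 1F :+ var 2F)) :+ var 3F) ((var 0F :+ var 1F) :+ (var 2F :+ var 3F)) refl ⟩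
          (z · c ⊕ length X · c) ⊕ (Σ X ⊕ alternate F)
            ≡⟨ cong₂ _⊕_ (sym (×-homo-+ c z (length X))) sum ⟩
          (z + length X) · c ⊕ length F · c
            ≡⟨ sym (×-homo-+ c (z + length X) (length F)) ⟩
          (z + length X + length F) · c
            ≡⟨ cong (_· c) total ⟩
          L · c
            ≡⟨ ∣⇒·≡𝟘 n∣L c ⟩
          𝟘 ∎
          where open ≡-Reasoning

      h<L : h < L
      h<L = ≰⇒> λ L≤h → impossible [] T L [] B ↭-refl L≤h ↭-refl refl
        (trans (+-identityʳ _) (+-identityʳ L)) (⊕-identityˡ 𝟘)

      no-zeroSub : ZeroSub L h T → ⊥
      no-zeroSub (U , V , p , ΣU , U≤L , L≤) = impossible U V z [] B p
        (+-cancelˡ-≤ (length U) z h (≤-trans (≤-reflexive U+z) L≤)) ↭-refl refl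
        (trans (+-identityʳ _) (trans (+-comm z (length U)) U+z))
        (trans (⊕-identityʳ _) ΣU)
        where
        z = proj₁ (m≤n⇒∃[o]m+o≡n U≤L)
        U+z = proj₂ (m≤n⇒∃[o]m+o≡n U≤L)

      stuck : Stuck L h T
      stuck = [ ⊥-elim ∘ no-zeroSub , (λ st → st) ]′ (exhaust L h T h<L T≢𝟘)

      -- Even with all `h` copies of `c` the zero-sum part `U` falls short of `L` by `s` terms.
      module WithStuck (st : Stuck L h T) (s : ℕ) (U+h+s : length (Stuck.U st) + h + s ≡ L) (1≤s : 1 ≤ s) where

        open Stuck st

        |R|+r : suc (length R + r) ≡ s + n
        |R|+r = ≡-from _ _ (trans total (cong (_+ n) (sym U+h+s))) (balance (length R) r s n (length U) h)
          where
          total : suc ((h + (length U + length R)) + r) ≡ L + n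
          total = trans (cong (λ m → suc (m + r)) (sym (trans |A| (cong (h +_) (trans (↭-length splits) (length-++ U)))))) |A|+r
          balance : ∀ ρ r s n u h → suc (ρ + r) + (u + h + s + n) ≡ s + n + suc ((h + (u + ρ)) + r)
          balance = ringℕ-∀

        count≤R : ∀ x → count x R ≤ h
        count≤R = count≤-++ʳ U splits count≤

        |R|<n : length R < n
        |R|<n = let C , uC , _ , |C| , _ = growth h R count≤R (NoZero-≤ (n≤1+n h) noZero)
                in ≤-trans (≤-reflexive (sym |C|)) (Unique-bound uC)

        s≤r : s ≤ r
        s≤r = ≤-from s r 0 (+-mono-≤ |R|<n (≤-reflexive (sym |R|+r))) (balance s n (length R) r)
          where
          balance : ∀ s n ρ r → s + (n + suc (ρ + r)) + 0 ≡ r + (suc ρ + (s + n))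
          balance = ringℕ-∀

        -- All reflections but one are fixed. As the last one runs through `βs`, the sum required of
        -- `W` takes `length βs` different values, and one of them lies in `C` by the pigeonhole
        -- principle.
        vary : ∀ fs βs → B ≡ fs ++ βs → Unique βs → odd? (suc (length fs)) ≡ false →
          ∀ {C} → Unique C → n < length C + length βs →
          (∀ {v} → v ∈ C → ∃₂ λ W V → R ↭ W ++ V × Σ W ≡ v ×
             ∃ λ z → z ≤ h × z + (length U + length W) + suc (length fs) ≡ L) → ⊥
        vary fs βs B≡ uβ even {C} uC n< witness =
          let v , v∈C , v∈K = meet uC (Uniqueₚ.map⁺ inj uβ)
                (≤-trans n< (≤-reflexive (cong (length C +_) (sym (length-map target βs)))))
              β , β∈ , v≡ = ∈-map⁻ target v∈K
              W , V , R↭ , ΣW , z , z≤h , total = witness v∈C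
              βs′ , βs↭ = ∈⇒↭ β∈
          in impossible (U ++ W) V z (β ∷ fs) βs′
            (↭-trans splits (↭-trans (++⁺ˡ U R↭) (↭-sym (++-assoc U W V)))) z≤h
            (↭-trans (↭-reflexive B≡) (↭-trans (++⁺ˡ fs βs↭) (shift β fs βs′)))
            even
            (trans (cong (λ m → z + m + suc (length fs)) (length-++ U)) total)
            (trans (cong (_⊕ (β ⊟ alternate fs)) (trans (Σ-++ U W) (trans (cong₂ _⊕_ ΣU (trans ΣW v≡)) (⊕-identityˡ _))))
              (solve (k ∷ alternate fs ∷ β ∷ [])
                (((var 0F :+ var 1F) :- var 2F) :+ (var 2F :- var 1F)) (var 0F) refl))
          where
          k : G
          k = suc (length fs) · c
          target : G → G
          target β = (k ⊕ alternate fs) ⊟ β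
          inj : ∀ {x y} → target x ≡ target y → x ≡ y
          inj {x} {y} e = ≡-diff (sym e) (solve (x ∷ y ∷ (k ⊕ alternate fs) ∷ [])
            (var 0F :- var 1F) ((var 2F :- var 1F) :- (var 2F :- var 0F)) refl)

        module _ (uB : Unique B) where

          -- Here `s` reflections are used, and `W` shares the remaining `h` places with copies of
          -- `c`. The `|R| + 1` sums and the `r - (s - 1)` choices of the last reflection add up to
          -- `n + 1`.
          s-even : ∀ s′ → s ≡ suc (suc s′) → odd? s′ ≡ false → ⊥
          s-even s′ s≡ even =
            let fs , βs , B≡ , |fs| = splitAt-length (suc s′) B (≤-trans (n≤1+n (suc s′)) (≤-trans (≤-reflexive (sym s≡)) s≤r))
                C , uC , _ , |C| , reach = growth h R count≤R (NoZero-≤ (n≤1+n h) noZero)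
                r≡ = trans (cong length B≡) (trans (length-++ fs) (cong (_+ length βs) |fs|))
            in vary fs βs B≡ (Unique-++ʳ fs (subst Unique B≡ uB))
                 (trans (cong (odd? ∘ suc) |fs|) (trans (not-involutive (odd? s′)) even)) uC
                 (≤-reflexive (trans (sym (count′ (length R) (length βs) (trans (cong (λ m → suc (length R + m)) (sym r≡)) (trans |R|+r (cong (_+ n) s≡)))))
                   (cong (_+ length βs) (sym |C|))))
                 λ v∈ → let W , V , p , l , ΣW = reach v∈
                            z , W+z = m≤n⇒∃[o]m+o≡n l
                        in W , V , p , ΣW , z , ≤-trans (m≤n+m z (length W)) (≤-reflexive W+z) ,
                           trans (cong (λ m → z + (length U + length W) + suc m) |fs|)
                           (trans (regroup z (length U) (length W) s′)
                           (trans (cong₂ (λ a b → length U + a + b) W+z (sym s≡)) U+h+s))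
            where
            count′ : ∀ ρ b → suc (ρ + (suc s′ + b)) ≡ suc (suc s′) + n → suc ρ + b ≡ suc n
            count′ ρ b eq = ≡-from _ _ eq (balance ρ b s′ n)
              where
              balance : ∀ ρ b s′ n → suc ρ + b + (suc (suc s′) + n) ≡ suc n + suc (ρ + (suc s′ + b))
              balance = ringℕ-∀
            regroup : ∀ z u w s′ → z + (u + w) + suc (suc s′) ≡ u + (w + z) + suc (suc s′)
            regroup = ringℕ-∀

          -- The number of reflections must be even, so `s - 1` are used and `h + 1` places remain.
          -- There are only `h` copies of `c`, so `W` must be nonempty and the sum `𝟘` is given up;
          -- in exchange one more reflection is free, and the count is again `n + 1`.
          s-odd : ∀ s′ → s ≡ suc (suc (suc s′)) → odd? s′ ≡ false → ⊥
          s-odd s′ s≡ even =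
            let fs , βs , B≡ , |fs| = splitAt-length (suc s′) B
                  (≤-trans (≤-trans (n≤1+n (suc s′)) (n≤1+n _)) (≤-trans (≤-reflexive (sym s≡)) s≤r))
                C , uC , 𝟘∈C , |C| , reach = growth h R count≤R (NoZero-≤ (n≤1+n h) noZero)
                C′ , C↭ = ∈⇒↭ 𝟘∈C
                u𝟘C′ = Unique-↭ C↭ uC
                r≡ = trans (cong length B≡) (trans (length-++ fs) (cong (_+ length βs) |fs|))
            in vary fs βs B≡ (Unique-++ʳ fs (subst Unique B≡ uB))
                 (trans (cong (odd? ∘ suc) |fs|) (trans (not-involutive (odd? s′)) even)) (Unique-++ʳ [ 𝟘 ] u𝟘C′)
                 (≤-reflexive (trans (sym (count′ (length R) (length βs) (trans (cong (λ m → suc (length R + m)) (sym r≡)) (trans |R|+r (cong (_+ n) s≡)))))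
                   (cong (_+ length βs) (suc-injective (trans (sym |C|) (↭-length C↭))))))
                 λ {v} v∈ → witness |fs| (reach (∈-resp-↭ (↭-sym C↭) (there v∈)))
                   λ { refl → Uniqueₚ.Unique[x∷xs]⇒x∉xs u𝟘C′ v∈ }
            where
            count′ : ∀ ρ b → suc (ρ + (suc s′ + b)) ≡ suc (suc (suc s′)) + n → ρ + b ≡ suc n
            count′ ρ b eq = ≡-from _ _ eq (balance ρ b s′ n)
              where
              balance : ∀ ρ b s′ n → ρ + b + (suc (suc (suc s′)) + n) ≡ suc n + suc (ρ + (suc s′ + b))
              balance = ringℕ-∀
            regroup : ∀ z u w s′ → z + (u + suc w) + suc (suc s′) ≡ u + (w + z) + suc (suc (suc s′))
            regroup = ringℕ-∀
            witness : ∀ {m v} → m ≡ suc s′ → Reach h R v → v ≢ 𝟘 → ∃₂ λ W V → R ↭ W ++ V × Σ W ≡ v ×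
                      ∃ λ z → z ≤ h × z + (length U + length W) + suc m ≡ L
            witness |fs| ([] , V , p , l , ΣW) v≢𝟘 = ⊥-elim (v≢𝟘 (sym ΣW))
            witness refl (w ∷ W , V , p , l , ΣW) v≢𝟘 =
              let z , W+z = m≤n⇒∃[o]m+o≡n (<⇒≤ l)
              in w ∷ W , V , p , ΣW , z , ≤-trans (m≤n+m z (length W)) (≤-reflexive W+z) ,
                 trans (regroup z (length U) (length W) s′)
                   (trans (cong₂ (λ a b → length U + a + b) W+z (sym s≡)) U+h+s)

          s≡1 : s ≡ 1
          s≡1 = cases s refl 1≤s
            where
            parity : ∀ s′ → s ≡ suc (suc s′) → (b : Bool) → odd? s′ ≡ b → ⊥
            parity s′ s≡ false even = s-even s′ s≡ even
            parity (suc s′) s≡ true odd = s-odd s′ s≡ (not-injective odd)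
            cases : ∀ m → s ≡ m → 1 ≤ m → s ≡ 1
            cases 1 s≡ _ = s≡
            cases (suc (suc m)) s≡ _ = ⊥-elim (parity m s≡ (odd? m) refl)

        -- The tight case `s = 1`.

        module Tight (s≡1 : s ≡ 1) where

          U+h : suc (length U + h) ≡ L
          U+h = trans (trans (+-comm 1 (length U + h)) (cong (length U + h +_) (sym s≡1))) U+h+s

          R+r : length R + r ≡ n
          R+r = suc-injective (trans |R|+r (cong (_+ n) s≡1))

          -- A sum of at most h + 1 elements of R is completed to length L − 2 by elements of zero
          -- sum. If w ≥ h there are too many elements for this, and a zero-sum block of U is left out.
          room : ∀ w → w ≤ suc h → w ≤ length R → 2 ≤ r → ∃₂ λ U₁ U₂ → U ↭ U₁ ++ U₂ × Σ U₁ ≡ 𝟘 ×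
                 ∃ λ z → z ≤ h × suc (suc (z + (length U₁ + w))) ≡ L
          room w w≤ w≤R 2≤r = decide (w <? h) block
            where
            decide : Dec (w < h) → (U ≡ [] ⊎ ∃₂ λ Z U′ → U ↭ Z ++ U′ × Σ Z ≡ 𝟘 × 2 ≤ length Z × length Z ≤ suc h) →
                     ∃₂ λ U₁ U₂ → U ↭ U₁ ++ U₂ × Σ U₁ ≡ 𝟘 × ∃ λ z → z ≤ h × suc (suc (z + (length U₁ + w))) ≡ L
            decide (yes w<h) _ =
              let z , W+z = m≤n⇒∃[o]m+o≡n w<h
              in U , [] , ↭-reflexive (sym (++-identityʳ U)) , ΣU , z ,
                   ≤-trans (m≤n+m z (suc w)) (≤-reflexive W+z) ,
                   trans (regroup z (length U) w) (trans (cong (λ m → suc (length U + m)) W+z) U+h)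
              where
              regroup : ∀ z u w → suc (suc (z + (u + w))) ≡ suc (u + (suc w + z))
              regroup = ringℕ-∀
            decide (no w≮h) (inj₁ U≡[]) = ⊥-elim (<-irrefl refl (≤-trans few (≮⇒≥ w≮h)))
              where
              suc-h : suc h ≡ L
              suc-h = trans (cong (λ u → suc (length u + h)) (sym U≡[])) U+h
              few : suc w ≤ h
              few = ≤-from _ _ 0 (+-mono-≤ w≤R (+-mono-≤ (≤-reflexive R+r)
                      (+-mono-≤ (≤-trans n≤L (≤-reflexive (sym suc-h))) 2≤r))) (few′ w (length R) n h r)
                    where
                    few′ : ∀ w ρ n h r → suc w + (ρ + (n + (suc h + r))) + 0 ≡ h + (w + ((ρ + r) + (n + 2)))
                    few′ = ringℕ-∀
            decide (no w≮h) (inj₂ (Z , U′ , U↭ , ΣZ , 2≤Z , Z≤)) =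
              let z , W+z = m≤n⇒∃[o]m+o≡n (≤-trans (s≤s w≤) (≤-trans (≤-reflexive (+-comm 2 h)) (+-monoʳ-≤ h 2≤Z)))
              in U′ , Z , ↭-trans U↭ (++-comm Z U′) ,
                   trans (sym (⊕-identityˡ _)) (trans (cong (_⊕ Σ U′) (sym ΣZ)) (trans (sym (Σ-++ Z U′)) (trans (sym (Σ-↭ U↭)) ΣU))) ,
                   z ,
                   ≤-from z h 0 (+-mono-≤ (+-mono-≤ Z≤ (≮⇒≥ w≮h)) (≤-reflexive W+z)) (small z h (length Z) w) ,
                   trans (regroup z (length U′) w)
                     (trans (cong (λ m → suc (length U′ + m)) W+z)
                     (trans (regroup′ (length U′) h (length Z)) (trans (cong (λ m → suc (m + h)) (sym (trans (↭-length U↭) (length-++ Z)))) U+h)))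
              where
              small : ∀ z h ζ w → z + (suc h + w + (h + ζ)) + 0 ≡ h + (ζ + h + (suc w + z))
              small = ringℕ-∀
              regroup : ∀ z u w → suc (suc (z + (u + w))) ≡ suc (u + (suc w + z))
              regroup = ringℕ-∀
              regroup′ : ∀ u h ζ → suc (u + (h + ζ)) ≡ suc ((ζ + u) + h)
              regroup′ = ringℕ-∀

          length-part : ∀ W V → R ↭ W ++ V → length W ≤ length R
          length-part W V R↭ = ≤-trans (m≤m+n (length W) (length V)) (≤-reflexive (sym (trans (↭-length R↭) (length-++ W))))

          2≤length : ∀ {β β′ B₂} → B ↭ β ∷ β′ ∷ B₂ → 2 ≤ r
          2≤length B↭ = ≤-trans (s≤s (s≤s z≤n)) (≤-reflexive (sym (↭-length B↭)))

          T↭parts : ∀ U₁ U₂ → U ↭ U₁ ++ U₂ → ∀ W V → R ↭ W ++ V → T ↭ (U₁ ++ W) ++ (U₂ ++ V)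
          T↭parts U₁ U₂ U↭ W V R↭ = ↭-trans splits (↭-trans (++⁺ U↭ R↭) (↭-trans (++-assoc U₁ U₂ (W ++ V))
                (↭-trans (++⁺ˡ U₁ (shifts U₂ W)) (↭-sym (++-assoc U₁ W (U₂ ++ V))))))

          -- This is `impossible` for two reflections, whence `2c`. Thanks to `room` the sum may
          -- have `h + 1` terms, one more than `growth` provides.
          pair-impossible : ∀ W V → R ↭ W ++ V → length W ≤ suc h → ∀ {β β′ B₂} → B ↭ β ∷ β′ ∷ B₂ →
            Σ W ⊕ (β ⊟ β′) ≢ c ⊕ c
          pair-impossible W V R↭ |W|≤ {β} {β′} {B₂} B↭ sum =
            let U₁ , U₂ , U↭ , ΣU₁ , z , z≤h , total = room (length W) |W|≤ (length-part W V R↭) (2≤length B↭)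
            in impossible (U₁ ++ W) (U₂ ++ V) z (β ∷ β′ ∷ []) B₂ (T↭parts U₁ U₂ U↭ W V R↭)
              z≤h B↭ refl (trans (cong (λ m → z + m + 2) (length-++ U₁)) (trans (+-comm _ 2) total))
              (≡-diff (trans (cong (_⊕ (β ⊟ β′)) (trans (Σ-++ U₁ W) (trans (cong (_⊕ Σ W) ΣU₁) (⊕-identityˡ _)))) sum)
                (solve (Σ (U₁ ++ W) ∷ β ∷ β′ ∷ c ∷ [])
                  ((var 0F :+ (var 1F :- (var 2F :- :0))) :- (var 3F :+ (var 3F :+ :0)))
                  ((var 0F :+ (var 1F :- var 2F)) :- (var 3F :+ var 3F)) refl))

          -- The rotation `c + w` is placed between the two reflections and so counts negatively.
          flip-impossible : ∀ w W V → R ↭ (w ∷ W) ++ V → length (w ∷ W) ≤ suc h → ∀ {β β′ B₂} → B ↭ β ∷ β′ ∷ B₂ →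
            (Σ W ⊟ w) ⊕ (β ⊟ β′) ≢ (c ⊕ c) ⊕ (c ⊕ c)
          flip-impossible w W V R↭ |W|≤ {β} {β′} {B₂} B↭ sum =
            let U₁ , U₂ , U↭ , ΣU₁ , z , z≤h , total = room (suc (length W)) |W|≤ (length-part (w ∷ W) V R↭) (2≤length B↭)
                o , z+o = m≤n⇒∃[o]m+o≡n z≤h
                P = replicate z c ++ map (c ⊕_) (U₁ ++ W)
                |P| = trans (length-++ (replicate z c)) (cong₂ _+_ (length-replicate z)
                        (trans (length-map (c ⊕_) (U₁ ++ W)) (length-++ U₁)))
            in no-signed β β′ P [ c ⊕ w ] (replicate o c ++ map (c ⊕_) (U₂ ++ V)) B₂
                 (perm z o U₁ U₂ z+o (↭-trans (T↭parts U₁ U₂ U↭ (w ∷ W) V R↭) (++⁺ʳ (U₂ ++ V) (shift w U₁ W))))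
                 B↭
                 (trans (cong (_+ 2) (trans (length-++ P) (cong (_+ 1) |P|)))
                   (trans (regroup z (length U₁) (length W)) total))
                 (zero-sum z U₁ ΣU₁ (trans (regroup₃ z (length U₁) (length W)) total))
            where
            regroup : ∀ z u w → z + (u + w) + 1 + 2 ≡ suc (suc (z + (u + suc w)))
            regroup = ringℕ-∀
            regroup₃ : ∀ z u w → 3 + (z + (u + w)) ≡ suc (suc (z + (u + suc w)))
            regroup₃ = ringℕ-∀
            perm : ∀ z o U₁ U₂ → z + o ≡ h → T ↭ (w ∷ U₁ ++ W) ++ (U₂ ++ V) →
              A ↭ ((replicate z c ++ map (c ⊕_) (U₁ ++ W)) ++ [ c ⊕ w ]) ++ (replicate o c ++ map (c ⊕_) (U₂ ++ V))
            perm z o U₁ U₂ z+o T↭ = ↭-trans shape (↭-trans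
              (++⁺ (↭-reflexive (trans (cong (λ k → replicate k c) (sym z+o)) (replicate-+ z o c)))
                   (↭-trans (map⁺ (c ⊕_) T↭) (↭-reflexive (map-++ (c ⊕_) (w ∷ U₁ ++ W) (U₂ ++ V)))))
              (↭-trans (++-assoc (replicate z c) _ _)
              (↭-trans (++⁺ˡ (replicate z c) (shifts (replicate o c) (map (c ⊕_) (w ∷ U₁ ++ W))))
              (↭-trans (↭-sym (++-assoc (replicate z c) _ _))
                (++⁺ʳ (replicate o c ++ map (c ⊕_) (U₂ ++ V))
                  (↭-trans (shift (c ⊕ w) (replicate z c) _) (++-comm [ c ⊕ w ] _)))))))
            zero-sum : ∀ z U₁ → Σ U₁ ≡ 𝟘 → 3 + (z + (length U₁ + length W)) ≡ L →
              Σ (replicate z c ++ map (c ⊕_) (U₁ ++ W)) ⊕ (β ⊟ ((c ⊕ w ⊕ 𝟘) ⊕ (β′ ⊟ 𝟘))) ≡ 𝟘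
            zero-sum z U₁ ΣU₁ total = trans (cong (_⊕ (β ⊟ ((c ⊕ w ⊕ 𝟘) ⊕ (β′ ⊟ 𝟘)))) expand)
              (flip-identity (trans (cong (_· c) total) (∣⇒·≡𝟘 n∣L c)) sum)
              where
              expand : Σ (replicate z c ++ map (c ⊕_) (U₁ ++ W)) ≡ (z + (length U₁ + length W)) · c ⊕ Σ W
              expand = trans (Σ-++ (replicate z c) _) (trans (cong₂ _⊕_ (Σ-replicate z c)
                (trans (Σ-map-⊕ c (U₁ ++ W)) (cong₂ _⊕_ (cong (_· c) (length-++ U₁))
                  (trans (Σ-++ U₁ W) (trans (cong (_⊕ Σ W) ΣU₁) (⊕-identityˡ (Σ W)))))))
                (regroup-sum (z · c) ((length U₁ + length W) · c) (Σ W) (×-homo-+ c z (length U₁ + length W))))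

          avoid : ∀ {v β β′} → Reach (suc h) R v → β ∈ B → β′ ∈ B → β ≢ β′ → v ⊕ (β ⊟ β′) ≢ c ⊕ c
          avoid (W , V , p , l , refl) β∈ β′∈ β≢β′ = pair-impossible W V p l (proj₂ (∈∈⇒↭ β∈ β′∈ β≢β′))

          -- Without `x` one term is in reserve: both `C` and `C + x` consist of sums of at most
          -- `h + 1` terms of `R`. Hence `C` avoids each `2c + β - b` with `β ≠ b` and also its
          -- translate by `-x`, although at most `r` elements lie outside `C`.
          module Remove {x R₀} (R↭ : R ↭ x ∷ R₀) (uB : Unique B) (C : List G) (uC : Unique C) (𝟘∈C : 𝟘 ∈ C)
            (|C| : length C ≡ suc (length R₀)) (reach : ∀ {v} → v ∈ C → Reach h R₀ v) where

            |C|+r : length C + r ≡ n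
            |C|+r = trans (cong (_+ r) (trans |C| (sym (↭-length R↭)))) R+r

            x≢𝟘 : x ≢ 𝟘
            x≢𝟘 = NoZero⇒≢𝟘 noZero (∈-resp-↭ (↭-sym R↭) (here refl))

            reach₀ : ∀ {v} → v ∈ C → Reach (suc h) R v
            reach₀ v∈ = let W , V , p , l , e = reach v∈ in
              W , x ∷ V , ↭-trans R↭ (↭-trans (prep x p) (↭-sym (shift x W V))) , ≤-trans l (n≤1+n h) , e

            reach₁ : ∀ {v} → v ∈ C → Reach (suc h) R (v ⊕ x)
            reach₁ {v} v∈ = let W , V , p , l , e = reach v∈ in
              x ∷ W , V , ↭-trans R↭ (prep x p) , s≤s l ,
              trans (cong (x ⊕_) e) (solve (x ∷ v ∷ []) (var 0F :+ var 1F) (var 1F :+ var 0F) refl)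

            -x∉C : 𝟘 ⊟ x ∉ C
            -x∉C -x∈ = let W , V , p , l , e = reach -x∈ in
              noZero x W V (↭-trans R↭ (prep x p)) (s≤s l)
                (trans (cong (x ⊕_) e) (solve (x ∷ []) (var 0F :+ (:0 :- var 0F)) :0 refl))

            shifted : G → G → G
            shifted b β = ((c ⊕ c) ⊕ β) ⊟ b

            shifted-injective : ∀ b {β β′} → shifted b β ≡ shifted b β′ → β ≡ β′
            shifted-injective b {β} {β′} e = ≡-diff e (solve (β ∷ β′ ∷ c ∷ b ∷ []) (var 0F :- var 1F)
              ((((var 2F :+ var 2F) :+ var 0F) :- var 3F) :- (((var 2F :+ var 2F) :+ var 1F) :- var 3F)) refl)

            shifted∉C : ∀ {b β} → b ∈ B → β ∈ B → β ≢ b → shifted b β ∉ C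
            shifted∉C {b} {β} b∈ β∈ β≢b v∈ = avoid (reach₀ v∈) b∈ β∈ (β≢b ∘ sym)
              (solve (c ∷ b ∷ β ∷ []) ((((var 0F :+ var 0F) :+ var 2F) :- var 1F) :+ (var 1F :- var 2F))
                (var 0F :+ var 0F) refl)

            shifted-x∉C : ∀ {b β} → b ∈ B → β ∈ B → β ≢ b → shifted b β ⊟ x ∉ C
            shifted-x∉C {b} {β} b∈ β∈ β≢b v∈ = avoid (reach₁ v∈) b∈ β∈ (β≢b ∘ sym)
              (solve (c ∷ b ∷ β ∷ x ∷ [])
                ((((((var 0F :+ var 0F) :+ var 2F) :- var 1F) :- var 3F) :+ var 3F) :+ (var 1F :- var 2F))
                (var 0F :+ var 0F) refl)

            -- If x = b₁ − b₀ then the complement of C is both 2c + B − b₀ and 2c + B − b₁, and C is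
            -- invariant under adding x.
            no-difference : ∀ {b₁ b₀} → b₁ ∈ B → b₀ ∈ B → x ≢ b₁ ⊟ b₀
            no-difference {b₁} {b₀} b₁∈ b₀∈ x≡ = -x∉C (orbit (_∈ C) x closed 𝟘∈C)
              where
              b₁≢b₀ : b₁ ≢ b₀
              b₁≢b₀ e = x≢𝟘 (trans x≡ (trans (cong (_⊟ b₀) e) (solve (b₀ ∷ []) (var 0F :- var 0F) :0 refl)))
              2c∉C : c ⊕ c ∉ C
              2c∉C 2c∈ = avoid (reach₁ 2c∈) b₀∈ b₁∈ (b₁≢b₀ ∘ sym)
                (trans (cong (λ y → ((c ⊕ c) ⊕ y) ⊕ (b₀ ⊟ b₁)) x≡)
                  (solve (c ∷ b₀ ∷ b₁ ∷ []) (((var 0F :+ var 0F) :+ (var 2F :- var 1F)) :+ (var 1F :- var 2F))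
                    (var 0F :+ var 0F) refl))
              outside : ∀ {b β} → b ∈ B → β ∈ B → shifted b β ∉ C
              outside {b} {β} b∈ β∈ v∈ with β ≟ b
              ... | no β≢b = shifted∉C b∈ β∈ β≢b v∈
              ... | yes refl = 2c∉C (subst (_∈ C)
                    (solve (c ∷ b ∷ []) (((var 0F :+ var 0F) :+ var 1F) :- var 1F) (var 0F :+ var 0F) refl) v∈)
              K : List G
              K = map (shifted b₀) B
              uCK : Unique (C ++ K)
              uCK = Uniqueₚ.++⁺ uC (Uniqueₚ.map⁺ (shifted-injective b₀) uB) λ (v∈C , v∈K) →
                let β , β∈ , v≡ = ∈-map⁻ (shifted b₀) v∈K in outside b₀∈ β∈ (subst (_∈ C) v≡ v∈C)
              n≤CK : n ≤ length (C ++ K)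
              n≤CK = ≤-reflexive (sym (trans (length-++ C) (trans (cong (length C +_) (length-map (shifted b₀) B)) |C|+r)))
              closed : ∀ {v} → v ∈ C → v ⊕ x ∈ C
              closed {v} v∈ with ∈-++⁻ C (full uCK n≤CK (v ⊕ x))
              ... | inj₁ v⊕x∈C = v⊕x∈C
              ... | inj₂ v⊕x∈K = let β , β∈ , e = ∈-map⁻ (shifted b₀) v⊕x∈K in
                contradiction (subst (_∈ C) (≡-diff (cong₂ _⊟_ e x≡)
                  (solve (v ∷ c ∷ β ∷ b₀ ∷ b₁ ∷ x ∷ [])
                    (var 0F :- (((var 1F :+ var 1F) :+ var 2F) :- var 4F))
                    (((var 0F :+ var 5F) :- var 5F) :- ((((var 1F :+ var 1F) :+ var 2F) :- var 3F) :- (var 4F :- var 3F)))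
                    refl)) v∈) (outside b₁∈ β∈)

            -- The `r - 1` values `2c + β - b` and their translates by `-x` all lie outside `C`, and
            -- `no-difference` keeps the two families disjoint. So `2(r - 1) ≤ r`.
            length≤2 : ∀ {b Bs} → B ≡ b ∷ Bs → length Bs ≤ 1
            length≤2 {b} {Bs} B≡ = ≤-from (length Bs) 1 0
              (≤-trans (≤-reflexive (sym |CK|)) (≤-trans (Unique-bound uCK) (≤-reflexive (trans (sym |C|+r) (cong (λ Y → length C + length Y) B≡)))))
              (balance (length Bs) (length C))
              where
              balance : ∀ b c → b + (c + suc b) + 0 ≡ 1 + (c + (b + b))
              balance = ringℕ-∀
              b∈ : b ∈ B
              b∈ = subst (b ∈_) (sym B≡) (here refl)
              ∈B : ∀ {β} → β ∈ Bs → β ∈ B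
              ∈B {β} β∈ = subst (β ∈_) (sym B≡) (there β∈)
              ubBs : Unique (b ∷ Bs)
              ubBs = subst Unique B≡ uB
              uBs : Unique Bs
              uBs = Unique-++ʳ [ b ] ubBs
              β≢b : ∀ {β} → β ∈ Bs → β ≢ b
              β≢b β∈ refl = Uniqueₚ.Unique[x∷xs]⇒x∉xs ubBs β∈
              K₁ K₂ : List G
              K₁ = map (shifted b) Bs
              K₂ = map (λ β → shifted b β ⊟ x) Bs
              uK₂ : Unique K₂
              uK₂ = Uniqueₚ.map⁺ (λ {β} {β′} e → shifted-injective b (≡-diff e
                (solve (shifted b β ∷ shifted b β′ ∷ x ∷ []) (var 0F :- var 1F) ((var 0F :- var 2F) :- (var 1F :- var 2F)) refl))) uBs
              K₁-K₂ : ∀ {v} → v ∈ K₁ → v ∈ K₂ → ⊥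
              K₁-K₂ v∈₁ v∈₂ = let β , β∈ , e = ∈-map⁻ (shifted b) v∈₁
                                  β′ , β′∈ , e′ = ∈-map⁻ (λ β → shifted b β ⊟ x) v∈₂
                in no-difference (∈B β′∈) (∈B β∈) (≡-diff (trans (sym e) e′)
                  (solve (x ∷ β ∷ β′ ∷ c ∷ b ∷ []) (var 0F :- (var 2F :- var 1F))
                    ((((var 3F :+ var 3F) :+ var 1F) :- var 4F) :- ((((var 3F :+ var 3F) :+ var 2F) :- var 4F) :- var 0F)) refl))
              uCK : Unique (C ++ (K₁ ++ K₂))
              uCK = Uniqueₚ.++⁺ uC (Uniqueₚ.++⁺ (Uniqueₚ.map⁺ (shifted-injective b) uBs) uK₂ λ (v∈₁ , v∈₂) → K₁-K₂ v∈₁ v∈₂)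
                λ (v∈C , v∈K) → [ (λ v∈₁ → let β , β∈ , e = ∈-map⁻ (shifted b) v∈₁
                                            in shifted∉C b∈ (∈B β∈) (β≢b β∈) (subst (_∈ C) e v∈C))
                                , (λ v∈₂ → let β , β∈ , e = ∈-map⁻ (λ β → shifted b β ⊟ x) v∈₂
                                            in shifted-x∉C b∈ (∈B β∈) (β≢b β∈) (subst (_∈ C) e v∈C)) ]′ (∈-++⁻ K₁ v∈K)
              |CK| : length (C ++ (K₁ ++ K₂)) ≡ length C + (length Bs + length Bs)
              |CK| = trans (length-++ C) (cong (length C +_) (trans (length-++ K₁)
                (cong₂ _+_ (length-map (shifted b) Bs) (length-map (λ β → shifted b β ⊟ x) Bs))))

            -- The complement of C has two elements, but −x, 2c + β − b and 2c + β − b − x lie in it.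
            negative : r ≡ 2 → ∀ {b β} → b ∈ B → β ∈ B → β ≢ b → 𝟘 ⊟ x ≡ shifted b β
            negative r≡2 {b} {β} b∈ β∈ β≢b with (𝟘 ⊟ x) ≟ shifted b β | (𝟘 ⊟ x) ≟ (shifted b β ⊟ x)
            ... | yes e | _ = e
            ... | no _ | yes e = contradiction (subst (_∈ C) (≡-diff e (solve (x ∷ shifted b β ∷ []) (:0 :- var 1F)
                  ((:0 :- var 0F) :- (var 1F :- var 0F)) refl)) 𝟘∈C) (shifted∉C b∈ β∈ β≢b)
            ... | no ≢₁ | no ≢₂ = contradiction
              (Unique-bound (Unique-∷ (λ { (here e) → ≢₁ e ; (there (here e)) → ≢₂ e ; (there (there v∈)) → -x∉C v∈ })
                (Unique-∷ (λ { (here e) → x≢𝟘 (≡-diff e (solve (x ∷ shifted b β ∷ []) (var 0F :- :0) (var 1F :- (var 1F :- var 0F)) refl))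
                             ; (there v∈) → shifted∉C b∈ β∈ β≢b v∈ })
                  (Unique-∷ (shifted-x∉C b∈ β∈ β≢b) uC))))
              (<⇒≱ (≤-reflexive (cong suc (trans (sym |C|+r) (trans (cong (length C +_) r≡2) (+-comm (length C) 2))))))

          remove : ∀ {x R₀} → R ↭ x ∷ R₀ → ∃ λ C → Unique C × 𝟘 ∈ C × length C ≡ suc (length R₀) ×
            (∀ {v} → v ∈ C → Reach h R₀ v)
          remove {x} {R₀} R↭ = growth h R₀ (count≤-++ʳ [ x ] R↭ count≤R)
            (NoZero-++ʳ [ x ] (NoZero-↭ R↭ (NoZero-≤ (n≤1+n h) noZero)))

          -- The sums of at most `h` terms of `R` miss only `2c + β - b`. If `β - b` is this value,
          -- `negative` makes `x` equal to `b - β`, against `no-difference`. Otherwise `β - b` is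
          -- such a sum, and reversing the sign of one of its terms gives the value excluded by
          -- `flip-impossible`.
          two-refs-impossible : Unique B → r ≡ 2 → ∀ {b β} → b ∈ B → β ∈ B → β ≢ b → ∀ {x R₀} → R ↭ x ∷ R₀ → ⊥
          two-refs-impossible uB r≡2 {b} {β} b∈ β∈ β≢b {x} {R₀} R↭ =
            let C , uC , _ , |C| , reach = growth h R count≤R (NoZero-≤ (n≤1+n h) noZero)
                t∉C : (c ⊕ c) ⊕ (β ⊟ b) ∉ C
                t∉C = λ t∈ → avoid (Reach-≤ (n≤1+n h) (reach t∈)) b∈ β∈ (β≢b ∘ sym)
                  (solve (c ∷ β ∷ b ∷ []) (((var 0F :+ var 0F) :+ (var 1F :- var 2F)) :+ (var 2F :- var 1F)) (var 0F :+ var 0F) refl)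
            in decide (full (Unique-∷ t∉C uC) (≤-reflexive (sym (trans (cong suc |C|)
                 (trans (+-comm 2 (length R)) (trans (cong (length R +_) (sym r≡2)) R+r))))) (β ⊟ b)) reach
            where
            shape-negative : ∀ {w R₁} → R ↭ w ∷ R₁ → ∀ {b β} → b ∈ B → β ∈ B → β ≢ b → 𝟘 ⊟ w ≡ ((c ⊕ c) ⊕ β) ⊟ b
            shape-negative q = let C , uC , 𝟘∈C , |C| , reach = remove q in Remove.negative q uB C uC 𝟘∈C |C| reach r≡2
            shape-no-difference : ∀ {w R₁} → R ↭ w ∷ R₁ → ∀ {b₁ b₀} → b₁ ∈ B → b₀ ∈ B → w ≢ b₁ ⊟ b₀
            shape-no-difference q = let C , uC , 𝟘∈C , |C| , reach = remove q in Remove.no-difference q uB C uC 𝟘∈C |C| reach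
            flip : Reach h R (β ⊟ b) → ⊥
            flip ([] , V , p , l , e) = β≢b (≡-diff (sym e) (solve (β ∷ b ∷ []) (var 0F :- var 1F) ((var 0F :- var 1F) :- :0) refl))
            -- From `w + Σ W = β - b` and `-w = 2c + b - β` follows
            -- `Σ W - w = (β - b) - 2w = 4c + (b - β)`.
            flip (w ∷ W , V , p , l , e) = flip-impossible w W V p (≤-trans l (n≤1+n h)) (proj₂ (∈∈⇒↭ β∈ b∈ β≢b))
              (≡-diff (cong₂ _⊕_ e (cong₂ _⊕_ -w -w)) (solve (w ∷ Σ W ∷ β ∷ b ∷ c ∷ [])
                (((var 1F :- var 0F) :+ (var 2F :- var 3F)) :- ((var 4F :+ var 4F) :+ (var 4F :+ var 4F)))
                (((var 0F :+ var 1F) :+ ((:0 :- var 0F) :+ (:0 :- var 0F)))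
                  :- ((var 2F :- var 3F) :+ ((((var 4F :+ var 4F) :+ var 3F) :- var 2F) :+ (((var 4F :+ var 4F) :+ var 3F) :- var 2F)))) refl))
              where
              -w : 𝟘 ⊟ w ≡ ((c ⊕ c) ⊕ b) ⊟ β
              -w = shape-negative p β∈ b∈ (β≢b ∘ sym)
            decide : ∀ {C} → β ⊟ b ∈ ((c ⊕ c) ⊕ (β ⊟ b)) ∷ C → (∀ {v} → v ∈ C → Reach h R v) → ⊥
            decide (there v∈) reach = flip (reach v∈)
            decide (here e) _ = shape-no-difference R↭ b∈ β∈
              (≡-diff (cong₂ _⊕_ (sym (shape-negative R↭ b∈ β∈ β≢b)) e)
                (solve (x ∷ b ∷ β ∷ c ∷ []) (var 0F :- (var 1F :- var 2F))
                  (((((var 3F :+ var 3F) :+ var 2F) :- var 1F) :+ (var 2F :- var 1F))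
                    :- ((:0 :- var 0F) :+ ((var 3F :+ var 3F) :+ (var 2F :- var 1F)))) refl))

          R-empty : Unique B → 2 ≤ r → R ≡ []
          R-empty uB 2≤r = go R refl B refl 2≤r
            where
            go : ∀ R₁ → R ≡ R₁ → ∀ B₁ → B ≡ B₁ → 2 ≤ length B₁ → R ≡ []
            go [] R≡ _ _ _ = R≡
            go (x ∷ R₀) R≡ (b ∷ β ∷ Bs) B≡ _ = ⊥-elim
              (let C , uC , 𝟘∈C , |C| , reach = remove (↭-reflexive R≡)
               in two-refs-impossible uB (trans (cong length B≡) (cong suc (≤-antisym
                    (Remove.length≤2 (↭-reflexive R≡) uB C uC 𝟘∈C |C| reach B≡) (s≤s z≤n))))
                  (subst (b ∈_) (sym B≡) (here refl)) (subst (β ∈_) (sym B≡) (there (here refl)))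
                  (λ β≡b → Uniqueₚ.Unique[x∷xs]⇒x∉xs (subst Unique B≡ uB) (here (sym β≡b)))
                  (↭-reflexive R≡))
            go (_ ∷ _) _ (_ ∷ []) _ (s≤s ())

          module AllRefs (uB : Unique B) (R≡[] : R ≡ []) where

            r≡n : r ≡ n
            r≡n = trans (cong (λ Y → length Y + r) (sym R≡[])) R+r

            allB : ∀ b → b ∈ B
            allB = full uB (≤-reflexive (sym r≡n))

            -- If `2c ≠ 0`, both occur among the reflections, and their difference `2c` is forbidden
            -- already for the empty sum of rotations.
            2c≡𝟘 : c ⊕ c ≡ 𝟘
            2c≡𝟘 with (c ⊕ c) ≟ 𝟘
            ... | yes e = e
            ... | no 2c≢𝟘 = contradiction (solve (c ∷ []) (:0 :+ ((var 0F :+ var 0F) :- :0)) (var 0F :+ var 0F) refl)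
              (pair-impossible [] [] (↭-reflexive R≡[]) z≤n (proj₂ (∈∈⇒↭ (allB (c ⊕ c)) (allB 𝟘) 2c≢𝟘)))

            T↭U : T ↭ U
            T↭U = ↭-trans splits (↭-reflexive (trans (cong (U ++_) R≡[]) (++-identityʳ U)))

            -- A term `u` of `U` could be traded for the reflections `u` and `𝟘`. This preserves the
            -- sum zero, which is the required `2c`, and gains the one missing term.
            T≡[] : T ≡ []
            T≡[] = go T refl
              where
              go : ∀ T₁ → T ≡ T₁ → T ≡ []
              go [] T≡ = T≡
              go (u ∷ T₁) T≡ = ⊥-elim (impossible T₁ [ u ] h (u ∷ 𝟘 ∷ []) _
                (↭-trans (↭-reflexive T≡) (++-comm [ u ] T₁)) ≤-refl
                (proj₂ (∈∈⇒↭ (allB u) (allB 𝟘) (T≢𝟘 (subst (u ∈_) (sym T≡) (here refl))))) refl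
                (trans (regroup h (length T₁)) (trans (cong (λ m → suc (m + h))
                  (trans (sym (cong length T≡)) (↭-length T↭U))) U+h))
                (≡-diff (cong₂ _⊟_ (trans (sym (cong Σ T≡)) (trans (Σ-↭ T↭U) ΣU)) 2c≡𝟘) (solve (u ∷ Σ T₁ ∷ c ∷ [])
                  ((var 1F :+ (var 0F :- (:0 :- :0))) :- (var 2F :+ (var 2F :+ :0)))
                  (((var 0F :+ var 1F) :- (var 2F :+ var 2F)) :- (:0 :- :0)) refl)))
                where
                regroup : ∀ h t → h + t + 2 ≡ suc (suc t + h)
                regroup = ringℕ-∀

            suc-h : suc h ≡ L
            suc-h = trans (cong (λ Y → suc (length Y + h)) (sym T≡[])) (trans (cong (λ m → suc (m + h)) (↭-length T↭U)) U+h)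

            constant : A ↭ replicate h c
            constant = ↭-trans shape (↭-reflexive (trans (cong (λ Y → replicate h c ++ map (c ⊕_) Y) T≡[]) (++-identityʳ _)))

          module OneRef (r≡1 : r ≡ 1) (L≤2n : L ≤ n + n) where

            |R|+1 : suc (length R) ≡ n
            |R|+1 = trans (+-comm 1 (length R)) (trans (cong (length R +_) (sym r≡1)) R+r)

            R-constant : ∀ {a b} → a ∈ R → b ∈ R → a ≡ b
            R-constant {a} {b} a∈ b∈ with a ≟ b
            ... | yes a≡b = a≡b
            ... | no a≢b =
              let o , 1+o = m≤n⇒∃[o]m+o≡n 1≤h
                  C , uC , _ , |C| , _ = growth-nonconstant o R
                    (λ x → ≤-trans (count≤R x) (≤-reflexive (sym 1+o)))
                    (NoZero-≤ (≤-reflexive (cong suc 1+o)) noZero) a∈ b∈ a≢b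
              in contradiction (≤-trans (≤-reflexive (sym (trans |C| (cong suc |R|+1)))) (Unique-bound uC)) (<-irrefl refl)

            -- By the size of `R` every element, in particular `u`, is a sum of at most `h` terms of
            -- `R`. If it had at least two terms, they could replace `u` in `U`, with the same sum
            -- and enough length to reach `L`.
            U-constant : ∀ {u x} → u ∈ U → x ∈ R → u ≡ x
            U-constant {u} {x} u∈ x∈ =
              let C , uC , _ , |C| , reach = growth h R count≤R (NoZero-≤ (n≤1+n h) noZero)
                  U′ , U↭ = ∈⇒↭ u∈
              in cases U↭ (reach (full uC (≤-reflexive (sym (trans |C| |R|+1))) u))
              where
              cases : ∀ {U′} → U ↭ u ∷ U′ → Reach h R u → u ≡ x
              cases U↭ ([] , V , p , l , e) = ⊥-elim (T≢𝟘 (∈-resp-↭ (↭-sym splits) (∈-++⁺ˡ u∈)) (sym e))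
              cases U↭ (w ∷ [] , V , p , l , e) = trans (sym e) (trans (⊕-identityʳ w)
                (R-constant (∈-resp-↭ (↭-sym p) (here refl)) x∈))
              cases {U′} U↭ (w ∷ w′ ∷ W , V , p , l , e) =
                let z , W+z = m≤n⇒∃[o]m+o≡n (<⇒≤ (<⇒≤ l))
                    W′ = w ∷ w′ ∷ W
                in ⊥-elim (impossible (U′ ++ W′) (u ∷ V) z [] B
                  (↭-trans splits (↭-trans (++⁺ (↭-trans U↭ (++-comm [ u ] U′)) p) (↭-trans (++-assoc U′ [ u ] (W′ ++ V))
                    (↭-trans (++⁺ˡ U′ (shifts [ u ] W′)) (↭-sym (++-assoc U′ W′ (u ∷ V)))))))
                  (≤-trans (m≤n+m z (length W)) (≤-reflexive W+z)) ↭-refl refl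
                  (trans (cong (λ m → z + m + 0) (length-++ U′)) (trans (regroup z (length U′) (length W))
                    (trans (cong₂ (λ a b → suc (a + b)) (sym (↭-length U↭)) W+z) U+h)))
                  (trans (⊕-identityʳ _) (trans (Σ-++ U′ W′) (trans (cong (Σ U′ ⊕_) e)
                    (trans (solve (u ∷ Σ U′ ∷ []) (var 1F :+ var 0F) (var 0F :+ var 1F) refl) (trans (sym (Σ-↭ U↭)) ΣU))))))
                where
                regroup : ∀ z u w → z + (u + suc (suc w)) + 0 ≡ suc (suc u + (w + z))
                regroup = ringℕ-∀

            module WithGenerator (x : G) (x∈R : x ∈ R) where

              R≡ : R ≡ replicate (length R) x
              R≡ = constant⇒replicate R λ a∈ → R-constant a∈ x∈R

              U≡ : U ≡ replicate (length U) x
              U≡ = constant⇒replicate U λ u∈ → U-constant u∈ x∈R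

              count-T : length U + length R ≤ h
              count-T = ≤-trans (≤-reflexive (sym (trans (count-↭ x splits) (trans (count-++ x U R)
                (cong₂ _+_ (trans (cong (count x) U≡) (count-replicate x (length U)))
                           (trans (cong (count x) R≡) (count-replicate x (length R))))))))
                (count≤ x)

              -- `R` consists of `n - 1` copies of `x`, and `n - 1 ≤ h` by `count-T`, so `j` of
              -- these copies are short enough for `noZero`.
              multiple≢𝟘 : ∀ j → 1 ≤ j → j < n → j · x ≢ 𝟘
              multiple≢𝟘 (suc j) _ j<n e =
                let o , j+o = m≤n⇒∃[o]m+o≡n (≤-pred (≤-trans j<n (≤-reflexive (sym |R|+1))))
                in noZero x (replicate j x) (replicate o x)
                  (↭-reflexive (trans R≡ (trans (cong (λ k → replicate k x) (sym j+o)) (replicate-+ (suc j) o x))))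
                  (≤-trans (≤-reflexive (length-replicate (suc j))) (≤-trans (m≤m+n (suc j) o) (≤-trans (≤-reflexive j+o)
                    (≤-trans (m≤n+m (length R) (length U)) (≤-trans count-T (n≤1+n h))))))
                  (trans (Σ-replicate (suc j) x) e)

              -- The bound `L ≤ 2n` enters here: `length U + (n - 1) ≤ h` and `length U + h + 1 = L`
              -- give `2 · length U ≤ n`. A nonempty `U` would then be a zero sum of fewer than `n`
              -- copies of `x`.
              U≡[] : U ≡ []
              U≡[] = go U refl
                where
                go : ∀ U₁ → U ≡ U₁ → U ≡ []
                go [] U≡[] = U≡[]
                go (u ∷ U₁) U≡∷ = ⊥-elim (multiple≢𝟘 (length U) (≤-trans (s≤s z≤n) (≤-reflexive (sym (cong length U≡∷))))
                  (≤-from (suc (length U)) n (length U₁) (+-mono-≤ (+-mono-≤ count-T (≤-trans (≤-reflexive U+h) L≤2n))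
                      (+-mono-≤ (≤-reflexive (sym |R|+1)) (≤-reflexive (sym (cong length U≡∷)))))
                    (balance (length U) (length R) h n (length U₁)))
                  (trans (sym (Σ-replicate (length U) x)) (trans (cong Σ (sym U≡)) ΣU)))
                  where
                  balance : ∀ u ρ h n v → suc u + (h + (n + n) + (suc ρ + u)) + v ≡ n + (u + ρ + suc (u + h) + (n + suc v))
                  balance = ringℕ-∀

              suc-h : suc h ≡ L
              suc-h = trans (cong (λ Y → suc (length Y + h)) (sym U≡[])) U+h

              two-values : A ↭ replicate h c ++ replicate (length R) (c ⊕ x)
              two-values = ↭-trans shape (++⁺ˡ (replicate h c) (↭-trans (map⁺ (c ⊕_) splits)
                (↭-reflexive (trans (cong (λ Y → map (c ⊕_) (Y ++ R)) U≡[])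
                  (trans (cong (map (c ⊕_)) R≡) (map-replicate (c ⊕_) (length R) x))))))

    record TwoValues : Set where
      field
        c x          : G
        h m          : ℕ
        suc-h        : suc h ≡ L
        suc-m        : suc m ≡ n
        shape        : A ↭ replicate h c ++ replicate m (c ⊕ x)
        multiple≢𝟘   : ∀ j → 1 ≤ j → j < n → j · x ≢ 𝟘

    record Degenerate : Set where
      field
        c      : G
        h      : ℕ
        suc-h  : suc h ≡ L
        2c≡𝟘   : c ⊕ c ≡ 𝟘
        shape  : A ↭ replicate h c
        r≡n    : length B ≡ n

    module _ (2≤n : 2 ≤ n) (L≤2n : L ≤ n + n) (uB : Unique B) where

      extremal : length B ≡ 1 × TwoValues ⊎ Degenerate
      extremal = go A refl
        where
        go : ∀ A₁ → A ≡ A₁ → length B ≡ 1 × TwoValues ⊎ Degenerate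
        go [] A≡ = ⊥-elim (<-irrefl refl (≤-trans 2≤n (≤-from n 1 0
            (+-mono-≤ n≤L (+-mono-≤ (Unique-bound uB) (≤-reflexive (trans (sym |A|+r) (cong (λ Y → suc (length Y + r)) A≡)))))
            (balance n L r))))
          where
          balance : ∀ n L r → n + (L + (n + suc r)) + 0 ≡ 1 + (n + (r + (L + n)))
          balance = ringℕ-∀
        go (a ∷ A₁) A≡ = withFrame (subst Frame (sym A≡) (frame a A₁))
          where
          withFrame : Frame A → length B ≡ 1 × TwoValues ⊎ Degenerate
          withFrame fr = withStuck stuck
            where
            open WithFrame fr
            withStuck : Stuck L (Frame.h fr) (Frame.T fr) → length B ≡ 1 × TwoValues ⊎ Degenerate
            withStuck st = withSlack (m≤n⇒∃[o]m+o≡n short)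
              where
              open Stuck st using (short; U; R)
              withSlack : (∃ λ o → suc (length U + Frame.h fr) + o ≡ L) → length B ≡ 1 × TwoValues ⊎ Degenerate
              withSlack (o , o≡) = tight (s≡1 uB)
                where
                open WithStuck st (suc o) (trans (+-suc (length U + Frame.h fr) o) o≡) (s≤s z≤n)
                tight : suc o ≡ 1 → length B ≡ 1 × TwoValues ⊎ Degenerate
                tight eq = decide (2 ≤? r)
                  where
                  open Tight eq
                  decide : Dec (2 ≤ r) → length B ≡ 1 × TwoValues ⊎ Degenerate
                  decide (yes 2≤r) = inj₂ record
                    { c = Frame.c fr ; h = Frame.h fr ; suc-h = suc-h ; 2c≡𝟘 = 2c≡𝟘 ; shape = constant ; r≡n = r≡n }
                    where open AllRefs uB (R-empty uB 2≤r)
                  decide (no 2≰r) = generator R refl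
                    where
                    r≡1 : r ≡ 1
                    r≡1 = ≤-antisym (≤-pred (≰⇒> 2≰r)) (≤-trans (s≤s z≤n) s≤r)
                    open OneRef r≡1 L≤2n
                    generator : ∀ R₁ → R ≡ R₁ → length B ≡ 1 × TwoValues ⊎ Degenerate
                    generator [] R≡ = ⊥-elim (<-irrefl (trans (cong (suc ∘ length) (sym R≡)) |R|+1) 2≤n)
                    generator (x ∷ _) R≡ = inj₁ (r≡1 , record
                      { c = Frame.c fr ; x = x ; h = Frame.h fr ; m = length R ; suc-h = suc-h ; suc-m = |R|+1
                      ; shape = two-values ; multiple≢𝟘 = multiple≢𝟘 })
                      where open WithGenerator x (subst (x ∈_) (sym R≡) (here refl))

-- A repeated reflection: balanced pairs and quadruples.

module _ {A B : Set} where

  Unique-map : ∀ (f : A → B) {xs} → (∀ {x y} → x ∈ xs → y ∈ xs → f x ≡ f y → x ≡ y) → Unique xs → Unique (map f xs)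
  Unique-map f {[]} inj u = []
  Unique-map f {x ∷ xs} inj u@(_ ∷ u′) = Unique-∷
    (λ fx∈ → let y , y∈ , e = ∈-map⁻ f fx∈ in
       Uniqueₚ.Unique[x∷xs]⇒x∉xs u (subst (_∈ xs) (sym (inj (here refl) (there y∈) e)) y∈))
    (Unique-map f (λ x∈ y∈ → inj (there x∈) (there y∈)) u′)

  length-cartesianProduct : ∀ (xs : List A) (ys : List B) → length (cartesianProduct xs ys) ≡ length xs * length ys
  length-cartesianProduct [] ys = refl
  length-cartesianProduct (x ∷ xs) ys = trans (length-++ (map (x ,_) ys))
    (cong₂ _+_ (length-map (x ,_) ys) (length-cartesianProduct xs ys))

module Pairing {G : Set} (_≟_ : DecidableEquality G)
  (_∙_ : G → G → G) (𝟘 : G) (_⁻¹ : G → G) (isAbelianGroup : IsAbelianGroup _≡_ _∙_ 𝟘 _⁻¹)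
  (n : ℕ)
  (Unique-bound : ∀ {xs : List G} → Unique xs → length xs ≤ n)
  (full : ∀ {C : List G} → Unique C → n ≤ length C → ∀ v → v ∈ C)
  where

  open AbelianSums _∙_ 𝟘 _⁻¹ isAbelianGroup
  open Counting _≟_

  -- k pairs taken from the rotations A and the reflections B, leaving A′ and B′. The elements
  -- of P and F⁺ count positively, those of N and F⁻ negatively.
  record Fill (k q : ℕ) (A B A′ B′ : List G) : Set where
    constructor fill
    field
      P N F⁺ F⁻ : List G
      A↭   : A ↭ (P ++ N) ++ A′
      B↭   : B ↭ (F⁺ ++ F⁻) ++ B′
      |F⁺| : length F⁺ ≡ q
      |F⁻| : length F⁻ ≡ q
      size : length (P ++ N) + (q + q) ≡ k + k
      sum  : Σ P ⊕ Σ F⁺ ≡ Σ N ⊕ Σ F⁻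

  private
    merge : ∀ {A A′ A″} P N {P′ N′ : List G} → A ↭ (P ++ N) ++ A′ → A′ ↭ (P′ ++ N′) ++ A″ →
            A ↭ ((P ++ P′) ++ (N ++ N′)) ++ A″
    merge {A″ = A″} P N {P′} {N′} p p′ = ↭-trans p (↭-trans (++⁺ˡ (P ++ N) p′)
      (↭-trans (↭-sym (++-assoc (P ++ N) (P′ ++ N′) A″)) (++⁺ʳ A″
        (↭-trans (++-assoc P N (P′ ++ N′)) (↭-trans (++⁺ˡ P (shifts N P′)) (↭-sym (++-assoc P P′ (N ++ N′))))))))

    interchange : ∀ a b c d → (a + b) + (c + d) ≡ (a + c) + (b + d)
    interchange = ringℕ-∀

  fill-++ : ∀ {k k′ q q′ A B A′ B′ A″ B″} → Fill k q A B A′ B′ → Fill k′ q′ A′ B′ A″ B″ →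
            Fill (k + k′) (q + q′) A B A″ B″
  fill-++ {k} {k′} {q} {q′} (fill P N F⁺ F⁻ A↭ B↭ |F⁺| |F⁻| size sum) (fill P′ N′ F⁺′ F⁻′ A↭′ B↭′ |F⁺|′ |F⁻|′ size′ sum′) =
    fill (P ++ P′) (N ++ N′) (F⁺ ++ F⁺′) (F⁻ ++ F⁻′) (merge P N A↭ A↭′) (merge F⁺ F⁻ B↭ B↭′)
      (trans (length-++ F⁺) (cong₂ _+_ |F⁺| |F⁺|′)) (trans (length-++ F⁻) (cong₂ _+_ |F⁻| |F⁻|′))
      (begin
        length ((P ++ P′) ++ (N ++ N′)) + ((q + q′) + (q + q′))
          ≡⟨ cong (_+ ((q + q′) + (q + q′))) (trans (length-++ (P ++ P′)) (trans (cong₂ _+_ (length-++ P) (length-++ N))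
               (interchange (length P) _ _ _))) ⟩
        ((length P + length N) + (length P′ + length N′)) + ((q + q′) + (q + q′))
          ≡⟨ cong₂ (λ x y → (x + y) + ((q + q′) + (q + q′))) (sym (length-++ P)) (sym (length-++ P′)) ⟩
        (length (P ++ N) + length (P′ ++ N′)) + ((q + q′) + (q + q′))
          ≡⟨ regroup (length (P ++ N)) (length (P′ ++ N′)) q q′ ⟩
        (length (P ++ N) + (q + q)) + (length (P′ ++ N′) + (q′ + q′))
          ≡⟨ cong₂ _+_ size size′ ⟩
        (k + k) + (k′ + k′)
          ≡⟨ interchange k k k′ k′ ⟩
        (k + k′) + (k + k′) ∎)
      (trans (cong₂ _⊕_ (Σ-++ P P′) (Σ-++ F⁺ F⁺′)) (trans (≡-diff (cong₂ _⊕_ sum sum′)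
        (solve (Σ P ∷ Σ P′ ∷ Σ F⁺ ∷ Σ F⁺′ ∷ Σ N ∷ Σ N′ ∷ Σ F⁻ ∷ Σ F⁻′ ∷ [])
          (((var 0F :+ var 1F) :+ (var 2F :+ var 3F)) :- ((var 4F :+ var 5F) :+ (var 6F :+ var 7F)))
          (((var 0F :+ var 2F) :+ (var 1F :+ var 3F)) :- ((var 4F :+ var 6F) :+ (var 5F :+ var 7F))) refl))
        (sym (cong₂ _⊕_ (Σ-++ N N′) (Σ-++ F⁻ F⁻′)))))
    where
    open ≡-Reasoning
    regroup : ∀ a b q q′ → (a + b) + ((q + q′) + (q + q′)) ≡ (a + (q + q)) + (b + (q′ + q′))
    regroup = ringℕ-∀

  fill-length : ∀ {k q A B A′ B′} → Fill k q A B A′ B′ → length A + length B ≡ (k + k) + (length A′ + length B′)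
  fill-length {k} {q} {A} {B} {A′} {B′} (fill P N F⁺ F⁻ A↭ B↭ |F⁺| |F⁻| size sum) =
    trans (cong₂ _+_ (trans (↭-length A↭) (length-++ (P ++ N)))
      (trans (↭-length B↭) (trans (length-++ (F⁺ ++ F⁻)) (cong (_+ length B′) (trans (length-++ F⁺) (cong₂ _+_ |F⁺| |F⁻|))))))
      (trans (interchange (length (P ++ N)) (length A′) (q + q) (length B′)) (cong (_+ (length A′ + length B′)) size))

  fill-↭ : ∀ {k q A B A′ B′ A₁ B₁} → A₁ ↭ A → B₁ ↭ B → Fill k q A B A′ B′ → Fill k q A₁ B₁ A′ B′
  fill-↭ p p′ (fill P N F⁺ F⁻ A↭ B↭ |F⁺| |F⁻| size sum) =
    fill P N F⁺ F⁻ (↭-trans p A↭) (↭-trans p′ B↭) |F⁺| |F⁻| size sum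

  fill-extend : ∀ {k q A B A′ B′} X Y → Fill k q A B A′ B′ → Fill k q (X ++ A) (Y ++ B) (X ++ A′) (Y ++ B′)
  fill-extend X Y (fill P N F⁺ F⁻ A↭ B↭ |F⁺| |F⁻| size sum) =
    fill P N F⁺ F⁻ (↭-trans (++⁺ˡ X A↭) (shifts X (P ++ N))) (↭-trans (++⁺ˡ Y B↭) (shifts Y (F⁺ ++ F⁻))) |F⁺| |F⁻| size sum

  fill-[] : ∀ {A B} → Fill 0 0 A B A B
  fill-[] = fill [] [] [] [] ↭-refl ↭-refl refl refl refl refl

  pairA : ∀ {a A A′ B} → A ↭ a ∷ a ∷ A′ → Fill 1 0 A B A′ B
  pairA {a} p = fill [ a ] [ a ] [] [] p ↭-refl refl refl refl refl

  pairB : ∀ {b A B B′} → B ↭ b ∷ b ∷ B′ → Fill 1 1 A B A B′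
  pairB {b} p = fill [] [] [ b ] [ b ] ↭-refl p refl refl refl refl

  oppositeA : ∀ {e A A′ B} → A ↭ e ∷ ⊖ e ∷ A′ → Fill 1 0 A B A′ B
  oppositeA {e} p = fill (e ∷ ⊖ e ∷ []) [] [] [] p ↭-refl refl refl refl
    (solve (e ∷ []) ((var 0F :+ ((:- var 0F) :+ :0)) :+ :0) (:0 :+ :0) refl)

  mixed : ∀ {a a′ b b′ A A′ B B′} → A ↭ a ∷ a′ ∷ A′ → B ↭ b ∷ b′ ∷ B′ → a ⊕ b ≡ a′ ⊕ b′ → Fill 2 1 A B A′ B′
  mixed {a} {a′} {b} {b′} p p′ e = fill [ a ] [ a′ ] [ b ] [ b′ ] p p′ refl refl refl
    (≡-diff e (solve (a ∷ a′ ∷ b ∷ b′ ∷ []) (((var 0F :+ :0) :+ (var 2F :+ :0)) :- ((var 1F :+ :0) :+ (var 3F :+ :0)))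
      ((var 0F :+ var 2F) :- (var 1F :+ var 3F)) refl))

  private
    double : ∀ {a b c d} → a ⊕ b ≡ c ⊕ d → (a ⊕ (b ⊕ 𝟘)) ≡ (c ⊕ (d ⊕ 𝟘))
    double {a} {b} {c} {d} e = ≡-diff e (solve (a ∷ b ∷ c ∷ d ∷ [])
      ((var 0F :+ (var 1F :+ :0)) :- (var 2F :+ (var 3F :+ :0))) ((var 0F :+ var 1F) :- (var 2F :+ var 3F)) refl)

  quadA : ∀ {a b c d A A′ B} → A ↭ a ∷ b ∷ c ∷ d ∷ A′ → a ⊕ b ≡ c ⊕ d → Fill 2 0 A B A′ B
  quadA {a} {b} {c} {d} p e = fill (a ∷ b ∷ []) (c ∷ d ∷ []) [] [] p ↭-refl refl refl refl (cong (_⊕ 𝟘) (double e))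

  quadB : ∀ {a b c d A B B′} → B ↭ a ∷ b ∷ c ∷ d ∷ B′ → a ⊕ b ≡ c ⊕ d → Fill 2 2 A B A B′
  quadB {a} {b} {c} {d} p e = fill [] [] (a ∷ b ∷ []) (c ∷ d ∷ []) ↭-refl p refl refl refl (cong (𝟘 ⊕_) (double e))

  -- If equal sums always had equal first summands, addition would be injective on the product of
  -- `A` and `B`, which has more than `n` elements.
  collision : ∀ {A B} → Unique A → Unique B → n < length A * length B →
    ∃₂ λ a a′ → ∃₂ λ b b′ → a ∈ A × a′ ∈ A × b ∈ B × b′ ∈ B × a ≢ a′ × b ≢ b′ × a ⊕ b ≡ a′ ⊕ b′
  collision {A} {B} uA uB n< with any? (λ (a , b) → any? (λ (a′ , b′) → ¬? (a ≟ a′) ×-dec (a ⊕ b) ≟ (a′ ⊕ b′)) AB) AB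
    where AB = cartesianProduct A B
  ... | yes found =
    let (a , b) , ab∈ , found′ = find found
        (a′ , b′) , ab′∈ , a≢a′ , e = find found′
        a∈ , b∈ = ∈-cartesianProduct⁻ A B ab∈
        a′∈ , b′∈ = ∈-cartesianProduct⁻ A B ab′∈
    in a , a′ , b , b′ , a∈ , a′∈ , b∈ , b′∈ , a≢a′ ,
       (λ b≡b′ → a≢a′ (≡-diff (cong₂ _⊟_ e b≡b′) (solve (a ∷ a′ ∷ b ∷ b′ ∷ []) (var 0F :- var 1F)
         (((var 0F :+ var 2F) :- var 2F) :- ((var 1F :+ var 3F) :- var 3F)) refl))) , e
  ... | no none = contradiction (Unique-bound (Unique-map add inj (Uniqueₚ.cartesianProduct⁺ uA uB)))
    (<⇒≱ (≤-trans n< (≤-reflexive (sym (trans (length-map add (cartesianProduct A B)) (length-cartesianProduct A B))))))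
    where
    add : G × G → G
    add (a , b) = a ⊕ b
    inj : ∀ {x y} → x ∈ cartesianProduct A B → y ∈ cartesianProduct A B → add x ≡ add y → x ≡ y
    inj {a , b} {a′ , b′} x∈ y∈ e with a ≟ a′
    ... | yes refl = cong (a ,_) (⊕-cancelˡ a e)
    ... | no a≢a′ = contradiction (lose x∈ (lose y∈ (a≢a′ , e))) none

  -- For numbers that are at least two the product is at least the sum, so `collision` applies. The
  -- block contains reflections of both signs, which `continue` and `core` rely on.
  mixedBlock : ∀ {A B} → Unique A → Unique B → n < length A + length B → 2 ≤ length A → 2 ≤ length B →
               ∃₂ λ A′ B′ → Fill 2 1 A B A′ B′
  mixedBlock {A} {B} uA uB n< 2≤A 2≤B =
    let a , a′ , b , b′ , a∈ , a′∈ , b∈ , b′∈ , a≢a′ , b≢b′ , e = collision uA uB (≤-trans n< (sum≤product 2≤A 2≤B))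
        A′ , p = ∈∈⇒↭ a∈ a′∈ a≢a′
        B′ , p′ = ∈∈⇒↭ b∈ b′∈ b≢b′
    in A′ , B′ , mixed p p′ e
    where
    sum≤product : ∀ {a b} → 2 ≤ a → 2 ≤ b → a + b ≤ a * b
    sum≤product {suc (suc a)} {suc (suc b)} _ _ = ≤-trans (m≤m+n _ (a + b + a * b)) (≤-reflexive (expand a b))
      where
      expand : ∀ a b → (2 + a) + (2 + b) + (a + b + a * b) ≡ (2 + a) * (2 + b)
      expand = ringℕ-∀
    sum≤product {suc zero} (s≤s ()) _
    sum≤product {_} {suc zero} _ (s≤s ())

  two-repeats : ∀ xs → (∃₂ λ x ys → xs ↭ x ∷ x ∷ ys × Unique ys) ⊎ Unique xs ⊎
                       (∃₂ λ x y → ∃ λ zs → xs ↭ x ∷ x ∷ y ∷ y ∷ zs)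
  two-repeats xs with unique? xs
  ... | yes u = inj₂ (inj₁ u)
  ... | no ¬u with x , ys , p ← ¬Unique⇒repeat xs ¬u with unique? ys
  ... | yes u = inj₁ (x , ys , p , u)
  ... | no ¬u′ = let y , zs , q = ¬Unique⇒repeat ys ¬u′ in inj₂ (inj₂ (x , y , zs , ↭-trans p (prep x (prep x q))))

  module _ {f₀ f₁ f₂ f₃ : G} (distinct : Unique (f₀ ∷ f₁ ∷ f₂ ∷ f₃ ∷ [])) (f≡ : f₀ ⊕ f₃ ≡ f₁ ⊕ f₂) where

    quads : ∀ {X} → Unique X → n ≤ length X → ∃ λ X′ → X ↭ f₀ ∷ f₃ ∷ f₁ ∷ f₂ ∷ X′
    quads {X} uX n≤ = take distinct
      where
      take : Unique (f₀ ∷ f₁ ∷ f₂ ∷ f₃ ∷ []) → ∃ λ X′ → X ↭ f₀ ∷ f₃ ∷ f₁ ∷ f₂ ∷ X′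
      take ((≢₀₁ ∷ ≢₀₂ ∷ ≢₀₃ ∷ []) ∷ (≢₁₂ ∷ ≢₁₃ ∷ []) ∷ (≢₂₃ ∷ []) ∷ [] ∷ []) =
        let X₁ , p₁ = ∈⇒↭ (full uX n≤ f₀)
            X₂ , p₂ = ∈⇒↭ (later p₁ (≢₀₃ ∘ sym) (full uX n≤ f₃))
            X₃ , p₃ = ∈⇒↭ (later p₂ ≢₁₃ (later p₁ (≢₀₁ ∘ sym) (full uX n≤ f₁)))
            X₄ , p₄ = ∈⇒↭ (later p₃ (≢₁₂ ∘ sym) (later p₂ ≢₂₃ (later p₁ (≢₀₂ ∘ sym) (full uX n≤ f₂))))
        in X₄ , ↭-trans p₁ (prep _ (↭-trans p₂ (prep _ (↭-trans p₃ (prep _ p₄)))))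
        where
        later : ∀ {x v X X′} → X ↭ x ∷ X′ → v ≢ x → v ∈ X → v ∈ X′
        later p v≢x v∈ with ∈-resp-↭ p v∈
        ... | here v≡x = contradiction v≡x v≢x
        ... | there v∈′ = v∈′

    -- If one of the lists has at most one element, the other is the whole group and contains the
    -- given quadruple.
    distinctBlock : ∀ {A B} → Unique A → Unique B → n < length A + length B →
                    ∃ λ q → ∃₂ λ A′ B′ → Fill 2 q A B A′ B′
    distinctBlock {A} {B} uA uB n< with 2 ≤? length A | 2 ≤? length B
    ... | yes 2≤A | yes 2≤B = 1 , mixedBlock uA uB n< 2≤A 2≤B
    ... | no 2≰A | _ = let B′ , p = quads uB (≤-pred (≤-trans n< (+-monoˡ-≤ (length B) (≤-pred (≰⇒> 2≰A))))) in
      2 , A , B′ , quadB p f≡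
    ... | yes _ | no 2≰B = let A′ , p = quads uA (≤-pred (≤-trans n< (≤-trans (+-monoʳ-≤ (length A) (≤-pred (≰⇒> 2≰B))) (≤-reflexive (+-comm (length A) 1))))) in
      0 , A′ , B , quadA p f≡

    -- The bound is `n + 3` and not `n + 1` because a single repeated pair may have to be set aside
    -- before `n + 1` distinct terms are left.
    block : ∀ A B → 3 + n ≤ length A + length B → ∃ λ q → ∃₂ λ A′ B′ → Fill 2 q A B A′ B′
    block A B n≤ with two-repeats A | two-repeats B
    ... | inj₂ (inj₂ (x , y , zs , p)) | _ = 0 , zs , B , fill-++ (pairA p) (pairA ↭-refl)
    ... | _ | inj₂ (inj₂ (x , y , zs , p)) = 2 , A , zs , fill-++ (pairB p) (pairB ↭-refl)
    ... | inj₁ (x , ys , p , _) | inj₁ (y , zs , p′ , _) = 1 , ys , zs , fill-++ (pairA p) (pairB p′)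
    ... | inj₂ (inj₁ uA) | inj₂ (inj₁ uB) = distinctBlock uA uB (≤-trans (m≤n+m (suc n) 2) n≤)
    ... | inj₁ (x , ys , p , uys) | inj₂ (inj₁ uB) =
      let q , A′ , B′ , f = distinctBlock uys uB (≤-pred (≤-pred (≤-trans n≤ (≤-reflexive (cong (_+ length B) (↭-length p))))))
      in q , x ∷ x ∷ A′ , B′ , fill-↭ p ↭-refl (fill-extend (x ∷ x ∷ []) [] f)
    ... | inj₂ (inj₁ uA) | inj₁ (y , ys , p , uys) =
      let q , A′ , B′ , f = distinctBlock uA uys (≤-pred (≤-pred (≤-trans n≤ (≤-reflexive
            (trans (cong (length A +_) (↭-length p)) (regroup (length A) (length ys)))))))
      in q , A′ , y ∷ y ∷ B′ , fill-↭ ↭-refl p (fill-extend [] (y ∷ y ∷ []) f)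
      where
      regroup : ∀ a b → a + suc (suc b) ≡ suc (suc (a + b))
      regroup = ringℕ-∀

    -- The hypothesis leaves at least `n + 4 - 1` terms before the last quadruple, exactly what
    -- `block` requires.
    blocks : ∀ u A B → (u + u) + (u + u) + n ≤ suc (length A + length B) →
             ∃ λ q → ∃₂ λ A′ B′ → Fill (u + u) q A B A′ B′
    blocks zero A B _ = 0 , A , B , fill-[]
    blocks (suc u) A B n≤ =
      let q , A₁ , B₁ , f = block A B (≤-pred (≤-trans (enough u n) n≤))
          q′ , A₂ , B₂ , g = blocks u A₁ B₁ (≤-from _ _ 0 (≤-trans n≤ (≤-reflexive (cong suc (fill-length f)))) (balance u n (length A₁ + length B₁)))
      in q + q′ , A₂ , B₂ , subst (λ k → Fill k (q + q′) A B A₂ B₂) (cong suc (sym (+-suc u u))) (fill-++ f g)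
      where
      enough : ∀ u n → 4 + n ≤ (suc u + suc u) + (suc u + suc u) + n
      enough u n = ≤-trans (m≤m+n (4 + n) (u + u + u + u)) (≤-reflexive (eq u n))
        where
        eq : ∀ u n → 4 + n + (u + u + u + u) ≡ (suc u + suc u) + (suc u + suc u) + n
        eq = ringℕ-∀
      balance : ∀ u n a → (u + u) + (u + u) + n + suc (4 + a) + 0 ≡ suc a + ((suc u + suc u) + (suc u + suc u) + n)
      balance = ringℕ-∀

  both-in : ∀ {X} → Unique X → n ≤ length X → ∀ {u v} → u ≢ v → ∃ λ X′ → X ↭ u ∷ v ∷ X′
  both-in uX n≤ {u} {v} = ∈∈⇒↭ (full uX n≤ u) (full uX n≤ v)

  even-or-odd : ∀ t → ∃ λ u → t ≡ u + u ⊎ t ≡ suc (u + u)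
  even-or-odd zero = 0 , inj₁ refl
  even-or-odd (suc t) with even-or-odd t
  ... | u , inj₁ eq = u , inj₂ (cong suc eq)
  ... | u , inj₂ eq = suc u , inj₁ (cong suc (trans eq (sym (+-suc u u))))

  private
    move : ∀ a b → a + suc (suc b) ≡ suc (suc (a + b))
    move = ringℕ-∀

  module _ {f₀ f₁ f₂ f₃ e : G} (distinct : Unique (f₀ ∷ f₁ ∷ f₂ ∷ f₃ ∷ [])) (f≡ : f₀ ⊕ f₃ ≡ f₁ ⊕ f₂) (e≢-e : e ≢ ⊖ e) where

    -- For `L = 2t + 2` the pair `b, b` leaves `t` pairs to be found. Quadruples suffice for even
    -- `t`. For odd `t` one further pair is needed, and the hard case is that of distinct terms,
    -- where no equal pair is available.
    repeated : ∀ t A b B → suc (length A + length B) ≡ (t + t) + n →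
               ∃ λ q → ∃₂ λ A′ B′ → Fill (suc t) (suc q) A (b ∷ b ∷ B) A′ B′
    repeated t A b B size with even-or-odd t
    ... | u , inj₁ refl =
      let q , A′ , B′ , f = blocks distinct f≡ u A B (≤-reflexive (sym size))
      in q , A′ , B′ , fill-++ (pairB ↭-refl) f
    ... | u , inj₂ refl with unique? A | unique? B
    ... | no ¬uA | _ =
      let a , A₁ , p = ¬Unique⇒repeat A ¬uA
          q , A′ , B′ , f = blocks distinct f≡ u A₁ B (≤-reflexive (sym (suc-injective (suc-injective
            (trans (cong (λ m → suc (m + length B)) (sym (↭-length p))) (trans size (balance u n)))))))
      in q , A′ , B′ , fill-++ (pairB ↭-refl) (fill-++ (pairA p) f)
      where
      balance : ∀ u n → (suc (u + u) + suc (u + u)) + n ≡ suc (suc ((u + u) + (u + u) + n))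
      balance = ringℕ-∀
    ... | yes _ | no ¬uB =
      let y , B₁ , p = ¬Unique⇒repeat B ¬uB
          q , A′ , B′ , f = blocks distinct f≡ u A B₁ (≤-reflexive (sym (suc-injective (suc-injective
            (trans (cong suc (trans (sym (move (length A) (length B₁))) (cong (length A +_) (sym (↭-length p))))) (trans size (balance u n)))))))
      in suc q , A′ , B′ , fill-++ (pairB ↭-refl) (fill-++ (pairB p) f)
      where
      balance : ∀ u n → (suc (u + u) + suc (u + u)) + n ≡ suc (suc ((u + u) + (u + u) + n))
      balance = ringℕ-∀
    ... | yes uA | yes uB = distinct-case (2 ≤? length A) (2 ≤? length B)
      where
      total : length A + length B ≡ suc ((u + u) + (u + u) + n)
      total = suc-injective (trans size (balance u n))
        where
        balance : ∀ u n → (suc (u + u) + suc (u + u)) + n ≡ suc (suc ((u + u) + (u + u) + n))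
        balance = ringℕ-∀
      large : n < length A + length B
      large = ≤-trans (s≤s (m≤n+m n _)) (≤-reflexive (sym total))
      -- The block f contains a reflection, so that the two copies of b may be paired arbitrarily.
      continue : ∀ {q A₁ B₁} → Fill 2 (suc q) A B A₁ B₁ →
                 ∃ λ q → ∃₂ λ A′ B′ → Fill (suc (suc (u + u))) (suc q) A (b ∷ b ∷ B) A′ B′
      continue {q} {A₁} {B₁} f =
        let q′ , A′ , B′ , g = blocks distinct f≡ u A₁ (b ∷ b ∷ B₁)
              (≤-from _ _ 0 (≤-reflexive (trans (sym total) (fill-length f))) (balance u n (length A₁) (length B₁)))
        in q + q′ , A′ , B′ , fill-++ (fill-extend [] (b ∷ b ∷ []) f) g
        where
        balance : ∀ u n a b → (u + u) + (u + u) + n + (4 + (a + b)) + 0 ≡ suc (a + suc (suc b)) + suc ((u + u) + (u + u) + n)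
        balance = ringℕ-∀
      distinct-case : Dec (2 ≤ length A) → Dec (2 ≤ length B) →
                      ∃ λ q → ∃₂ λ A′ B′ → Fill (suc (suc (u + u))) (suc q) A (b ∷ b ∷ B) A′ B′
      distinct-case (yes 2≤A) (yes 2≤B) = let A′ , B′ , f = mixedBlock uA uB large 2≤A 2≤B in continue f
      distinct-case (no 2≰A) _ = let B′ , p = quads distinct f≡ uB
                                       (≤-pred (≤-trans large (+-monoˡ-≤ (length B) (≤-pred (≰⇒> 2≰A)))))
                                 in continue (quadB p f≡)
      distinct-case (yes _) (no 2≰B) = small u refl
        where
        A≥ : (u + u) + (u + u) + n ≤ length A
        A≥ = ≤-pred (≤-trans (≤-reflexive (sym total)) (≤-trans (+-monoʳ-≤ (length A) (≤-pred (≰⇒> 2≰B))) (≤-reflexive (+-comm (length A) 1))))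
        -- At least `4u + n` distinct rotations force `u = 0`, and `A` is the whole group. The
        -- further pair is then `e, -e`.
        small : ∀ v → u ≡ v → ∃ λ q → ∃₂ λ A′ B′ → Fill (suc (suc (u + u))) (suc q) A (b ∷ b ∷ B) A′ B′
        small zero refl = let A′ , p = both-in uA A≥ e≢-e in 0 , A′ , B , fill-++ (pairB ↭-refl) (oppositeA p)
        small (suc v) refl = contradiction (≤-trans A≥ (Unique-bound uA))
          (<⇒≱ (+-monoˡ-≤ n (s≤s z≤n)))

  -- Three elements admit no quadruple of distinct terms. Its place is taken by
  -- `b + b = (b + e) + (b - e)`, in which the repeated reflection itself takes part.
  module Three (n≡3 : n ≡ 3) {e : G} (e≢-e : e ≢ ⊖ e) (b : G) where

    core : ∀ {A B} → Unique A → Unique B → length A + length B ≡ 4 →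
           ∃ λ q → ∃₂ λ A′ B′ → Fill 2 (suc q) A (b ∷ b ∷ B) A′ B′
    core {A} {B} uA uB size with 2 ≤? length A | 2 ≤? length B
    ... | yes 2≤A | yes 2≤B =
      let A′ , B′ , f = mixedBlock uA uB (≤-reflexive (trans (cong suc n≡3) (sym size))) 2≤A 2≤B
      in 0 , A′ , b ∷ b ∷ B′ , fill-extend [] (b ∷ b ∷ []) f
    ... | no 2≰A | _ =
      let B′ , p = both-in uB (≤-trans (≤-reflexive n≡3) (≤-pred (≤-trans (≤-reflexive (sym size)) (+-monoˡ-≤ (length B) (≤-pred (≰⇒> 2≰A))))))
                     {b ⊕ e} {b ⊟ e} (λ eq → e≢-e (⊕-cancelˡ b eq))
      in 1 , A , B′ , quadB (prep b (prep b p)) (solve (b ∷ e ∷ []) (var 0F :+ var 0F) ((var 0F :+ var 1F) :+ (var 0F :- var 1F)) refl)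
    ... | yes _ | no 2≰B =
      let A′ , p = both-in uA (≤-trans (≤-reflexive n≡3) (≤-pred (≤-trans (≤-reflexive (sym size)) (≤-trans (+-monoʳ-≤ (length A) (≤-pred (≰⇒> 2≰B)))
                     (≤-reflexive (+-comm (length A) 1)))))) {e} {⊖ e} e≢-e
      in 0 , A′ , B , fill-++ (pairB ↭-refl) (oppositeA p)

    repeated₃ : ∀ A B → length A + length B ≡ 6 → ∃ λ q → ∃₂ λ A′ B′ → Fill 3 (suc q) A (b ∷ b ∷ B) A′ B′
    repeated₃ A B size with two-repeats A | two-repeats B
    ... | inj₂ (inj₂ (x , y , zs , p)) | _ = 0 , zs , B , fill-++ (pairB ↭-refl) (fill-++ (pairA p) (pairA ↭-refl))
    ... | _ | inj₂ (inj₂ (x , y , zs , p)) = 2 , A , zs , fill-++ (pairB ↭-refl) (fill-++ (pairB p) (pairB ↭-refl))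
    ... | inj₁ (x , ys , p , _) | inj₁ (y , zs , p′ , _) = 1 , ys , zs , fill-++ (pairB ↭-refl) (fill-++ (pairA p) (pairB p′))
    ... | inj₂ (inj₁ uA) | inj₂ (inj₁ uB) =
      let A′ , B′ , f = mixedBlock uA uB (≤-trans (≤-reflexive (cong suc n≡3)) (≤-trans (s≤s (s≤s (s≤s (s≤s z≤n)))) (≤-reflexive (sym size))))
            (half (length A) (length B) size (≤-trans (Unique-bound uB) (≤-reflexive n≡3)))
            (half (length B) (length A) (trans (+-comm (length B) _) size) (≤-trans (Unique-bound uA) (≤-reflexive n≡3)))
      in 1 , A′ , B′ , fill-++ (pairB ↭-refl) f
      where
      half : ∀ a b → a + b ≡ 6 → b ≤ 3 → 2 ≤ a
      half a b eq b≤ = ≤-trans (s≤s (s≤s z≤n)) (+-cancelʳ-≤ 3 3 a (≤-trans (≤-reflexive (sym eq)) (+-monoʳ-≤ a b≤)))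
    ... | inj₁ (x , ys , p , uys) | inj₂ (inj₁ uB) =
      let q , A′ , B′ , f = core uys uB (suc-injective (suc-injective (trans (cong (_+ length B) (sym (↭-length p))) size)))
      in q , A′ , B′ , fill-++ (pairA p) f
    ... | inj₂ (inj₁ uA) | inj₁ (y , ys , p , uys) =
      let q , A′ , B′ , f = core uA uys (suc-injective (suc-injective
            (trans (sym (move (length A) (length ys))) (trans (cong (length A +_) (sym (↭-length p))) size))))
      in suc q , A′ , B′ , fill-++ (pairB (↭-trans (prep b (prep b p)) (shifts (b ∷ b ∷ []) (y ∷ y ∷ [])))) f

-- The inverse theorem for the dihedral group.

module Classification (n : ℕ) .{{_ : NonZero n}} (3≤n : 3 ≤ n) where

  open Dihedral n
  open Pairing _≟ᶠ_ (addF n) 𝟘 (negF n) isAbelianGroup n Unique-bound full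

  -- The index `suc q` provides reflections `b` and `b′` between which the negative rotations are
  -- placed. The other reflections are interleaved, so that their signs alternate as prescribed.
  fillP1 : ∀ {S A B A′ B′ k q L} → S ↭ map rot A ++ map ref B → k + k ≡ L → Fill k (suc q) A B A′ B′ → HasP1Sub n L S
  fillP1 {q = q} S↭ k+k (fill P N (b ∷ F⁺) (b′ ∷ F⁻) A↭ B↭ |F⁺| |F⁻| size sum) =
    signedP1 b b′ P N (interleave F⁺ F⁻) S↭ A↭
      (↭-trans B↭ (++⁺ʳ _ (prep b (↭-trans (shift b′ F⁺ F⁻) (prep b′ (↭-sym F↭))))))
      (trans (cong odd? |F|) (odd?-double q))
      (trans (cong (λ m → length (P ++ N) + suc (suc m)) |F|)
        (trans (cong (λ m → length (P ++ N) + suc m) (sym (+-suc _ _))) (trans size k+k)))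
      (trans (cong (λ f → Σ P ⊕ (b ⊟ (Σ N ⊕ (b′ ⊟ f)))) (alternate-interleave F⁺ F⁻ F⁺≡F⁻))
        (signed-identity {p = Σ P} {Σ N} {b} {b′} {Σ F⁺} {Σ F⁻} sum))
    where
    F⁺≡F⁻ = suc-injective (trans |F⁺| (sym |F⁻|))
    F↭ = interleave-↭ F⁺ F⁻ F⁺≡F⁻
    |F| = trans (↭-length F↭) (trans (length-++ F⁺) (cong₂ _+_ (suc-injective |F⁺|) (suc-injective |F⁻|)))

  mod-injective : ∀ {i j} → i < n → j < n → i mod n ≡ j mod n → i ≡ j
  mod-injective {i} {j} i<n j<n e = trans (sym (m<n⇒m%n≡m i<n)) (trans (sym (toℕ-mod i))
    (trans (cong toℕ e) (trans (toℕ-mod j) (m<n⇒m%n≡m j<n))))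

  1≢-1 : 1 mod n ≢ ⊖ (1 mod n)
  1≢-1 e = 1+n≰n (≤-trans 3≤n (∣⇒≤ (mod≡𝟘⇒∣ {2} (trans (sym (addF-mod 1 1))
    (trans (cong (1 mod n ⊕_) e) (addF-inverseʳ (1 mod n)))))))

  0+3≡1+2 : 0 mod n ⊕ 3 mod n ≡ 1 mod n ⊕ 2 mod n
  0+3≡1+2 = trans (addF-mod 0 3) (sym (addF-mod 1 2))

  0123-distinct : 4 ≤ n → Unique (0 mod n ∷ 1 mod n ∷ 2 mod n ∷ 3 mod n ∷ [])
  0123-distinct 4≤n = (≢′ 0 1 (s≤s z≤n) (s≤s (s≤s z≤n)) (λ ()) ∷ ≢′ 0 2 (s≤s z≤n) (s≤s (s≤s (s≤s z≤n))) (λ ()) ∷ ≢′ 0 3 (s≤s z≤n) ≤-refl (λ ()) ∷ []) ∷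
    (≢′ 1 2 (s≤s (s≤s z≤n)) (s≤s (s≤s (s≤s z≤n))) (λ ()) ∷ ≢′ 1 3 (s≤s (s≤s z≤n)) ≤-refl (λ ()) ∷ []) ∷
    (≢′ 2 3 (s≤s (s≤s (s≤s z≤n))) ≤-refl (λ ()) ∷ []) ∷ [] ∷ []
    where
    ≢′ : ∀ i j → suc i ≤ 4 → suc j ≤ 4 → i ≢ j → i mod n ≢ j mod n
    ≢′ i j i< j< i≢j e = i≢j (mod-injective (≤-trans i< 4≤n) (≤-trans j< 4≤n) e)

  -- The field `multiple≢𝟘` stands for the coprimality condition of the theorem: the difference `x`
  -- of the two rotation exponents has order `n`.
  record Standard (L : ℕ) (S : List (D n)) : Set where
    field
      c x b      : G
      l m        : ℕ
      suc-l      : suc l ≡ L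
      suc-m      : suc m ≡ n
      shape      : S ↭ replicate l (rot c) ++ replicate m (rot (c ⊕ x)) ++ [ ref b ]
      multiple≢𝟘 : ∀ j → 1 ≤ j → j < n → j · x ≢ 𝟘

  Exceptional : ℕ → List (D n) → Set
  Exceptional L S = n ≡ 3 × L ≡ 6 × S ↭ replicate 5 (rot 𝟘) ++ map ref (0 mod n ∷ 1 mod n ∷ 2 mod n ∷ [])

  -- `L` is even in both parts of the theorem, being an even `n` or `2n`; the pairing argument
  -- depends on this.
  module Inverse (L t : ℕ) (n≤L : n ≤ L) (n∣L : n ∣ L) (L≤2n : L ≤ n + n) (L≡ : suc t + suc t ≡ L)
    (cases : 4 ≤ n ⊎ (n ≡ 3 × L ≡ 6)) where

    module _ (S : List (D n)) (|S| : suc (length S) ≡ L + n) (¬P1 : ¬ HasP1Sub n L S) where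

      A B : List G
      A = rots S
      B = refs S

      |A|+|B| : suc (length A + length B) ≡ L + n
      |A|+|B| = trans (cong suc (sym (length-split S))) |S|

      repeat-impossible : ∀ b B₁ → B ↭ b ∷ b ∷ B₁ → 4 ≤ n ⊎ (n ≡ 3 × L ≡ 6) → ⊥
      repeat-impossible b B₁ p (inj₁ 4≤n) =
        let q , A′ , B′ , f = repeated (0123-distinct 4≤n) 0+3≡1+2 1≢-1 t A b B₁ (suc-injective (suc-injective
              (trans (regroup (length A) (length B₁)) (trans (cong (λ m → suc (length A + m)) (sym (↭-length p)))
                (trans |A|+|B| (trans (cong (_+ n) (sym L≡)) (double t n)))))))
        in ¬P1 (fillP1 (split-↭ S) L≡ (fill-↭ ↭-refl p f))
        where
        regroup : ∀ a b → suc (suc (suc (a + b))) ≡ suc (a + suc (suc b))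
        regroup = ringℕ-∀
        double : ∀ t n → suc t + suc t + n ≡ suc (suc (t + t + n))
        double = ringℕ-∀
      repeat-impossible b B₁ p (inj₂ (n≡3 , L≡6)) =
        let q , A′ , B′ , f = Three.repeated₃ n≡3 1≢-1 b A B₁ (suc-injective (suc-injective (suc-injective
              (trans (regroup (length A) (length B₁)) (trans (cong (λ m → suc (length A + m)) (sym (↭-length p)))
                (trans |A|+|B| (cong₂ _+_ L≡6 n≡3)))))))
        in ¬P1 (fillP1 (split-↭ S) (sym L≡6) (fill-↭ ↭-refl p f))
        where
        regroup : ∀ a b → suc (suc (suc (a + b))) ≡ suc (a + suc (suc b))
        regroup = ringℕ-∀

      no-plain : ∀ A₁ A₂ F B₂ → A ↭ A₁ ++ A₂ → B ↭ F ++ B₂ → odd? (length F) ≡ false →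
        length A₁ + length F ≡ L → Σ A₁ ⊕ alternate F ≢ 𝟘
      no-plain A₁ A₂ F B₂ p q even size sum = ¬P1 (plainP1 {A₂ = A₂} {B₂ = B₂} A₁ F (split-↭ S) p q even size sum)

      no-signed : ∀ b b′ P N A₂ B₂ → A ↭ (P ++ N) ++ A₂ → B ↭ b ∷ b′ ∷ B₂ →
        length (P ++ N) + 2 ≡ L → Σ P ⊕ (b ⊟ (Σ N ⊕ (b′ ⊟ 𝟘))) ≢ 𝟘
      no-signed b b′ P N A₂ B₂ p q size sum = ¬P1 (signedP1 {A₂ = A₂} b b′ P N [] (split-↭ S) p {B₂} q refl size sum)

      open Extremal _≟ᶠ_ (addF n) 𝟘 (negF n) isAbelianGroup n n·≡𝟘 Unique-bound involution-unique
        using (module TwoValues; TwoValues; module Degenerate; Degenerate; extremal)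

      standard : length B ≡ 1 → TwoValues A B L n≤L n∣L |A|+|B| no-plain no-signed → Standard L S
      standard |B| tv = one-ref B refl |B|
        where
        open TwoValues tv
        one-ref : ∀ B₁ → B ≡ B₁ → length B₁ ≡ 1 → Standard L S
        one-ref (b ∷ []) B≡ _ = record
          { c = c ; x = x ; b = b ; l = h ; m = m ; suc-l = suc-h ; suc-m = suc-m
          ; shape = ↭-trans (split-↭ S) (↭-trans (++⁺ (map⁺ rot shape) (↭-reflexive (cong (map ref) B≡)))
              (↭-trans (↭-reflexive (cong (_++ [ ref b ]) (trans (map-++ rot (replicate h c) _)
                (cong₂ _++_ (map-replicate rot h c) (map-replicate rot m (c ⊕ x))))))
              (++-assoc (replicate h (rot c)) _ _)))
          ; multiple≢𝟘 = multiple≢𝟘 }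

      -- For `n ≥ 4` the reflections satisfy `0 - 1 + 3 - 2 = 0`, and `(L - 4) · c = 0` because
      -- `2c = 0`, so these four and `L - 4` copies of `c` have product one. For `n = 3` the
      -- equation `2c = 0` forces `c = 0`, and the exceptional sequence remains.
      degenerate : Unique B → Degenerate A B L n≤L n∣L |A|+|B| no-plain no-signed → 4 ≤ n ⊎ (n ≡ 3 × L ≡ 6) → Exceptional L S
      degenerate uB dg (inj₁ 4≤n) = ⊥-elim (contra (quads (0123-distinct 4≤n) 0+3≡1+2 uB (≤-reflexive (sym r≡n)))
          (m≤n⇒∃[o]m+o≡n (≤-trans 4≤n n≤L)))
        where
        open Degenerate dg
        contra : (∃ λ B₁ → B ↭ 0 mod n ∷ 3 mod n ∷ 1 mod n ∷ 2 mod n ∷ B₁) → (∃ λ o → 4 + o ≡ L) → ⊥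
        contra (B₁ , p) (o , 4+o) = no-plain (replicate o c) (replicate 3 c) (0 mod n ∷ 1 mod n ∷ 3 mod n ∷ 2 mod n ∷ []) B₁
          (↭-trans shape (↭-reflexive (trans (cong (λ k → replicate k c) (trans (suc-injective (trans suc-h (sym 4+o))) (+-comm 3 o))) (replicate-+ o 3 c))))
          (↭-trans p (prep _ (swap _ _ ↭-refl))) refl
          (trans (cong (_+ 4) (length-replicate o)) (trans (+-comm o 4) 4+o))
          (trans (cong (_⊕ alternate (0 mod n ∷ 1 mod n ∷ 3 mod n ∷ 2 mod n ∷ [])) (Σ-replicate o c))
            (degenerate-identity {l = o · c} {c} {0 mod n} {1 mod n} {2 mod n} {3 mod n} 2c≡𝟘
              (trans (cong (_· c) 4+o) (∣⇒·≡𝟘 n∣L c)) 0+3≡1+2))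
      degenerate uB dg (inj₂ (n≡3 , L≡6)) = n≡3 , L≡6 ,
        ↭-trans (split-↭ S) (++⁺ (↭-trans (map⁺ rot shape) (↭-reflexive (trans (map-replicate rot h c)
          (cong₂ replicate (suc-injective (trans suc-h L≡6)) (cong rot c≡𝟘))))) (map⁺ ref B↭))
        where
        open Degenerate dg
        c≡𝟘 : c ≡ 𝟘
        c≡𝟘 with c ≟ᶠ 𝟘
        ... | yes e = e
        ... | no c≢𝟘 = ⊥-elim (odd3 (toℕ c) (trans (double≡n 2c≡𝟘 c≢𝟘) n≡3))
          where
          odd3 : ∀ k → k + k ≢ 3
          odd3 k eq with () ← trans (sym (odd?-double k)) (cong odd? eq)
        all = full uB (≤-reflexive (sym r≡n))
        B↭ : B ↭ 0 mod n ∷ 1 mod n ∷ 2 mod n ∷ []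
        B↭ = exhaust₃ (∈∈⇒↭ (all (0 mod n)) (all (1 mod n)) (λ e → 0≢1+n (mod-injective (≤-trans (s≤s z≤n) 3≤n) (≤-trans (s≤s (s≤s z≤n)) 3≤n) e)))
          where
          exhaust₃ : (∃ λ B₁ → B ↭ 0 mod n ∷ 1 mod n ∷ B₁) → B ↭ 0 mod n ∷ 1 mod n ∷ 2 mod n ∷ []
          exhaust₃ (B₁ , p) = third (∈-resp-↭ p (all (2 mod n))) (suc-injective (suc-injective (trans (sym (↭-length p)) (trans r≡n n≡3))))
            where
            third : 2 mod n ∈ 0 mod n ∷ 1 mod n ∷ B₁ → length B₁ ≡ 1 → B ↭ 0 mod n ∷ 1 mod n ∷ 2 mod n ∷ []
            third (here e) _ = ⊥-elim (0≢1+n (sym (mod-injective 3≤n (≤-trans (s≤s z≤n) 3≤n) e)))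
            third (there (here e)) _ = ⊥-elim (0≢1+n (sym (suc-injective (mod-injective 3≤n (≤-trans (s≤s (s≤s z≤n)) 3≤n) e))))
            third (there (there 2∈)) |B₁| = ↭-trans p (prep _ (prep _ (singleton B₁ |B₁| 2∈)))
              where
              singleton : ∀ X → length X ≡ 1 → 2 mod n ∈ X → X ↭ [ 2 mod n ]
              singleton (x ∷ []) _ (here e) = ↭-reflexive (cong [_] (sym e))

      inverse : Standard L S ⊎ Exceptional L S
      inverse with unique? B
      ... | no ¬uB = let b , B₁ , p = ¬Unique⇒repeat B ¬uB in ⊥-elim (repeat-impossible b B₁ p cases)
      ... | yes uB with extremal A B L n≤L n∣L |A|+|B| no-plain no-signed (≤-trans (n≤1+n 2) 3≤n) L≤2n uB
      ... | inj₁ (|B| , tv) = inj₁ (standard |B| tv)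
      ... | inj₂ dg = inj₂ (degenerate uB dg cases)

-- The converse direction, and dihedral presentations in coordinates.

module _ {A : Set} where

  ∈-replicate : ∀ k {x y : A} → y ∈ replicate k x → y ≡ x
  ∈-replicate (suc k) (here e) = e
  ∈-replicate (suc k) (there y∈) = ∈-replicate k y∈

module TwoValued {G : Set} (_≟_ : DecidableEquality G)
  (_∙_ : G → G → G) (𝟘 : G) (_⁻¹ : G → G) (isAbelianGroup : IsAbelianGroup _≡_ _∙_ 𝟘 _⁻¹)
  (c x : G) (c≢y : c ≢ c ∙ x) where

  open AbelianSums _∙_ 𝟘 _⁻¹ isAbelianGroup
  open Counting _≟_

  Σ-two-valued : ∀ W → (∀ {w} → w ∈ W → w ≡ c ⊎ w ≡ c ⊕ x) →
    Σ W ≡ length W · c ⊕ count (c ⊕ x) W · x × length W ≡ count c W + count (c ⊕ x) W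
  Σ-two-valued [] _ = sym (⊕-identityˡ 𝟘) , refl
  Σ-two-valued (w ∷ W) two with Σ-two-valued W (two ∘ there) | c ≟ w | (c ⊕ x) ≟ w | two (here refl)
  ... | e , l | yes refl | no _ | _ = trans (cong (c ⊕_) e)
        (solve (c ∷ length W · c ∷ count (c ⊕ x) W · x ∷ []) (var 0F :+ (var 1F :+ var 2F)) ((var 0F :+ var 1F) :+ var 2F) refl) ,
        cong suc l
  ... | e , l | no _ | yes refl | _ = trans (cong ((c ⊕ x) ⊕_) e)
        (solve (c ∷ x ∷ length W · c ∷ count (c ⊕ x) W · x ∷ []) ((var 0F :+ var 1F) :+ (var 2F :+ var 3F))
          ((var 0F :+ var 2F) :+ (var 1F :+ var 3F)) refl) ,
        trans (cong suc l) (sym (+-suc _ _))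
  ... | _ | yes e | yes e′ | _ = contradiction (trans e (sym e′)) c≢y
  ... | _ | no c≢w | _ | inj₁ e = contradiction (sym e) c≢w
  ... | _ | _ | no y≢w | inj₂ e = contradiction (sym e) y≢w

  -- `W` has more terms than there are copies of `c`, so it contains `c + x` between `1` and `n - 1`
  -- times; its sum is that multiple of `x`.
  two-valued-nonzero : ∀ {l m n} W V → replicate l c ++ replicate m (c ⊕ x) ↭ W ++ V → length W ≡ suc l → suc l · c ≡ 𝟘 →
    suc m ≡ n → (∀ j → 1 ≤ j → j < n → j · x ≢ 𝟘) → Σ W ≢ 𝟘
  two-valued-nonzero {l} {m} W V p |W| L·c suc-m ≢0 ΣW =
    let e , count-W = Σ-two-valued W two
    in ≢0 (count y W) (1≤count count-W) (≤-trans (s≤s count-y) (≤-reflexive suc-m))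
      (≡-diff (cong₂ _⊟_ (trans (sym e) ΣW) (trans (cong (_· c) |W|) L·c))
        (solve (length W · c ∷ count y W · x ∷ []) (var 1F :- :0) (((var 0F :+ var 1F) :- var 0F) :- (:0 :- :0)) refl))
    where
    y = c ⊕ x
    two : ∀ {w} → w ∈ W → w ≡ c ⊎ w ≡ y
    two w∈ with ∈-++⁻ (replicate l c) (∈-resp-↭ (↭-sym p) (∈-++⁺ˡ w∈))
    ... | inj₁ w∈c = inj₁ (∈-replicate l w∈c)
    ... | inj₂ w∈y = inj₂ (∈-replicate m w∈y)
    count-≤ : ∀ z → count z W ≤ count z (replicate l c) + count z (replicate m y)
    count-≤ z = ≤-trans (m≤m+n (count z W) (count z V))
      (≤-reflexive (trans (sym (count-++ z W V)) (trans (sym (count-↭ z p)) (count-++ z (replicate l c) _))))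
    count-y : count y W ≤ m
    count-y = ≤-trans (count-≤ y) (≤-reflexive (cong₂ _+_ (count-∉ (λ y∈ → c≢y (sym (∈-replicate l y∈)))) (count-replicate y m)))
    count-c : count c W ≤ l
    count-c = ≤-trans (count-≤ c) (≤-reflexive (trans (cong₂ _+_ (count-replicate c l) (count-∉ (λ c∈ → c≢y (∈-replicate m c∈)))) (+-identityʳ l)))
    1≤count : length W ≡ count c W + count y W → 1 ≤ count y W
    1≤count eq = +-cancelˡ-≤ l 1 (count y W) (≤-trans (≤-reflexive (trans (+-comm l 1) (trans (sym |W|) eq))) (+-monoˡ-≤ (count y W) count-c))

module Converse (n : ℕ) .{{_ : NonZero n}} (3≤n : 3 ≤ n) where

  open Classification n 3≤n
  open Dihedral n

  rots-map : ∀ A B → rots (map rot A ++ map ref B) ≡ A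
  rots-map [] [] = refl
  rots-map [] (b ∷ B) = rots-map [] B
  rots-map (a ∷ A) B = cong (a ∷_) (rots-map A B)

  refs-map : ∀ A B → refs (map rot A ++ map ref B) ≡ B
  refs-map [] [] = refl
  refs-map [] (b ∷ B) = cong (b ∷_) (refs-map [] B)
  refs-map (a ∷ A) B = refs-map A B

  module _ {L S} (st : Standard L S) where

    open Standard st

    as-map : S ↭ map rot (replicate l c ++ replicate m (c ⊕ x)) ++ map ref [ b ]
    as-map = ↭-trans shape (↭-trans (↭-sym (++-assoc (replicate l (rot c)) _ _)) (↭-reflexive (cong (_++ [ ref b ])
      (sym (trans (map-++ rot (replicate l c) _) (cong₂ _++_ (map-replicate rot l c) (map-replicate rot m (c ⊕ x))))))))

    standard-rots : rots S ↭ replicate l c ++ replicate m (c ⊕ x)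
    standard-rots = ↭-trans (rots-↭ as-map) (↭-reflexive (rots-map (replicate l c ++ replicate m (c ⊕ x)) [ b ]))

    standard-refs : refs S ↭ [ b ]
    standard-refs = ↭-trans (refs-↭ as-map) (↭-reflexive (refs-map (replicate l c ++ replicate m (c ⊕ x)) [ b ]))

    -- A product-one sequence has an even number of reflections, so the only reflection cannot
    -- occur.
    standard-¬P1 : n ∣ L → ¬ HasP1Sub n L S
    standard-¬P1 n∣L (T , U , p , |T| , T′ , q , e) = no-refs (refs T′) refl
      where
      S↭ : S ↭ T′ ++ U
      S↭ = ↭-trans p (++⁺ʳ U q)
      parity : odd? (length (refs T′)) ≡ false
      parity = trans (sym (prod-parity T′)) (cong proj₂ e)
      |refs| : length (refs T′) + length (refs U) ≡ 1
      |refs| = trans (sym (trans (↭-length (refs-↭ S↭)) (trans (cong length (refs-++ T′ U)) (length-++ (refs T′))))) (↭-length standard-refs)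
      no-refs : ∀ F → refs T′ ≡ F → ⊥
      no-refs [] F≡ = two-valued-nonzero (rots T′) (rots U)
        (↭-trans (↭-sym standard-rots) (↭-trans (rots-↭ S↭) (↭-reflexive (rots-++ T′ U))))
        (trans (sym (trans (length-split T′) (trans (cong (λ F → length (rots T′) + length F) F≡) (+-identityʳ _))))
          (trans (sym (↭-length q)) (trans |T| (sym suc-l))))
        (trans (cong (_· c) suc-l) (∣⇒·≡𝟘 n∣L c)) suc-m multiple≢𝟘
        (cong proj₁ (trans (sym (prod-no-refs T′ F≡)) e))
        where
        open TwoValued _≟ᶠ_ (addF n) 𝟘 (negF n) isAbelianGroup c x
          (λ c≡y → multiple≢𝟘 1 ≤-refl (≤-trans (s≤s (s≤s z≤n)) 3≤n) (≡-diff (sym c≡y)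
            (solve (c ∷ x ∷ []) ((var 1F :+ :0) :- :0) ((var 0F :+ var 1F) :- var 0F) refl)))
      no-refs (_ ∷ []) F≡ with () ← trans (sym (cong (odd? ∘ length) F≡)) parity
      no-refs (_ ∷ _ ∷ _) F≡ with () ← suc-injective (trans (sym (cong (λ F → length F + length (refs U)) F≡)) |refs|)

  prod-zero-rots : ∀ T → (∀ {a} → a ∈ rots T → a ≡ 𝟘) → proj₁ (prod n T) ≡ alternate (refs T)
  prod-zero-rots [] _ = refl
  prod-zero-rots ((i , false) ∷ T) ≡0 = trans (cong₂ _⊕_ (≡0 (here refl)) (prod-zero-rots T (≡0 ∘ there))) (⊕-identityˡ _)
  prod-zero-rots ((i , true) ∷ T) ≡0 = cong (i ⊟_) (prod-zero-rots T ≡0)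

  module _ {S B} (S↭ : S ↭ map rot (replicate 5 𝟘) ++ map ref B) where

    exceptional-rots : rots S ↭ replicate 5 𝟘
    exceptional-rots = ↭-trans (rots-↭ S↭) (↭-reflexive (rots-map (replicate 5 𝟘) B))

    exceptional-refs : refs S ↭ B
    exceptional-refs = ↭-trans (refs-↭ S↭) (↭-reflexive (refs-map (replicate 5 𝟘) B))

    -- Five rotations are too few, so parity leaves exactly two reflections. As all rotations are
    -- trivial, these two would have to be equal.
    exceptional-¬P1 : Unique B → length B ≡ 3 → ¬ HasP1Sub n 6 S
    exceptional-¬P1 uB |B| (T , U , p , |T| , T′ , q , e) = two-refs (refs T′) refl
      where
      S↭′ : S ↭ T′ ++ U
      S↭′ = ↭-trans p (++⁺ʳ U q)
      refs↭ : B ↭ refs T′ ++ refs U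
      refs↭ = ↭-trans (↭-sym exceptional-refs) (↭-trans (refs-↭ S↭′) (↭-reflexive (refs-++ T′ U)))
      rots↭ : replicate 5 𝟘 ↭ rots T′ ++ rots U
      rots↭ = ↭-trans (↭-sym exceptional-rots) (↭-trans (rots-↭ S↭′) (↭-reflexive (rots-++ T′ U)))
      zero-rots : ∀ {a} → a ∈ rots T′ → a ≡ 𝟘
      zero-rots a∈ = ∈-replicate 5 (∈-resp-↭ (↭-sym rots↭) (∈-++⁺ˡ a∈))
      few-rots : length (rots T′) ≤ 5
      few-rots = ≤-trans (m≤m+n _ (length (rots U))) (≤-reflexive (sym (trans (↭-length rots↭) (length-++ (rots T′)))))
      few-refs : length (refs T′) ≤ 3
      few-refs = ≤-trans (m≤m+n _ (length (refs U))) (≤-reflexive (trans (sym (trans (↭-length refs↭) (length-++ (refs T′)))) |B|))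
      parity : odd? (length (refs T′)) ≡ false
      parity = trans (sym (prod-parity T′)) (cong proj₂ e)
      size : length (rots T′) + length (refs T′) ≡ 6
      size = trans (sym (length-split T′)) (trans (sym (↭-length q)) |T|)
      two-refs : ∀ F → refs T′ ≡ F → ⊥
      two-refs [] F≡ = <-irrefl refl (≤-trans (≤-reflexive (sym (trans (sym (trans (cong (λ F → length (rots T′) + length F) F≡) (+-identityʳ _))) size))) few-rots)
      two-refs (_ ∷ []) F≡ with () ← trans (sym (cong (odd? ∘ length) F≡)) parity
      two-refs (i ∷ j ∷ []) F≡ = Uniqueₚ.Unique[x∷xs]⇒x∉xs
        (Unique-++ˡ (i ∷ j ∷ []) (subst (λ F → Unique (F ++ refs U)) F≡ (Unique-↭ refs↭ uB)))
        (here (≡-diff (trans (sym (trans (prod-zero-rots T′ zero-rots) (cong alternate F≡))) (cong proj₁ e))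
          (solve (i ∷ j ∷ []) (var 0F :- var 1F) ((var 0F :- (var 1F :- :0)) :- :0) refl)))
      two-refs (_ ∷ _ ∷ _ ∷ []) F≡ with () ← trans (sym (cong (odd? ∘ length) F≡)) parity
      two-refs (_ ∷ _ ∷ _ ∷ _ ∷ F) F≡ = <⇒≱ (s≤s (s≤s (s≤s (s≤s z≤n)))) (≤-trans (≤-reflexive (sym (cong length F≡))) few-refs)

  ρ σ : D n
  ρ = rot (1 mod n)
  σ = ref 𝟘

  pow-rot : ∀ a k → pow n (rot a) k ≡ rot (k · a)
  pow-rot a zero = refl
  pow-rot a (suc k) = cong (mul n (rot a)) (pow-rot a k)

  ·-mod-n : ∀ k x → (k % n) · x ≡ k · x
  ·-mod-n k x = begin
    (k % n) · x                       ≡⟨ sym (⊕-identityʳ _) ⟩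
    (k % n) · x ⊕ 𝟘                   ≡⟨ cong ((k % n) · x ⊕_) (sym (∣⇒·≡𝟘 (n∣m*n (k / n)) x)) ⟩
    (k % n) · x ⊕ (k / n * n) · x     ≡⟨ sym (×-homo-+ x (k % n) (k / n * n)) ⟩
    (k % n + k / n * n) · x           ≡⟨ cong (_· x) (sym (m≡m%n+[m/n]*n k n)) ⟩
    k · x                             ∎
    where open ≡-Reasoning

  ·-1 : ∀ k → k · (1 mod n) ≡ k mod n
  ·-1 k = trans (·-mod k (1 mod n)) (cong (_mod n) (trans (cong (k *_) (trans (toℕ-mod 1) (m<n⇒m%n≡m (≤-trans (s≤s (s≤s z≤n)) 3≤n)))) (*-identityʳ k)))

  pow-ρ : ∀ i → pow n ρ (toℕ i) ≡ rot i
  pow-ρ i = trans (pow-rot (1 mod n) (toℕ i)) (cong rot (trans (·-1 (toℕ i)) (mod-toℕ i)))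

  normalForm-ρσ : ∀ x → normalForm n ρ σ x ≡ x
  normalForm-ρσ (i , false) = pow-ρ i
  normalForm-ρσ (i , true) = trans (cong (λ g → mul n g σ) (pow-ρ i)) (cong ref (⊕-identityʳ i))

  presentation : Presentation n ρ σ
  presentation = trans (pow-rot (1 mod n) n) (cong rot (n·≡𝟘 (1 mod n))) ,
    cong rot (solve [] (:0 :- :0) :0 refl) ,
    cong ref (solve (1 mod n ∷ []) (:0 :- var 0F) ((:- var 0F) :+ :0) refl) ,
    (λ x y e → trans (sym (normalForm-ρσ x)) (trans e (normalForm-ρσ y))) ,
    λ g → g , normalForm-ρσ g

  module FromPresentation {α τ : D n} (pres : Presentation n α τ) where

    private
      injective = proj₁ (proj₂ (proj₂ (proj₂ pres)))
      surjective = proj₂ (proj₂ (proj₂ (proj₂ pres)))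

    -- A reflection has square one, which would identify the normal forms with exponents `2` and
    -- `0`.
    α-rot : ∃ λ a → α ≡ rot a
    α-rot = go α refl
      where
      go : ∀ g → α ≡ g → ∃ λ a → α ≡ rot a
      go (a , false) e = a , e
      go (a , true) e = contradiction
        (mod-injective (≤-trans (s≤s (s≤s (s≤s z≤n))) 3≤n) (≤-trans (s≤s z≤n) 3≤n) (cong proj₁ (injective (2 mod n , false) (0 mod n , false) same))) λ ()
        where
        two : toℕ (2 mod n) ≡ 2
        two = trans (toℕ-mod 2) (m<n⇒m%n≡m 3≤n)
        zero′ : toℕ (0 mod n) ≡ 0
        zero′ = trans (toℕ-mod 0) (m<n⇒m%n≡m (≤-trans (s≤s z≤n) 3≤n))
        same : pow n α (toℕ (2 mod n)) ≡ pow n α (toℕ (0 mod n))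
        same = trans (cong (pow n α) two) (trans (cong (λ g → pow n g 2) e)
          (trans (cong rot (solve (a ∷ []) (var 0F :- (var 0F :- :0)) :0 refl)) (cong (pow n α) (sym zero′))))

    a : G
    a = proj₁ α-rot

    pow-α : ∀ k → pow n α k ≡ rot (k · a)
    pow-α k = trans (cong (λ g → pow n g k) (proj₂ α-rot)) (pow-rot a k)

    -- If `τ` were a rotation as well, every normal form would be a rotation and no reflection would
    -- be reached.
    τ-ref : ∃ λ t → τ ≡ ref t
    τ-ref = go τ refl
      where
      rotation : ∀ {b} x → τ ≡ rot b → proj₂ (normalForm n α τ x) ≡ false
      rotation (i , false) e = cong proj₂ (pow-α (toℕ i))
      rotation (i , true) e = cong proj₂ (cong₂ (mul n) (pow-α (toℕ i)) e)
      go : ∀ g → τ ≡ g → ∃ λ t → τ ≡ ref t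
      go (t , true) e = t , e
      go (t , false) e = let x , nf = surjective (ref 𝟘) in
        contradiction (trans (sym (rotation x e)) (cong proj₂ nf)) λ ()

    t : G
    t = proj₁ τ-ref

    order-a : ∀ k → k · a ≡ 𝟘 → n ∣ k
    order-a k e = mod≡𝟘⇒∣ (cong proj₁ (injective (k mod n , false) (0 mod n , false)
      (trans (pow-α (toℕ (k mod n))) (trans (cong rot (begin
        toℕ (k mod n) · a  ≡⟨ cong (_· a) (toℕ-mod k) ⟩
        (k % n) · a        ≡⟨ ·-mod-n k a ⟩
        k · a              ≡⟨ e ⟩
        0 · a              ≡⟨ sym (·-mod-n 0 a) ⟩
        (0 % n) · a        ≡⟨ cong (_· a) (sym (toℕ-mod 0)) ⟩
        toℕ (0 mod n) · a  ∎)) (sym (pow-α (toℕ (0 mod n))))))))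
      where open ≡-Reasoning

    mul-τ : ∀ k → mul n (pow n α k) τ ≡ ref (k · a ⊕ t)
    mul-τ k = cong₂ (mul n) (pow-α k) (proj₂ τ-ref)

    order-difference : ∀ k l → k · a ≡ l · a → n ∣ ∣ k - l ∣
    order-difference k l e with ≤-total k l
    ... | inj₁ k≤l = subst (n ∣_) (sym (m≤n⇒∣m-n∣≡n∸m k≤l)) (order-a (l ∸ k) (⊕-cancelˡ (k · a)
            (trans (sym (×-homo-+ a k (l ∸ k))) (trans (cong (_· a) (m+[n∸m]≡n k≤l)) (trans (sym e) (sym (⊕-identityʳ _)))))))
    ... | inj₂ l≤k = subst (n ∣_) (sym (m≤n⇒∣n-m∣≡n∸m l≤k)) (order-a (k ∸ l) (⊕-cancelˡ (l · a)
            (trans (sym (×-homo-+ a l (k ∸ l))) (trans (cong (_· a) (m+[n∸m]≡n l≤k)) (trans e (sym (⊕-identityʳ _)))))))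

-- Orders of elements and the exponent for even `n`.

module Exponent (n : ℕ) .{{_ : NonZero n}} (3≤n : 3 ≤ n) (2∣n : 2 ∣ n) where

  open Dihedral n
  open Classification n 3≤n using (mod-injective)
  open Converse n 3≤n using (pow-rot; ·-1; ρ)

  -- The known exponent `m` inside the search range guarantees that the search never falls back on
  -- its default value `0`.
  ordSearch-least : ∀ g k fuel m → k ≤ m → m < k + fuel → pow n g m ≡ one n →
    pow n g (ordSearch n g k fuel) ≡ one n × k ≤ ordSearch n g k fuel ×
    (∀ j → k ≤ j → j < ordSearch n g k fuel → pow n g j ≢ one n)
  ordSearch-least g k zero m k≤m m< _ = contradiction (≤-trans m< (≤-reflexive (+-identityʳ k))) (≤⇒≯ k≤m)
  ordSearch-least g k (suc fuel) m k≤m m< gᵐ with ≡-dec _≟ᶠ_ _≟ᵇ_ (pow n g k) (one n)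
  ... | yes gᵏ = gᵏ , ≤-refl , λ j k≤j j<k _ → <⇒≱ j<k k≤j
  ... | no ¬gᵏ =
    let k<m = ≤∧≢⇒< k≤m (λ { refl → ¬gᵏ gᵐ })
        e , k< , least = ordSearch-least g (suc k) fuel m k<m (≤-trans m< (≤-reflexive (+-suc k fuel))) gᵐ
    in e , <⇒≤ k< , λ j k≤j j< gʲ → [ (λ k<j → least j k<j j< gʲ) , (λ { refl → ¬gᵏ gʲ }) ]′ (m≤n⇒m<n∨m≡n k≤j)

  rot≡one : ∀ {a} → rot a ≡ one n → a ≡ 𝟘
  rot≡one e = cong proj₁ e

  ord-rot : ∀ a → ord n (rot a) · a ≡ 𝟘 × 1 ≤ ord n (rot a) × (∀ j → 1 ≤ j → j < ord n (rot a) → j · a ≢ 𝟘)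
  ord-rot a =
    let e , 1≤ , least = ordSearch-least (rot a) 1 (n + n) n (≤-trans (s≤s z≤n) 3≤n) (s≤s (m≤m+n n n))
          (trans (pow-rot a n) (cong rot (n·≡𝟘 a)))
    in rot≡one (trans (sym (pow-rot a _)) e) , 1≤ , λ j 1≤j j< ja → least j 1≤j j< (trans (pow-rot a j) (cong rot ja))

  ord-rot∣n : ∀ a → ord n (rot a) ∣ n
  ord-rot∣n a = go (ord n (rot a)) (ord-rot a)
    where
    go : ∀ o → o · a ≡ 𝟘 × 1 ≤ o × (∀ j → 1 ≤ j → j < o → j · a ≢ 𝟘) → o ∣ n
    go (suc o) (oa , _ , least) = m%n≡0⇒n∣m n (suc o) (remainder (n % suc o) (m%n<n n (suc o)) (begin
      (n % suc o) · a                                    ≡⟨ sym (⊕-identityʳ _) ⟩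
      (n % suc o) · a ⊕ 𝟘                                ≡⟨ cong ((n % suc o) · a ⊕_) (sym (trans (cong ((n / suc o) ·_) oa) (·-𝟘 (n / suc o)))) ⟩
      (n % suc o) · a ⊕ (n / suc o) · (suc o · a)        ≡⟨ cong ((n % suc o) · a ⊕_) (×-assocˡ a (n / suc o) (suc o)) ⟩
      (n % suc o) · a ⊕ (n / suc o * suc o) · a          ≡⟨ sym (×-homo-+ a (n % suc o) (n / suc o * suc o)) ⟩
      (n % suc o + n / suc o * suc o) · a                ≡⟨ cong (_· a) (sym (m≡m%n+[m/n]*n n (suc o))) ⟩
      n · a                                              ≡⟨ n·≡𝟘 a ⟩
      𝟘                                                  ∎))
      where
      open ≡-Reasoning
      remainder : ∀ r → r < suc o → r · a ≡ 𝟘 → r ≡ 0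
      remainder zero _ _ = refl
      remainder (suc r) r< ra = contradiction ra (least (suc r) (s≤s z≤n) r<)

  ord-ref : ∀ b → ord n (ref b) ≡ 2
  ord-ref b = go (ord n (ref b)) (ordSearch-least (ref b) 1 (n + n) 2 (s≤s z≤n) (s≤s (≤-trans (≤-trans (n≤1+n 2) 3≤n) (m≤m+n n n)))
      (cong rot (solve (b ∷ []) (var 0F :- (var 0F :- :0)) :0 refl)))
    where
    go : ∀ o → pow n (ref b) o ≡ one n × 1 ≤ o × (∀ j → 1 ≤ j → j < o → pow n (ref b) j ≢ one n) → o ≡ 2
    go 1 (e , _) = contradiction (cong proj₂ e) λ ()
    go 2 _ = refl
    go (suc (suc (suc o))) (_ , _ , least) = contradiction (cong rot (solve (b ∷ []) (var 0F :- (var 0F :- :0)) :0 refl))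
      (least 2 (s≤s z≤n) (s≤s (s≤s (s≤s z≤n))))

  ord∣n : ∀ g → ord n g ∣ n
  ord∣n (a , false) = ord-rot∣n a
  ord∣n (b , true) = subst (_∣ n) (sym (ord-ref b)) 2∣n

  n∣ord-ρ : n ∣ ord n ρ
  n∣ord-ρ = mod≡𝟘⇒∣ (trans (sym (·-1 (ord n ρ))) (proj₁ (ord-rot (1 mod n))))

  -- Reflections have order two, so evenness of `n` makes every order divide `n`, and `ρ` has order
  -- `n`.
  expD≡n : expD n ≡ n
  expD≡n = ∣-antisym (upper (elements n)) (∣-trans n∣ord-ρ (lower (elements n) ρ∈))
    where
    upper : ∀ gs → foldr lcm 1 (map (ord n) gs) ∣ n
    upper [] = 1∣ n
    upper (g ∷ gs) = lcm-least (ord∣n g) (upper gs)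
    lower : ∀ gs {g} → g ∈ gs → ord n g ∣ foldr lcm 1 (map (ord n) gs)
    lower (g ∷ gs) (here refl) = m∣lcm[m,n] (ord n g) _
    lower (g ∷ gs) (there g∈) = ∣-trans (lower gs g∈) (n∣lcm[m,n] (ord n g) _)
    ρ∈ : ρ ∈ elements n
    ρ∈ = ∈-cartesianProduct⁺ (∈-allFin (1 mod n)) (there (here refl))

-- The stated forms and the least forcing lengths.

module Forms (n : ℕ) .{{_ : NonZero n}} (3≤n : 3 ≤ n) where

  open Dihedral n
  open Classification n 3≤n
  open Converse n 3≤n

  StandardForm : ℕ → D n → D n → List (D n) → Set
  StandardForm L α τ S = ∃[ r₁ ] ∃[ r₂ ] Σ[ r₃ ∈ Fin n ]
    (gcd ∣ toℕ {n} r₁ - toℕ {n} r₂ ∣ n ≡ 1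
     × S ↭ replicate (L ∸ 1) (pow n α (toℕ r₁)) ++ replicate (n ∸ 1) (pow n α (toℕ r₂)) ++ (mul n (pow n α (toℕ r₃)) τ ∷ []))

  ∣-difference : ∀ a b → n ∣ ∣ a - b ∣ → a mod n ≡ b mod n
  ∣-difference a b n∣ with ≤-total a b
  ... | inj₁ a≤b = sym (below a b a≤b (subst (n ∣_) (m≤n⇒∣m-n∣≡n∸m a≤b) n∣))
    where
    below : ∀ a b → a ≤ b → n ∣ b ∸ a → b mod n ≡ a mod n
    below a b a≤b (divides q e) = mod-cong (trans (cong (_% n) (trans (sym (m+[n∸m]≡n a≤b)) (cong (a +_) e))) ([m+kn]%n≡m%n a q n))
  ... | inj₂ b≤a = below b a b≤a (subst (n ∣_) (m≤n⇒∣n-m∣≡n∸m b≤a) n∣)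
    where
    below : ∀ a b → a ≤ b → n ∣ b ∸ a → b mod n ≡ a mod n
    below a b a≤b (divides q e) = mod-cong (trans (cong (_% n) (trans (sym (m+[n∸m]≡n a≤b)) (cong (a +_) e))) ([m+kn]%n≡m%n a q n))

  -- With `q = n / g` the number `n` divides `q · d`, hence `q · x = 0`. The order of `x` forces
  -- `q = n` and so `g = 1`.
  generator⇒coprime : ∀ c x → (∀ j → 1 ≤ j → j < n → j · x ≢ 𝟘) → gcd ∣ toℕ c - toℕ (c ⊕ x) ∣ n ≡ 1
  generator⇒coprime c x ≢0 = go (gcd[m,n]∣n d n)
    where
    d = ∣ toℕ c - toℕ (c ⊕ x) ∣
    g = gcd d n
    1≤n : 1 ≤ n
    1≤n = ≤-trans (s≤s z≤n) 3≤n
    go : g ∣ n → g ≡ 1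
    go (divides q n≡) = *-cancelˡ-≡ g 1 n (trans (sym (cong (_* g) q≡n)) (trans (sym n≡) (sym (*-identityʳ n))))
      where
      1≤q : ∀ p → n ≡ p * g → 1 ≤ p
      1≤q zero e = contradiction (≤-trans 1≤n (≤-reflexive e)) λ ()
      1≤q (suc p) _ = s≤s z≤n
      q·y≡q·c : q · (c ⊕ x) ≡ q · c
      q·y≡q·c = trans (·-mod q (c ⊕ x)) (trans (sym (∣-difference (q * toℕ c) (q * toℕ (c ⊕ x))
        (subst (n ∣_) (*-distribˡ-∣-∣ q (toℕ c) (toℕ (c ⊕ x))) (subst (_∣ q * d) (sym n≡) (*-monoʳ-∣ q (gcd[m,n]∣m d n))))))
        (sym (·-mod q c)))
      q·x≡𝟘 : q · x ≡ 𝟘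
      q·x≡𝟘 = ⊕-cancelˡ (q · c) (trans (sym (×-distrib-+ c x q)) (trans q·y≡q·c (sym (⊕-identityʳ (q · c)))))
      q≡n : q ≡ n
      q≡n = ≤-antisym (∣⇒≤ (divides g (trans n≡ (*-comm q g)))) (≮⇒≥ λ q<n → ≢0 q (1≤q q n≡) q<n q·x≡𝟘)

  standard⇒form : ∀ {L S} → Standard L S → StandardForm L ρ σ S
  standard⇒form st = c , c ⊕ x , b , generator⇒coprime c x multiple≢𝟘 ,
    ↭-trans shape (↭-reflexive (cong₂ _++_ (cong₂ replicate (cong (_∸ 1) suc-l) (sym (pow-ρ c)))
      (cong₂ _++_ (cong₂ replicate (cong (_∸ 1) suc-m) (sym (pow-ρ (c ⊕ x)))) (cong [_] (sym (normalForm-ρσ (b , true)))))))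
    where open Standard st

  form⇒standard : ∀ {L S α τ} → 1 ≤ L → Presentation n α τ → StandardForm L α τ S → Standard L S
  form⇒standard {L} {S} {α} {τ} 1≤L pres (r₁ , r₂ , r₃ , coprime , p) = record
    { c = c ; x = y ⊟ c ; b = toℕ r₃ · a ⊕ t ; l = L ∸ 1 ; m = n ∸ 1
    ; suc-l = trans (+-comm 1 (L ∸ 1)) (m∸n+n≡m 1≤L)
    ; suc-m = trans (+-comm 1 (n ∸ 1)) (m∸n+n≡m (≤-trans (s≤s z≤n) 3≤n))
    ; shape = ↭-trans p (↭-reflexive (cong₂ _++_ (cong (replicate (L ∸ 1)) (pow-α (toℕ r₁)))
        (cong₂ _++_ (cong (replicate (n ∸ 1)) (trans (pow-α (toℕ r₂)) (cong rot y≡))) (cong [_] (mul-τ (toℕ r₃))))))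
    ; multiple≢𝟘 = multiple≢𝟘 }
    where
    open FromPresentation pres
    c y : G
    c = toℕ r₁ · a
    y = toℕ r₂ · a
    y≡ : y ≡ c ⊕ (y ⊟ c)
    y≡ = solve (c ∷ y ∷ []) (var 1F) (var 0F :+ (var 1F :- var 0F)) refl
    multiple≢𝟘 : ∀ j → 1 ≤ j → j < n → j · (y ⊟ c) ≢ 𝟘
    -- A vanishing multiple means `j r₁ a = j r₂ a`, so `n` divides `j · |r₁ - r₂|`, and by
    -- coprimality it divides `j`.
    multiple≢𝟘 j 1≤j j<n e = <⇒≱ j<n (∣⇒≤ {{>-nonZero 1≤j}} n∣j)
      where
      j·c≡j·y : j · c ≡ j · y
      j·c≡j·y = trans (sym (⊕-identityʳ (j · c))) (trans (cong (j · c ⊕_) (sym e))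
        (trans (sym (×-distrib-+ c (y ⊟ c) j)) (cong (j ·_) (sym y≡))))
      n∣j*d : n ∣ j * ∣ toℕ r₁ - toℕ r₂ ∣
      n∣j*d = subst (n ∣_) (sym (*-distribˡ-∣-∣ j (toℕ r₁) (toℕ r₂)))
        (order-difference (j * toℕ r₁) (j * toℕ r₂)
          (trans (sym (×-assocˡ a j (toℕ r₁))) (trans j·c≡j·y (×-assocˡ a j (toℕ r₂)))))
      n∣j : n ∣ j
      n∣j = coprime-divisor (coprime-sym (gcd≡1⇒coprime {∣ toℕ r₁ - toℕ r₂ ∣} {n} coprime))
        (subst (n ∣_) (*-comm j ∣ toℕ r₁ - toℕ r₂ ∣) n∣j*d)

  ExceptionalForm : D n → D n → List (D n) → Set
  ExceptionalForm α τ S = S ↭ replicate 5 (one n) ++ (τ ∷ mul n α τ ∷ mul n (pow n α 2) τ ∷ [])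

  exceptional⇒form : ∀ {L S} → Exceptional L S → ExceptionalForm ρ σ S
  exceptional⇒form (_ , _ , p) = ↭-trans p (↭-reflexive (cong (λ B → replicate 5 (one n) ++ (σ ∷ B))
    (cong₂ (λ x y → x ∷ y ∷ []) (cong ref (sym (⊕-identityʳ (1 mod n))))
      (sym (trans (cong (λ g → mul n g σ) (trans (pow-rot (1 mod n) 2) (cong rot (·-1 2)))) (cong ref (⊕-identityʳ (2 mod n))))))))

  form⇒exceptional : ∀ {S α τ} → Presentation n α τ → ExceptionalForm α τ S →
    ∃ λ B → S ↭ map rot (replicate 5 𝟘) ++ map ref B × Unique B × length B ≡ 3
  form⇒exceptional {S} {α} {τ} pres p = t ∷ (a ⊕ t) ∷ (2 · a ⊕ t) ∷ [] ,
    ↭-trans p (↭-reflexive (cong (replicate 5 (one n) ++_) (cong₂ _∷_ (proj₂ τ-ref)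
      (cong₂ (λ x y → x ∷ y ∷ []) (cong₂ (mul n) (proj₂ α-rot) (proj₂ τ-ref)) (mul-τ 2))))) ,
    ((≢₀₁ ∷ ≢₀₂ ∷ []) ∷ (≢₁₂ ∷ []) ∷ [] ∷ []) , refl
    where
    open FromPresentation pres
    a≢𝟘 : a ≢ 𝟘
    a≢𝟘 e = <⇒≱ 3≤n (≤-trans (∣⇒≤ (order-a 1 (trans (⊕-identityʳ a) e))) (s≤s z≤n))
    2a≢𝟘 : 2 · a ≢ 𝟘
    2a≢𝟘 e = <⇒≱ 3≤n (∣⇒≤ (order-a 2 e))
    ≢₀₁ : t ≢ a ⊕ t
    ≢₀₁ e = a≢𝟘 (≡-diff (sym e) (solve (a ∷ t ∷ []) (var 0F :- :0) ((var 0F :+ var 1F) :- var 1F) refl))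
    ≢₀₂ : t ≢ 2 · a ⊕ t
    ≢₀₂ e = 2a≢𝟘 (≡-diff (sym e) (solve (2 · a ∷ t ∷ []) (var 0F :- :0) ((var 0F :+ var 1F) :- var 1F) refl))
    ≢₁₂ : a ⊕ t ≢ 2 · a ⊕ t
    ≢₁₂ e = a≢𝟘 (≡-diff (sym e) (solve (a ∷ t ∷ []) (var 0F :- :0) (((var 0F :+ (var 0F :+ :0)) :+ var 1F) :- (var 0F :+ var 1F)) refl))

  module Length (L t : ℕ) (n≤L : n ≤ L) (n∣L : n ∣ L) (L≤2n : L ≤ n + n) (L≡ : suc t + suc t ≡ L)
    (cases : 4 ≤ n ⊎ (n ≡ 3 × L ≡ 6)) where

    open Inverse L t n≤L n∣L L≤2n L≡ cases using (inverse)

    1≤L : 1 ≤ L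
    1≤L = ≤-trans (≤-trans (s≤s z≤n) 3≤n) n≤L

    standard-length : ∀ {S} → Standard L S → suc (length S) ≡ L + n
    standard-length st = trans (cong suc (trans (↭-length shape) (trans (length-++ (replicate l (rot c)))
      (cong₂ _+_ (length-replicate l) (trans (length-++ (replicate m (rot (c ⊕ x)))) (trans (cong (_+ 1) (length-replicate m)) (+-comm m 1)))))))
      (cong₂ _+_ suc-l suc-m)
      where open Standard st

    -- For `forces` only the odd number of reflections and the presence of a rotation matter.
    one-or-three : ∀ {S} → Standard L S ⊎ Exceptional L S → (length (refs S) ≡ 1 ⊎ length (refs S) ≡ 3) × 1 ≤ length (rots S)
    one-or-three (inj₁ st) = inj₁ (↭-length (standard-refs st)) ,
      ≤-trans (positive (suc-injective (trans suc-l (sym (suc-pred-L 1≤L)))))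
        (≤-reflexive (sym (trans (↭-length (standard-rots st)) (trans (length-++ (replicate l c)) (cong (_+ _) (length-replicate l))))))
      where
      open Standard st
      suc-pred-L : 1 ≤ L → suc (L ∸ 1) ≡ L
      suc-pred-L 1≤ = trans (+-comm 1 (L ∸ 1)) (m∸n+n≡m 1≤)
      positive : l ≡ L ∸ 1 → 1 ≤ l + length (replicate m (c ⊕ x))
      positive eq = ≤-trans (≤-trans (s≤s z≤n) (≤-trans (∸-monoˡ-≤ 1 (≤-trans 3≤n n≤L)) (≤-reflexive (sym eq)))) (m≤m+n l _)
    one-or-three (inj₂ (n≡3 , L≡6 , p)) = inj₂ (↭-length (exceptional-refs p)) ,
      ≤-trans (s≤s z≤n) (≤-reflexive (sym (↭-length (exceptional-rots p))))

    -- If S′ of length L + n − 1 plus one more element had no product-one subsequence of length L,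
    -- deleting a rotation and deleting a reflection would both leave 1 or 3 reflections.
    forces : Forces n L (L + n)
    forces S L+n≤ with hasP1Sub? L S
    ... | yes p1 = p1
    ... | no ¬p1 = ⊥-elim (split (splitAt-length (L + n) S L+n≤))
      where
      classify : ∀ g X Y → S ↭ (g ∷ X) ++ Y → length (g ∷ X) ≡ L + n → Standard L X ⊎ Exceptional L X
      classify g X Y p |gX| = inverse X |gX| λ (T , U , q , r) →
        ¬p1 (T , U ++ (g ∷ Y) , ↭-trans p (↭-trans (↭-sym (shift g X Y)) (↭-trans (++⁺ʳ (g ∷ Y) q) (++-assoc T U (g ∷ Y)))) , r)
      with-both : ∀ g X Y → S ↭ (g ∷ X) ++ Y → length (g ∷ X) ≡ L + n → ∀ A B → rots X ≡ A → refs X ≡ B →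
        1 ≤ length A → 1 ≤ length B → ⊥
      with-both g X Y p |gX| (i ∷ A) (j ∷ B) A≡ B≡ _ _ =
        incompatible (proj₁ (one-or-three (classify (rot i) (g ∷ X₁) Y (↭-trans p (++⁺ʳ Y gX↭₁)) (trans (sym (↭-length gX↭₁)) |gX|))))
                     (proj₁ (one-or-three (classify (ref j) (g ∷ X₂) Y (↭-trans p (++⁺ʳ Y gX↭₂)) (trans (sym (↭-length gX↭₂)) |gX|))))
        where
        X₁ = map rot A ++ map ref (j ∷ B)
        X₂ = map rot (i ∷ A) ++ map ref B
        X↭ : X ↭ map rot (i ∷ A) ++ map ref (j ∷ B)
        X↭ = ↭-trans (split-↭ X) (↭-reflexive (cong₂ (λ A B → map rot A ++ map ref B) A≡ B≡))
        gX↭₁ : g ∷ X ↭ rot i ∷ g ∷ X₁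
        gX↭₁ = ↭-trans (prep g X↭) (swap g (rot i) ↭-refl)
        gX↭₂ : g ∷ X ↭ ref j ∷ g ∷ X₂
        gX↭₂ = ↭-trans (prep g (↭-trans X↭ (shift (ref j) (map rot (i ∷ A)) (map ref B)))) (swap g (ref j) ↭-refl)
        counts : length (refs (g ∷ X₁)) ≡ suc (length (refs (g ∷ X₂)))
        counts = trans (sym (↭-length (refs-↭ gX↭₁))) (↭-length (refs-↭ gX↭₂))
        incompatible : length (refs (g ∷ X₁)) ≡ 1 ⊎ length (refs (g ∷ X₁)) ≡ 3 →
                       length (refs (g ∷ X₂)) ≡ 1 ⊎ length (refs (g ∷ X₂)) ≡ 3 → ⊥
        incompatible (inj₁ e) (inj₁ e′) with () ← trans (sym e) (trans counts (cong suc e′))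
        incompatible (inj₁ e) (inj₂ e′) with () ← trans (sym e) (trans counts (cong suc e′))
        incompatible (inj₂ e) (inj₁ e′) with () ← trans (sym e) (trans counts (cong suc e′))
        incompatible (inj₂ e) (inj₂ e′) with () ← trans (sym e) (trans counts (cong suc e′))
      -- Deleting the head first shows that the rest contains both a rotation and a reflection, so
      -- that each kind can be deleted in turn.
      both : ∀ g X Y → S ↭ (g ∷ X) ++ Y → length (g ∷ X) ≡ L + n → ⊥
      both g X Y p |gX| = let refl-count , 1≤rots = one-or-three (classify g X Y p |gX|) in
        with-both g X Y p |gX| (rots X) (refs X) refl refl 1≤rots
          ([ (λ e → ≤-reflexive (sym e)) , (λ e → ≤-trans (s≤s z≤n) (≤-reflexive (sym e))) ]′ refl-count)
      split : (∃₂ λ X Y → S ≡ X ++ Y × length X ≡ L + n) → ⊥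
      split ([] , Y , _ , l) = contradiction (≤-trans 1≤L (≤-trans (m≤m+n L n) (≤-reflexive (sym l)))) λ ()
      split (g ∷ X , Y , e , l) = both g X Y (↭-reflexive e) l

    least : ∀ {S} → suc (length S) ≡ L + n → ¬ HasP1Sub n L S → IsLeast (Forces n L) (suc (length S)) × ¬ HasP1Sub n L S
    least {S} |S| ¬p1 = (subst (Forces n L) (sym |S|) forces , λ m forces-m → ≰⇒> λ m≤ → ¬p1 (forces-m S m≤)) , ¬p1

    example : ∃ λ S → Standard L S
    example = _ , record
      { c = 𝟘 ; x = 1 mod n ; b = 𝟘 ; l = L ∸ 1 ; m = n ∸ 1
      ; suc-l = trans (+-comm 1 (L ∸ 1)) (m∸n+n≡m 1≤L)
      ; suc-m = trans (+-comm 1 (n ∸ 1)) (m∸n+n≡m (≤-trans (s≤s z≤n) 3≤n))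
      ; shape = ↭-refl
      ; multiple≢𝟘 = λ j 1≤j j<n e → <⇒≱ j<n (∣⇒≤ {{>-nonZero 1≤j}} (mod≡𝟘⇒∣ (trans (sym (·-1 j)) e))) }

    -- The upper bound is `forces`. For the lower bound, a smaller forcing length would apply to
    -- `example`, which has length `L + n - 1` and no product-one subsequence of length `L`.
    length-of-extremal : ∀ {S : List (D n)} → IsLeast (Forces n L) (suc (length S)) → suc (length S) ≡ L + n
    length-of-extremal {S} (forces-S , minimal) = ≤-antisym (minimal (L + n) forces)
      (≮⇒≥ λ S< → let S₀ , st = example in
        standard-¬P1 st n∣L (forces-S S₀ (≤-pred (≤-trans S< (≤-reflexive (sym (standard-length st)))))))

    extremal⇒ : ∀ {S} → IsLeast (Forces n L) (suc (length S)) × ¬ HasP1Sub n L S → Standard L S ⊎ Exceptional L S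
    extremal⇒ {S} (isLeast , ¬p1) = inverse S (length-of-extremal {S} isLeast) ¬p1

    ⇒extremal : ∀ {S} → Standard L S → IsLeast (Forces n L) (suc (length S)) × ¬ HasP1Sub n L S
    ⇒extremal {S} st = least {S} (standard-length st) (standard-¬P1 st n∣L)

theorem1p2 : (n : ℕ) .{{_ : NonZero n}} → 3 ≤ n → (S : List (D n)) →
    ((4 ≤ n → 2 ∣ n →
        ((IsLeast (Forces n (expD n)) (suc (length S)) × ¬ HasP1Sub n (expD n) S)
          → ∃[ α ] ∃[ τ ] (Presentation n α τ × ∃[ r₁ ] ∃[ r₂ ] Σ[ r₃ ∈ Fin n ]
               (gcd ∣ toℕ {n} r₁ - toℕ {n} r₂ ∣ n ≡ 1
                × S ↭ replicate (n ∸ 1) (pow n α (toℕ r₁)) ++ replicate (n ∸ 1) (pow n α (toℕ r₂))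
                        ++ (mul n (pow n α (toℕ r₃)) τ ∷ []))))
        × (∃[ α ] ∃[ τ ] (Presentation n α τ × ∃[ r₁ ] ∃[ r₂ ] Σ[ r₃ ∈ Fin n ]
               (gcd ∣ toℕ {n} r₁ - toℕ {n} r₂ ∣ n ≡ 1
                × S ↭ replicate (n ∸ 1) (pow n α (toℕ r₁)) ++ replicate (n ∸ 1) (pow n α (toℕ r₂))
                        ++ (mul n (pow n α (toℕ r₃)) τ ∷ [])))
          → (IsLeast (Forces n (expD n)) (suc (length S)) × ¬ HasP1Sub n (expD n) S)))
    × (((IsLeast (Forces n (n + n)) (suc (length S)) × ¬ HasP1Sub n (n + n) S)
          → ∃[ α ] ∃[ τ ] (Presentation n α τ × CaseE n α τ S))
       × (∃[ α ] ∃[ τ ] (Presentation n α τ × CaseE n α τ S)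
          → (IsLeast (Forces n (n + n)) (suc (length S)) × ¬ HasP1Sub n (n + n) S))))
theorem1p2 n 3≤n S = (λ 4≤n 2∣n → exponent⇒ 4≤n 2∣n , exponent⇐ 4≤n 2∣n) , order⇒ , order⇐
  where
  open Forms n 3≤n
  open Classification n 3≤n using (Standard; Exceptional)
  open Converse n 3≤n using (presentation; ρ; σ; exceptional-¬P1)

  half : 4 ≤ n → ∀ q → n ≡ q * 2 → ∃ λ t → suc t + suc t ≡ n
  half 4≤n zero e = contradiction (≤-trans 4≤n (≤-reflexive e)) λ ()
  half 4≤n (suc t) e = t , sym (trans e (trans (*-comm (suc t) 2) (cong (suc t +_) (+-identityʳ (suc t)))))

  module Even (4≤n : 4 ≤ n) (2∣n : 2 ∣ n) where
    t = half 4≤n (quotient 2∣n) (_∣_.equality 2∣n)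
    open Length n (proj₁ t) ≤-refl ∣-refl (m≤m+n n n) (proj₂ t) (inj₁ 4≤n) public
    open Exponent n 3≤n 2∣n public using (expD≡n)

  not-three : 4 ≤ n → n ≢ 3
  not-three 4≤n refl = <-irrefl refl 4≤n

  exponent⇒ : 4 ≤ n → 2 ∣ n → IsLeast (Forces n (expD n)) (suc (length S)) × ¬ HasP1Sub n (expD n) S →
    ∃[ α ] ∃[ τ ] (Presentation n α τ × StandardForm n α τ S)
  exponent⇒ 4≤n 2∣n ext = ρ , σ , presentation ,
    [ standard⇒form , (λ exc → contradiction (proj₁ exc) (not-three 4≤n)) ]′
      (extremal⇒ {S} (subst (λ L → IsLeast (Forces n L) (suc (length S)) × ¬ HasP1Sub n L S) expD≡n ext))
    where open Even 4≤n 2∣n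

  exponent⇐ : 4 ≤ n → 2 ∣ n → ∃[ α ] ∃[ τ ] (Presentation n α τ × StandardForm n α τ S) →
    IsLeast (Forces n (expD n)) (suc (length S)) × ¬ HasP1Sub n (expD n) S
  exponent⇐ 4≤n 2∣n (α , τ , pres , form) =
    subst (λ L → IsLeast (Forces n L) (suc (length S)) × ¬ HasP1Sub n L S) (sym expD≡n)
      (⇒extremal (form⇒standard 1≤L pres form))
    where open Even 4≤n 2∣n

  suc-pred-n : suc (n ∸ 1) ≡ n
  suc-pred-n = trans (+-comm 1 (n ∸ 1)) (m∸n+n≡m (≤-trans (s≤s z≤n) 3≤n))

  size : 4 ≤ n ⊎ n ≡ 3
  size = [ inj₁ , (λ 3≡n → inj₂ (sym 3≡n)) ]′ (m≤n⇒m<n∨m≡n 3≤n)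

  small : 4 ≤ n ⊎ n ≡ 3 → 4 ≤ n ⊎ (n ≡ 3 × n + n ≡ 6)
  small (inj₁ 4≤n) = inj₁ 4≤n
  small (inj₂ n≡3) = inj₂ (n≡3 , cong₂ _+_ n≡3 n≡3)

  open Length (n + n) (n ∸ 1) (m≤m+n n n) (∣m∣n⇒∣m+n ∣-refl ∣-refl) ≤-refl (cong₂ _+_ suc-pred-n suc-pred-n) (small size)

  order⇒ : IsLeast (Forces n (n + n)) (suc (length S)) × ¬ HasP1Sub n (n + n) S →
    ∃[ α ] ∃[ τ ] (Presentation n α τ × CaseE n α τ S)
  order⇒ ext = ρ , σ , presentation , [ standard size ∘ standard⇒form , exceptional ]′ (extremal⇒ {S} ext)
    where
    standard : 4 ≤ n ⊎ n ≡ 3 → StandardForm (n + n) ρ σ S → CaseE n ρ σ S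
    standard (inj₁ 4≤n) form = inj₁ (4≤n , form)
    -- For `n = 3` the multiplicities `2n - 1` and `n - 1` evaluate to the stated `5` and `2`.
    standard (inj₂ refl) form = inj₂ (refl , inj₂ form)
    exceptional : Exceptional (n + n) S → CaseE n ρ σ S
    exceptional exc@(n≡3 , _) = inj₂ (n≡3 , inj₁ (exceptional⇒form {n + n} exc))

  order⇐ : ∃[ α ] ∃[ τ ] (Presentation n α τ × CaseE n α τ S) →
    IsLeast (Forces n (n + n)) (suc (length S)) × ¬ HasP1Sub n (n + n) S
  order⇐ (α , τ , pres , inj₁ (_ , form)) = ⇒extremal (form⇒standard 1≤L pres form)
  order⇐ (α , τ , pres , inj₂ (refl , inj₂ form)) = ⇒extremal (form⇒standard 1≤L pres form)
  order⇐ (α , τ , pres , inj₂ (refl , inj₁ form)) =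
    let B , p , uB , |B| = form⇒exceptional pres form
    in least {S} (cong suc (trans (↭-length form) refl)) (exceptional-¬P1 p uB |B|)
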